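{- There is a polynomial-time algorithm that, given any instance of the Machine-Loads-Identical-Jobs (MLIJ) problem with $d$ machines and any $\alpha>4$, finds a portfolio $X$ of size $$|X| = O\left(\frac{\log d}{\log(\alpha/4)}\right)$$ that is (i) $\alpha$-approximate for ordered norms and (ii) $O(\alpha\log d)$-approximate for symmetric monotonic norms. Further, there exists a family of instances of MLIJ for which the size of any $\alpha$-approximate portfolio for ordered norms is lower bounded by $\Omega\left(\frac{\log d}{\log\alpha+\log\log d}\right)$. This characterizes the size-approximation trade-off for $\alpha>4$.
   Context: MLIJ: an instance consists of $n$ copies of a job and $d$ machines with processing times $p_1,\dots,p_d>0$. A schedule assigns $n_i\in\mathbb{Z}_{\ge 0}$ jobs to machine $i$ with $\sum_{i=1}^d n_i=n$; its load vector is $(n_1p_1,\dots,n_dp_d)\in\mathbb{R}^d_{\ge 0}$. The set $\mathcal{D}$ of feasible vectors is the set of all such load vectors. Norms: for $x\in\mathbb{R}^d$, $|x|^{\downarrow}$ is the vector of absolute values of coordinates of $x$ sorted in decreasing order. A weight vector is a nonzero $w\in\mathbb{R}^d$ with $w_1\ge\dots\ge w_d\ge 0$; the corresponding ordered norm is $\|x\|_{(w)}=w^\top|x|^{\downarrow}$. A symmetric monotonic norm on $\mathbb{R}^d$ is a norm that is invariant under permutations of coordinates and monotone (nondecreasing) in each coordinate. Portfolio: given $\mathcal{D}$, a class $\mathbf{C}$ of functions $\mathcal{D}\to\mathbb{R}_{\ge 0}$ and $\alpha\ge 1$, a set $X\subseteq\mathcal{D}$ is an $\alpha$-approximate portfolio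 for $\mathbf{C}$ if $\min_{x\in X}f(x)\le\alpha\min_{x\in\mathcal{D}}f(x)$ for every $f\in\mathbf{C}$. Its size is $|X|$.
   Formalization: The bounds are O(1 + log d/log(α/4)) and O(α(1 + log d)), since the literal ones fail for d = 1 and, for the size, when α is far above d; the polynomial-time algorithm takes rational processing times and α, while for real data the portfolio is shown to exist. -}

module Defs where

open import Algebra.Bundles using (CommutativeRing)
import Algebra.Definitions.RawMonoid as RawMonoidOps
open import Data.Bool.Base using (if_then_else_; _∧_)
open import Data.Fin.Base as Fin using (Fin; toℕ)
open import Data.Fin.Permutation using (Permutation′; _⟨$⟩ʳ_)
open import Data.Integer.Base as ℤ using (ℤ; +_; -[1+_])
open import Data.List.Base as List using (List; []; _∷_; length)
open import Data.List.Membership.Propositional using (_∈_)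
open import Data.List.Properties using (length-tabulate)
open import Data.List.Relation.Binary.Permutation.Propositional.Properties using (↭-length)
open import Data.List.Relation.Unary.All using (All)
import Data.List.Sort as Sort
open import Data.Nat.Base as ℕ using (ℕ; zero; suc; _≡ᵇ_)
open import Data.Nat.Logarithm using (⌊log₂_⌋)
open import Data.Nat.ListAction using () renaming (sum to sumᴸ)
open import Data.Product.Base using (∃; ∃₂; _×_)
open import Data.Rational.Base using (ℚ; ↥_; ↧ₙ_)
open import Data.Vec.Functional using (Vector)
open import Level using (0ℓ)
open import Relation.Binary.Bundles using (DecTotalOrder)
open import Relation.Binary.Core using (Rel)
import Relation.Binary.Construct.Flip.EqAndOrd as Flip
open import Relation.Binary.PropositionalEquality as ≡ using (_≡_; _≢_)
open import Relation.Binary.Structures using (IsDecTotalOrder)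
open import Relation.Nullary using (¬_; does)
open import Relation.Unary using (Pred)

-- The real numbers, given axiomatically as a Dedekind-complete ordered
-- field.  The order is decidable and every inhabited bounded predicate has
-- a supremum: these are the reals of classical mathematics, unique up to
-- isomorphism.  The value of 0# ⁻¹ is unspecified.

record RealField : Set₁ where
  infix  4 _≤_ _<_
  infixl 7 _/_
  infix  8 _⁻¹
  field
    commutativeRing : CommutativeRing 0ℓ 0ℓ
  open CommutativeRing commutativeRing public
  field
    _≤_             : Rel Carrier 0ℓ
    isDecTotalOrder : IsDecTotalOrder _≈_ _≤_
    _⁻¹             : Carrier → Carrier
    0≉1             : ¬ 0# ≈ 1#
    ⁻¹-inverseʳ     : ∀ x → ¬ x ≈ 0# → x * x ⁻¹ ≈ 1#
    +-monoˡ-≤       : ∀ z {x y} → x ≤ y → x + z ≤ y + z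
    *-nonNegative   : ∀ {x y} → 0# ≤ x → 0# ≤ y → 0# ≤ x * y

  UpperBound : Pred Carrier 0ℓ → Pred Carrier 0ℓ
  UpperBound P b = ∀ x → P x → x ≤ b

  field
    supremum : ∀ (P : Pred Carrier 0ℓ) → ∃ P → ∃ (UpperBound P) →
               ∃ λ s → UpperBound P s × (∀ b → UpperBound P b → s ≤ b)

  decTotalOrder : DecTotalOrder 0ℓ 0ℓ 0ℓ
  decTotalOrder = record { isDecTotalOrder = isDecTotalOrder }

  open IsDecTotalOrder isDecTotalOrder public using (_≤?_)

  _<_ : Rel Carrier 0ℓ
  x < y = x ≤ y × ¬ x ≈ y

  _/_ : Carrier → Carrier → Carrier
  x / y = x * y ⁻¹

  ∣_∣ : Carrier → Carrier
  ∣ x ∣ = if does (0# ≤? x) then x else - x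

  open RawMonoidOps +-rawMonoid public using (sum) renaming (_×_ to _·_)

  fromℕ : ℕ → Carrier
  fromℕ n = n · 1#

  fromℤ : ℤ → Carrier
  fromℤ (+ n)    = fromℕ n
  fromℤ -[1+ n ] = - fromℕ (suc n)

  fromℚ : ℚ → Carrier
  fromℚ q = fromℤ (↥ q) / fromℕ (↧ₙ q)

-- The natural logarithm on positive reals: the two laws ln-* and
-- ln-≤ determine it uniquely (they give 1 - 1/x ≤ ln x ≤ x - 1).
-- Values at non-positive arguments are unspecified.

record NaturalLog (R : RealField) : Set where
  open RealField R
  field
    ln      : Carrier → Carrier
    ln-cong : ∀ {x y} → 0# < x → x ≈ y → ln x ≈ ln y
    ln-*    : ∀ {x y} → 0# < x → 0# < y → ln (x * y) ≈ ln x + ln y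
    ln-≤    : ∀ {x} → 0# < x → ln x ≤ x - 1#

-- Random access machines with logarithmic cost, as structured programs over
-- finitely many named arrays of natural numbers.  Every operation is charged
-- one plus the bit lengths of its operands (for an array access: of the index
-- and the contents).

module Machine where

  infixl 6 _⊕_ _⊖_
  infixl 7 _⊗_ _⊘_
  infix  8 _[_]
  infix  4 _[_]≔_
  infixr 3 _⍮_

  data Expr : Set where
    lit  : ℕ → Expr
    _[_] : ℕ → Expr → Expr
    _⊕_ _⊖_ _⊗_ _⊘_ : Expr → Expr → Expr

  data Cmd : Set where
    skip      : Cmd
    _[_]≔_    : ℕ → Expr → Expr → Cmd
    _⍮_       : Cmd → Cmd → Cmd
    If_Then_Else_ : Expr → Cmd → Cmd → Cmd
    While_Do_ : Expr → Cmd → Cmd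

  -- Contents of each array at each index.
  Store : Set
  Store = ℕ → ℕ → ℕ

  update : Store → ℕ → ℕ → ℕ → Store
  update s a i v b j = if (b ≡ᵇ a) ∧ (j ≡ᵇ i) then v else s b j

  bits : ℕ → ℕ
  bits n = suc ⌊log₂ n ⌋

  quotient : ℕ → ℕ → ℕ
  quotient m zero    = 0
  quotient m (suc n) = m ℕ./ suc n

  eval : Expr → Store → ℕ
  eval (lit n)   s = n
  eval (a [ e ]) s = s a (eval e s)
  eval (e ⊕ f)   s = eval e s ℕ.+ eval f s
  eval (e ⊖ f)   s = eval e s ℕ.∸ eval f s
  eval (e ⊗ f)   s = eval e s ℕ.* eval f s
  eval (e ⊘ f)   s = quotient (eval e s) (eval f s)

  cost : Expr → Store → ℕ
  binaryCost : Expr → Expr → Store → ℕ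

  cost (lit n)   s = suc (bits n)
  cost (a [ e ]) s = suc (cost e s ℕ.+ bits (eval e s) ℕ.+ bits (s a (eval e s)))
  cost (e ⊕ f)   s = binaryCost e f s
  cost (e ⊖ f)   s = binaryCost e f s
  cost (e ⊗ f)   s = binaryCost e f s
  cost (e ⊘ f)   s = binaryCost e f s

  binaryCost e f s =
    suc (cost e s ℕ.+ cost f s ℕ.+ bits (eval e s) ℕ.+ bits (eval f s))

  -- Run c s t s′: started in s, the program c halts in s′ at total cost t.
  data Run : Cmd → Store → ℕ → Store → Set where
    skip   : ∀ {s} → Run skip s 1 s
    assign : ∀ {a e f s} →
             Run (a [ e ]≔ f) s
                 (suc (cost e s ℕ.+ cost f s ℕ.+ bits (eval e s) ℕ.+ bits (eval f s)))
                 (update s a (eval e s) (eval f s))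
    seq    : ∀ {c c′ s s′ s″ t t′} → Run c s t s′ → Run c′ s′ t′ s″ →
             Run (c ⍮ c′) s (suc (t ℕ.+ t′)) s″
    if≢0   : ∀ {e c c′ s s′ t} → eval e s ≢ 0 → Run c s t s′ →
             Run (If e Then c Else c′) s (suc (cost e s ℕ.+ t)) s′
    if≡0   : ∀ {e c c′ s s′ t} → eval e s ≡ 0 → Run c′ s t s′ →
             Run (If e Then c Else c′) s (suc (cost e s ℕ.+ t)) s′
    while≢0 : ∀ {e c s s′ s″ t t′} → eval e s ≢ 0 →
              Run c s t s′ → Run (While e Do c) s′ t′ s″ →
              Run (While e Do c) s (suc (cost e s ℕ.+ t ℕ.+ t′)) s″
    while≡0 : ∀ {e c s} → eval e s ≡ 0 →
              Run (While e Do c) s (suc (cost e s)) s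

  -- The list, padded with zeros.
  contents : List ℕ → ℕ → ℕ
  contents []       _       = 0
  contents (x ∷ xs) zero    = x
  contents (x ∷ xs) (suc i) = contents xs i

  -- Input for n jobs, positive rational processing times p and a positive
  -- rational a.  Array 0 holds n, d and the numerator and denominator of a;
  -- arrays 1 and 2 hold the numerators and denominators of p.
  num : ℚ → ℕ
  num q = ℤ.∣ ↥ q ∣

  input : ∀ {d} → ℕ → Vector ℚ d → ℚ → Store
  input {d} n p a 0 = contents (n ∷ d ∷ num a ∷ ↧ₙ a ∷ [])
  input {d} n p a 1 = contents (List.tabulate λ i → num (p i))
  input {d} n p a 2 = contents (List.tabulate λ i → ↧ₙ (p i))
  input {d} n p a _ = contents []

  ratBits : ℚ → ℕ
  ratBits q = bits (num q) ℕ.+ bits (↧ₙ q)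

  inputSize : ∀ {d} → ℕ → Vector ℚ d → ℚ → ℕ
  inputSize {d} n p a =
    bits n ℕ.+ bits d ℕ.+ ratBits a ℕ.+ sumᴸ (List.tabulate λ i → ratBits (p i))

  -- Output: the number of schedules is in array 3 at index 0; the number of
  -- jobs that schedule j places on machine i is in array 4 at index j * d + i.
  output : (d : ℕ) → Store → List (Vector ℕ d)
  output d s = List.applyUpTo (λ j i → s 4 (j ℕ.* d ℕ.+ toℕ i)) (s 3 0)

module Portfolios (R : RealField) (L : NaturalLog R) where

  open RealField R
  open NaturalLog L

  Point : ℕ → Set
  Point d = Vector Carrier d

  toList : ∀ {d} → Point d → List Carrier
  toList = List.tabulate

  -- Sorting with respect to the reversed order, so that the result decreases.
  open Sort (Flip.decTotalOrder decTotalOrder) using (sort; sort-↭)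

  ∣_∣↓ : ∀ {d} → Point d → Point d
  ∣_∣↓ {d} x i = List.lookup (sort xs) (Fin.cast (≡.sym length≡d) i)
    where
    xs : List Carrier
    xs = toList λ j → ∣ x j ∣

    length≡d : length (sort xs) ≡ d
    length≡d = ≡.trans (↭-length (sort-↭ xs)) (length-tabulate _)

  record IsWeight {d} (w : Point d) : Set where
    field
      nonZero     : ∃ λ i → ¬ w i ≈ 0#
      decreasing  : ∀ i j → i Fin.≤ j → w j ≤ w i
      nonNegative : ∀ i → 0# ≤ w i

  ‖_‖⟨_⟩ : ∀ {d} → Point d → Point d → Carrier
  ‖ x ‖⟨ w ⟩ = sum λ i → w i * ∣ x ∣↓ i

  IsOrderedNorm : ∀ {d} → Pred (Point d → Carrier) 0ℓ
  IsOrderedNorm f = ∃ λ w → IsWeight w × (∀ x → f x ≈ ‖ x ‖⟨ w ⟩)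

  record IsNorm {d} (f : Point d → Carrier) : Set where
    field
      cong        : ∀ {x y} → (∀ i → x i ≈ y i) → f x ≈ f y
      nonNegative : ∀ x → 0# ≤ f x
      definite    : ∀ x → f x ≈ 0# → ∀ i → x i ≈ 0#
      homogeneous : ∀ c x → f (λ i → c * x i) ≈ ∣ c ∣ * f x
      triangle    : ∀ x y → f (λ i → x i + y i) ≤ f x + f y

  -- A norm is even, so it can only be monotone on the non-negative orthant.
  record IsSymmetricMonotonicNorm {d} (f : Point d → Carrier) : Set where
    field
      isNorm    : IsNorm f
      symmetric : ∀ (σ : Permutation′ d) x → f (λ i → x (σ ⟨$⟩ʳ i)) ≈ f x
      monotone  : ∀ x y → (∀ i → 0# ≤ x i) → (∀ i → x i ≤ y i) → f x ≤ f y

  record MLIJ (d : ℕ) : Set where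
    field
      n   : ℕ
      p   : Point d
      p>0 : ∀ i → 0# < p i

    loads : Vector ℕ d → Point d
    loads m i = fromℕ (m i) * p i

    IsSchedule : Vector ℕ d → Set
    IsSchedule m = sumᴸ (List.tabulate m) ≡ n

    Feasible : Pred (Point d) 0ℓ
    Feasible x = ∃ λ m → IsSchedule m × (∀ i → x i ≈ loads m i)

  open MLIJ

  IsMinimiser : ∀ {d} → (Point d → Carrier) → Pred (Point d) 0ℓ → Pred (Point d) 0ℓ
  IsMinimiser f D x = D x × (∀ y → D y → f x ≤ f y)

  -- The set X is given by a list, possibly with repetitions.
  record IsPortfolio {d} (I : MLIJ d) (C : Pred (Point d → Carrier) 0ℓ)
                     (α : Carrier) (X : List (Point d)) : Set where
    field
      feasible    : All (Feasible I) X
      approximate : ∀ f → C f → ∃₂ λ x y →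
                    IsMinimiser f (_∈ X) x × IsMinimiser f (Feasible I) y ×
                    f x ≤ α * f y

  -- The summands 1# make the bounds meaningful when d = 1 (where ln d = 0, but
  -- portfolios are nonempty and factors at least 1) and when α / 4 > d.
  record IsGoodPortfolio {d} (K : Carrier) (I : MLIJ d) (α : Carrier)
                         (X : List (Point d)) : Set where
    field
      size      : fromℕ (length X) ≤ K * (1# + ln (fromℕ d) / ln (α / fromℕ 4))
      ordered   : IsPortfolio I IsOrderedNorm α X
      symmetric : IsPortfolio I IsSymmetricMonotonicNorm
                    (K * (α * (1# + ln (fromℕ d)))) X

-- Sort the machines by processing time, let S k be the total speed (the sum of
-- 1 / p) of the k fastest machines and F k the norm of their indicator vector.
-- Fractionally, balancing n jobs on them costs n F k / S k; rounding up adds at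
-- most the norm of their processing times, and every schedule that uses at
-- least k machines pays as much.  For an ordered norm, summation by parts
-- yields a k for which the fractional cost is at most that of a given schedule.
-- For a symmetric monotonic norm f and a schedule with sorted loads z, one has
-- z k * F k ≤ f z, and the k-th speed is at most S k / k, so that some k loses
-- only the factor 1 + 1/2 + … + 1/d ≤ 1 + ln d.  Since F increases and S k / k
-- decreases, k may be rounded down to a power of b at the cost of a factor b.
-- The choice b = ⌊α⌋ - 1 (at most d + 3 in the existence proof) gives the total
-- factor b + 1 ≤ α and about log d / log b schedules.
--
-- The program makes the speeds integral by multiplying them with the product of
-- the numerators of the processing times.
--
-- For the lower bound, the machines have speeds about 1 / √i and the norms are
-- 4 ^ t * max + sum.  A vector that is α-approximate for the norms of both t and
-- t + 2h forces 2 ^ h ≤ 8 α, so the pigeonhole principle bounds the portfolio.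

module Submission where

open import Defs
open import Algebra.Bundles using (CommutativeRing)
import Algebra.Properties.Ring
import Algebra.Properties.Semiring.Mult
import Algebra.Properties.Semiring.Sum
import Algebra.Solver.Ring
open import Algebra.Solver.Ring.AlmostCommutativeRing using (AlmostCommutativeRing; fromCommutativeRing; _-Raw-AlmostCommutative⟶_)
open import Data.Bool.Base using (Bool; true; false; if_then_else_; _∧_; _∨_)
open import Data.Fin.Base as Fin using (Fin; zero; suc; toℕ; fromℕ<)
import Data.Fin.Permutation as Perm
open import Data.Fin.Permutation using (Permutation; Permutation′; _⟨$⟩ʳ_; _⟨$⟩ˡ_)
import Data.Fin.Properties as Finₚ
open import Data.Integer.Base as ℤ using (ℤ; +_; -[1+_])
import Data.Integer.Properties as ℤₚ
open import Data.List.Base as List using (List; []; _∷_; length; map)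
open import Data.List.Membership.Propositional using (_∈_)
import Data.List.Membership.Propositional.Properties as ∈ₚ
open import Data.List.Properties using (length-tabulate; length-map; length-applyUpTo; tabulate-cong)
import Data.List.Relation.Binary.Permutation.Propositional as Permˡ
open Permˡ using (_↭_; ↭⇒↭ₛ; ↭-sym; ↭-trans; ↭-refl)
import Data.List.Relation.Binary.Permutation.Propositional.Properties as Permˡₚ
open import Data.List.Relation.Binary.Permutation.Homogeneous using (onIndices)
import Data.List.Relation.Binary.Permutation.Setoid.Properties as Permˢₚ
open import Data.List.Relation.Unary.All as All using (All; []; _∷_)
import Data.List.Relation.Unary.All.Properties as Allₚ
open import Data.List.Relation.Unary.AllPairs using (AllPairs; []; _∷_)
open import Data.List.Relation.Unary.Any as Any using (here; there)
import Data.List.Relation.Unary.Any.Properties as Anyₚ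
import Data.List.Relation.Unary.Sorted.TotalOrder.Properties as Sortedₚ
import Data.List.Sort
open import Data.Maybe.Base using (Maybe; just; nothing)
open import Data.Nat.Base as ℕ using (ℕ; NonZero; zero; suc; z≤n; s≤s; z<s; _<ᵇ_; _≡ᵇ_)
import Data.Nat.DivMod as ℕᵈ
open import Data.Nat.ListAction using () renaming (sum to sumᴸ)
open import Data.Nat.Logarithm using (⌊log₂⌋-mono-≤; ⌊log₂[2^n]⌋≡n)
import Data.Nat.ListAction.Properties as ListActionₚ
import Data.Nat.Properties as ℕₚ
import Data.Nat.Solver
open import Data.Product.Base using (∃; ∃₂; _×_; _,_; proj₁; proj₂)
open import Data.Rational.Base using (ℚ; ↥_; ↧ₙ_)
open import Data.Sum.Base using (_⊎_; inj₁; inj₂; [_,_]′)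
open import Data.Unit.Base using (tt)
open import Data.Vec.Functional as Vector using (Vector)
open import Function.Base using (_∘_; id; case_of_)
open import Level using (0ℓ)
open import Relation.Binary.Bundles using (DecTotalOrder; Poset)
import Relation.Binary.Construct.Flip.EqAndOrd as Flip
import Relation.Binary.Reasoning.PartialOrder
open import Relation.Binary.PropositionalEquality as ≡ using (_≡_; _≢_)
open import Relation.Binary.Structures using (IsDecTotalOrder)
open import Relation.Nullary using (¬_; Dec; yes; no; contradiction)
open import Relation.Nullary.Decidable using (_×-dec_)
open import Relation.Unary using (Pred)

-- A schedule pays for the processing times of the `k` fastest machines only if it uses at least `k`
-- machines. The fractional competitor is therefore sought among those `j` whose sorted load is
-- positive (`Competitive`), and both arguments for its existence refute the opposite strict
-- inequalities on this support. Rounding `j` down stays within the support, and the factor `b`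
-- falls on the fractional cost alone; this gives `b + 1` instead of `2 * b`. The schedules depend
-- on the instance and on `b` but on no norm, so one list serves both classes. Unless `b` is capped,
-- `α ≤ b + 2 ≤ 4 * b` leads from `log b` to `log (α / 4)`.
--
-- In the lower bound, the first `4 ^ t` machines can share `n` jobs with loads of at most
-- `n / 2 ^ t`, so that `4 ^ t * max` and `sum` are both of order `n * 2 ^ t` at the optimum for
-- `t`. Near-optimality for a large `t` limits the maximum, for a small `t` the sum; both limits
-- together leave too little work done.

-- Arithmetic in ordered fields.

module OrderedField (R : RealField) where
  open RealField R hiding (zero)
  open Algebra.Properties.Ring ring public
    using (-‿distribˡ-*; -‿distribʳ-*; -0#≈0#; -‿involutive; -‿+-comm)
  open Algebra.Properties.Semiring.Mult semiring public
    using (×-homo-+; ×1-homo-*)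
  open Algebra.Properties.Semiring.Sum semiring public
    using (sum-cong-≋; sum-permute; ∑-distrib-+; *-distribˡ-sum; *-distribʳ-sum)
  open IsDecTotalOrder isDecTotalOrder public
    using (antisym; total; ≤-respˡ-≈; ≤-respʳ-≈)
    renaming (refl to ≤-refl; trans to ≤-trans; reflexive to ≤-reflexive; _≟_ to _≈?_)

  poset : Poset 0ℓ 0ℓ 0ℓ
  poset = DecTotalOrder.poset decTotalOrder

  module ≤-Reasoning = Relation.Binary.Reasoning.PartialOrder poset

  fromℕ-+ : ∀ m n → fromℕ (m ℕ.+ n) ≈ fromℕ m + fromℕ n
  fromℕ-+ = ×-homo-+ 1#

  fromℕ-* : ∀ m n → fromℕ (m ℕ.* n) ≈ fromℕ m * fromℕ n
  fromℕ-* = ×1-homo-*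

  private
    module ER = Relation.Binary.Reasoning.PartialOrder poset

    cancel-suc : ∀ a b → a - b ≈ (1# + a) - (1# + b)
    cancel-suc a b = begin-equality
      a - b                          ≈⟨ +-congʳ (+-identityˡ a) ⟨
      (0# + a) - b                   ≈⟨ +-congʳ (+-congʳ (-‿inverseʳ 1#)) ⟨
      ((1# - 1#) + a) - b            ≈⟨ +-congʳ (+-assoc 1# (- 1#) a) ⟩
      (1# + (- 1# + a)) - b          ≈⟨ +-congʳ (+-congˡ (+-comm (- 1#) a)) ⟩
      (1# + (a - 1#)) - b            ≈⟨ +-congʳ (+-assoc 1# a (- 1#)) ⟨
      ((1# + a) - 1#) - b            ≈⟨ +-assoc (1# + a) (- 1#) (- b) ⟩
      (1# + a) + (- 1# - b)          ≈⟨ +-congˡ (-‿+-comm 1# b) ⟩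
      (1# + a) - (1# + b)            ∎
      where open ER

    fromℤ-⊖ : ∀ m n → fromℤ (m ℤ.⊖ n) ≈ fromℕ m - fromℕ n
    fromℤ-⊖ m       zero    = sym (trans (+-congˡ -0#≈0#) (+-identityʳ _))
    fromℤ-⊖ zero    (suc n) = sym (+-identityˡ _)
    fromℤ-⊖ (suc m) (suc n) =
      trans (reflexive (≡.cong fromℤ (ℤₚ.[1+m]⊖[1+n]≡m⊖n m n)))
            (trans (fromℤ-⊖ m n) (cancel-suc (fromℕ m) (fromℕ n)))

    fromℤ-+ : ∀ i j → fromℤ (i ℤ.+ j) ≈ fromℤ i + fromℤ j
    fromℤ-+ (+ m)    (+ n)    = fromℕ-+ m n
    fromℤ-+ (+ m)    -[1+ n ] = fromℤ-⊖ m (suc n)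
    fromℤ-+ -[1+ m ] (+ n)    = trans (fromℤ-⊖ n (suc m)) (+-comm _ _)
    fromℤ-+ -[1+ m ] -[1+ n ] = begin-equality
      - fromℕ (suc (suc (m ℕ.+ n)))        ≡⟨ ≡.cong (λ k → - fromℕ (suc k)) (ℕₚ.+-suc m n) ⟨
      - fromℕ (suc m ℕ.+ suc n)            ≈⟨ -‿cong (fromℕ-+ (suc m) (suc n)) ⟩
      - (fromℕ (suc m) + fromℕ (suc n))    ≈⟨ -‿+-comm _ _ ⟨
      - fromℕ (suc m) - fromℕ (suc n)      ∎
      where open ER

    fromℤ-neg : ∀ i → fromℤ (ℤ.- i) ≈ - fromℤ i
    fromℤ-neg (+ zero)  = sym -0#≈0#
    fromℤ-neg (+ suc n) = refl
    fromℤ-neg -[1+ n ]  = sym (-‿involutive _)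

    fromℤ-pos* : ∀ m j → fromℤ (+ m ℤ.* j) ≈ fromℕ m * fromℤ j
    fromℤ-pos* zero    j = trans (reflexive (≡.cong fromℤ (ℤₚ.*-zeroˡ j))) (sym (zeroˡ _))
    fromℤ-pos* (suc m) j = begin-equality
      fromℤ (+ suc m ℤ.* j)           ≡⟨ ≡.cong fromℤ (ℤₚ.suc-* (+ m) j) ⟩
      fromℤ (j ℤ.+ + m ℤ.* j)         ≈⟨ fromℤ-+ j (+ m ℤ.* j) ⟩
      fromℤ j + fromℤ (+ m ℤ.* j)     ≈⟨ +-cong (sym (*-identityˡ _)) (fromℤ-pos* m j) ⟩
      1# * fromℤ j + fromℕ m * fromℤ j ≈⟨ distribʳ _ _ _ ⟨
      (1# + fromℕ m) * fromℤ j        ∎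
      where open ER

    fromℤ-* : ∀ i j → fromℤ (i ℤ.* j) ≈ fromℤ i * fromℤ j
    fromℤ-* (+ m)    j = fromℤ-pos* m j
    fromℤ-* -[1+ m ] j = begin-equality
      fromℤ (-[1+ m ] ℤ.* j)          ≡⟨ ≡.cong fromℤ (ℤₚ.neg-distribˡ-* (+ suc m) j) ⟨
      fromℤ (ℤ.- (+ suc m ℤ.* j))     ≈⟨ fromℤ-neg (+ suc m ℤ.* j) ⟩
      - fromℤ (+ suc m ℤ.* j)         ≈⟨ -‿cong (fromℤ-pos* (suc m) j) ⟩
      - (fromℕ (suc m) * fromℤ j)     ≈⟨ -‿distribˡ-* _ _ ⟩
      - fromℕ (suc m) * fromℤ j       ∎
      where open ER

    almostCommutativeRing : AlmostCommutativeRing 0ℓ 0ℓ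
    almostCommutativeRing = fromCommutativeRing commutativeRing

    -- Integer coefficients have an equality test that computes, and `fromℤ` makes numerals such as
    -- `fromℕ 4` constants of the solver. The numeral one is `1# + 0#`, which is why later calls
    -- pass `1#` as a variable.
    ℤ⟶R : CommutativeRing.rawRing ℤₚ.+-*-commutativeRing -Raw-AlmostCommutative⟶ almostCommutativeRing
    ℤ⟶R = record
      { ⟦_⟧ = fromℤ ; +-homo = fromℤ-+ ; *-homo = fromℤ-* ; -‿homo = fromℤ-neg
      ; 0-homo = refl ; 1-homo = +-identityʳ 1# }

    ℤ≟ : ∀ i j → Maybe (fromℤ i ≈ fromℤ j)
    ℤ≟ i j with i ℤₚ.≟ j
    ... | yes i≡j = just (reflexive (≡.cong fromℤ i≡j))
    ... | no  _   = nothing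

  module Solver = Algebra.Solver.Ring
    (CommutativeRing.rawRing ℤₚ.+-*-commutativeRing) almostCommutativeRing ℤ⟶R ℤ≟

  open Solver using (solve; con; _:=_; _:+_; _:*_; _:-_; :-_)
  open ≤-Reasoning

  +-monoʳ-≤ : ∀ z {x y} → x ≤ y → z + x ≤ z + y
  +-monoʳ-≤ z {x} {y} x≤y = begin
    z + x ≈⟨ +-comm z x ⟩
    x + z ≤⟨ +-monoˡ-≤ z x≤y ⟩
    y + z ≈⟨ +-comm y z ⟩
    z + y ∎

  +-mono-≤ : ∀ {x y u v} → x ≤ y → u ≤ v → x + u ≤ y + v
  +-mono-≤ {x} {y} {u} x≤y u≤v = ≤-trans (+-monoˡ-≤ u x≤y) (+-monoʳ-≤ y u≤v)

  x≤y⇒0≤y-x : ∀ {x y} → x ≤ y → 0# ≤ y - x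
  x≤y⇒0≤y-x {x} {y} x≤y = begin
    0#    ≈⟨ -‿inverseʳ x ⟨
    x - x ≤⟨ +-monoˡ-≤ (- x) x≤y ⟩
    y - x ∎

  0≤y-x⇒x≤y : ∀ {x y} → 0# ≤ y - x → x ≤ y
  0≤y-x⇒x≤y {x} {y} 0≤ = begin
    x            ≈⟨ +-identityˡ x ⟨
    0# + x       ≤⟨ +-monoˡ-≤ x 0≤ ⟩
    (y - x) + x  ≈⟨ solve 2 (λ x y → (y :- x) :+ x := y) refl x y ⟩
    y            ∎

  neg-mono-≤ : ∀ {x y} → x ≤ y → - y ≤ - x
  neg-mono-≤ {x} {y} x≤y = 0≤y-x⇒x≤y (≤-respʳ-≈ (solve 2 (λ x y → y :- x := (:- x) :- (:- y)) refl x y) (x≤y⇒0≤y-x x≤y))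

  *-monoˡ-≤ : ∀ z {x y} → 0# ≤ z → x ≤ y → z * x ≤ z * y
  *-monoˡ-≤ z {x} {y} 0≤z x≤y = 0≤y-x⇒x≤y (begin
    0#            ≤⟨ *-nonNegative 0≤z (x≤y⇒0≤y-x x≤y) ⟩
    z * (y - x)   ≈⟨ solve 3 (λ z x y → z :* (y :- x) := z :* y :- z :* x) refl z x y ⟩
    z * y - z * x ∎)

  *-monoʳ-≤ : ∀ z {x y} → 0# ≤ z → x ≤ y → x * z ≤ y * z
  *-monoʳ-≤ z {x} {y} 0≤z x≤y = begin
    x * z ≈⟨ *-comm x z ⟩
    z * x ≤⟨ *-monoˡ-≤ z 0≤z x≤y ⟩
    z * y ≈⟨ *-comm z y ⟩
    y * z ∎

  *-mono-≤ : ∀ {x y u v} → 0# ≤ x → 0# ≤ v → x ≤ y → u ≤ v → x * u ≤ y * v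
  *-mono-≤ {x} {v = v} 0≤x 0≤v x≤y u≤v = ≤-trans (*-monoˡ-≤ x 0≤x u≤v) (*-monoʳ-≤ v 0≤v x≤y)

  <⇒≤ : ∀ {x y} → x < y → x ≤ y
  <⇒≤ = proj₁

  <-irrefl : ∀ {x} → ¬ x < x
  <-irrefl (_ , x≉x) = x≉x refl

  ≤⇒≯ : ∀ {x y} → x ≤ y → ¬ y < x
  ≤⇒≯ x≤y (y≤x , y≉x) = y≉x (antisym y≤x x≤y)

  ≰⇒> : ∀ {x y} → ¬ x ≤ y → y < x
  ≰⇒> {x} {y} x≰y with total x y
  ... | inj₁ x≤y = contradiction x≤y x≰y
  ... | inj₂ y≤x = y≤x , λ y≈x → x≰y (≤-reflexive (sym y≈x))

  <-≤-trans : ∀ {x y z} → x < y → y ≤ z → x < z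
  <-≤-trans {x} {y} {z} x<y y≤z = begin-strict x <⟨ x<y ⟩ y ≤⟨ y≤z ⟩ z ∎

  ≤-<-trans : ∀ {x y z} → x ≤ y → y < z → x < z
  ≤-<-trans {x} {y} {z} x≤y y<z = begin-strict x ≤⟨ x≤y ⟩ y <⟨ y<z ⟩ z ∎

  <-respʳ-≈ : ∀ {x y z} → y ≈ z → x < y → x < z
  <-respʳ-≈ y≈z x<y = <-≤-trans x<y (≤-reflexive y≈z)

  <-respˡ-≈ : ∀ {x y z} → x ≈ y → x < z → y < z
  <-respˡ-≈ x≈y x<z = ≤-<-trans (≤-reflexive (sym x≈y)) x<z

  nonNeg≉⇒pos : ∀ {x} → 0# ≤ x → ¬ x ≈ 0# → 0# < x
  nonNeg≉⇒pos 0≤x x≉0 = 0≤x , x≉0 ∘ sym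

  pos≉0 : ∀ {x} → 0# < x → ¬ x ≈ 0#
  pos≉0 (_ , 0≉x) x≈0 = 0≉x (sym x≈0)

  +-mono-≤-< : ∀ {x y u v} → x ≤ y → u < v → x + u < y + v
  +-mono-≤-< {x} {y} {u} {v} x≤y (u≤v , u≉v) = +-mono-≤ x≤y u≤v , λ eq → u≉v (antisym u≤v (begin
    v               ≈⟨ solve 2 (λ y v → v := (y :+ v) :- y) refl y v ⟩
    (y + v) - y     ≈⟨ +-congʳ eq ⟨
    (x + u) - y     ≤⟨ +-monoˡ-≤ (- y) (+-monoˡ-≤ u x≤y) ⟩
    (y + u) - y     ≈⟨ solve 2 (λ y v → v := (y :+ v) :- y) refl y u ⟨
    u               ∎))

  *-cancelˡ-≈0 : ∀ {x y} → ¬ x ≈ 0# → x * y ≈ 0# → y ≈ 0#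
  *-cancelˡ-≈0 {x} {y} x≉0 xy≈0 = begin-equality
    y                ≈⟨ *-identityˡ y ⟨
    1# * y           ≈⟨ *-congʳ (⁻¹-inverseʳ x x≉0) ⟨
    (x * x ⁻¹) * y   ≈⟨ solve 3 (λ x i y → (x :* i) :* y := i :* (x :* y)) refl x (x ⁻¹) y ⟩
    x ⁻¹ * (x * y)   ≈⟨ *-congˡ xy≈0 ⟩
    x ⁻¹ * 0#        ≈⟨ zeroʳ _ ⟩
    0#               ∎

  *-pos : ∀ {x y} → 0# < x → 0# < y → 0# < x * y
  *-pos 0<x 0<y = nonNeg≉⇒pos (*-nonNegative (<⇒≤ 0<x) (<⇒≤ 0<y))
    (λ xy≈0 → pos≉0 0<y (*-cancelˡ-≈0 (pos≉0 0<x) xy≈0))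

  *-monoˡ-< : ∀ z {x y} → 0# < z → x < y → z * x < z * y
  *-monoˡ-< z {x} {y} 0<z (x≤y , x≉y) = *-monoˡ-≤ z (<⇒≤ 0<z) x≤y , λ eq → x≉y (antisym x≤y (0≤y-x⇒x≤y (≤-reflexive (sym
    (*-cancelˡ-≈0 (pos≉0 0<z) (begin-equality
      z * (x - y)    ≈⟨ solve 3 (λ z x y → z :* (x :- y) := z :* x :- z :* y) refl z x y ⟩
      z * x - z * y  ≈⟨ +-congʳ eq ⟩
      z * y - z * y  ≈⟨ -‿inverseʳ _ ⟩
      0#             ∎))))))

  *-cancelˡ-≤ : ∀ {z x y} → 0# < z → z * x ≤ z * y → x ≤ y
  *-cancelˡ-≤ {z} {x} {y} 0<z zx≤zy with x ≤? y
  ... | yes x≤y = x≤y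
  ... | no  x≰y = contradiction (*-monoˡ-< z 0<z (≰⇒> x≰y)) (≤⇒≯ zx≤zy)

  x²-nonNegative : ∀ x → 0# ≤ x * x
  x²-nonNegative x with total 0# x
  ... | inj₁ 0≤x = *-nonNegative 0≤x 0≤x
  ... | inj₂ x≤0 = ≤-respʳ-≈ (solve 1 (λ x → (:- x) :* (:- x) := x :* x) refl x) (*-nonNegative 0≤-x 0≤-x)
    where 0≤-x = ≤-respˡ-≈ -0#≈0# (neg-mono-≤ x≤0)

  0<1 : 0# < 1#
  0<1 = ≤-respʳ-≈ (*-identityʳ 1#) (x²-nonNegative 1#) , 0≉1

  fromℕ-nonNegative : ∀ n → 0# ≤ fromℕ n
  fromℕ-nonNegative zero    = ≤-refl
  fromℕ-nonNegative (suc n) = ≤-respˡ-≈ (+-identityʳ 0#) (+-mono-≤ (<⇒≤ 0<1) (fromℕ-nonNegative n))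

  fromℕ-mono-≤ : ∀ {m n} → m ℕ.≤ n → fromℕ m ≤ fromℕ n
  fromℕ-mono-≤ {n = n} z≤n = fromℕ-nonNegative n
  fromℕ-mono-≤ (s≤s m≤n)   = +-monoʳ-≤ 1# (fromℕ-mono-≤ m≤n)

  x<1+x : ∀ x → x < 1# + x
  x<1+x x = <-respˡ-≈ (+-identityʳ x) (<-respʳ-≈ (+-comm x 1#) (+-mono-≤-< (≤-refl {x}) 0<1))

  fromℕ-mono-< : ∀ {m n} → m ℕ.< n → fromℕ m < fromℕ n
  fromℕ-mono-< {m} m<n = <-≤-trans (x<1+x (fromℕ m)) (fromℕ-mono-≤ m<n)

  fromℕ-pos : ∀ {n} → 0 ℕ.< n → 0# < fromℕ n
  fromℕ-pos = fromℕ-mono-<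

  fromℕ-cancel-≤ : ∀ {m n} → fromℕ m ≤ fromℕ n → m ℕ.≤ n
  fromℕ-cancel-≤ {m} {n} m≤n with m ℕₚ.≤? n
  ... | yes p = p
  ... | no  p = contradiction (fromℕ-mono-< (ℕₚ.≰⇒> p)) (≤⇒≯ m≤n)

  ⁻¹-pos : ∀ {x} → 0# < x → 0# < x ⁻¹
  ⁻¹-pos {x} 0<x with x ⁻¹ ≤? 0#
  ... | no  p = ≰⇒> p
  ... | yes p = contradiction (begin
      1#        ≈⟨ ⁻¹-inverseʳ x (pos≉0 0<x) ⟨
      x * x ⁻¹  ≤⟨ *-monoˡ-≤ x (<⇒≤ 0<x) p ⟩
      x * 0#    ≈⟨ zeroʳ x ⟩
      0#        ∎) (λ q → ≤⇒≯ q 0<1)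

  x*y/x : ∀ {x} y → 0# < x → x * (y / x) ≈ y
  x*y/x {x} y 0<x = begin-equality
    x * (y * x ⁻¹)  ≈⟨ solve 3 (λ x i y → x :* (y :* i) := (x :* i) :* y) refl x (x ⁻¹) y ⟩
    (x * x ⁻¹) * y  ≈⟨ *-congʳ (⁻¹-inverseʳ x (pos≉0 0<x)) ⟩
    1# * y          ≈⟨ *-identityˡ y ⟩
    y               ∎

  x≤y*z⇒x/z≤y : ∀ {x y z} → 0# < z → x ≤ z * y → x / z ≤ y
  x≤y*z⇒x/z≤y {x} 0<z x≤zy = *-cancelˡ-≤ 0<z (≤-respˡ-≈ (sym (x*y/x x 0<z)) x≤zy)

  x*z≤y⇒x≤y/z : ∀ {x y z} → 0# < z → z * x ≤ y → x ≤ y / z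
  x*z≤y⇒x≤y/z {y = y} 0<z zx≤y = *-cancelˡ-≤ 0<z (≤-respʳ-≈ (sym (x*y/x y 0<z)) zx≤y)

  ⁻¹-antimono-≤ : ∀ {x y} → 0# < x → x ≤ y → y ⁻¹ ≤ x ⁻¹
  ⁻¹-antimono-≤ {x} {y} 0<x x≤y = begin
    y ⁻¹             ≈⟨ *-identityˡ _ ⟨
    1# * y ⁻¹        ≈⟨ *-congʳ (⁻¹-inverseʳ x (pos≉0 0<x)) ⟨
    (x * x ⁻¹) * y ⁻¹ ≤⟨ *-monoʳ-≤ _ (<⇒≤ (⁻¹-pos 0<y)) (*-monoʳ-≤ _ (<⇒≤ (⁻¹-pos 0<x)) x≤y) ⟩
    (y * x ⁻¹) * y ⁻¹ ≈⟨ solve 3 (λ y i j → (y :* i) :* j := (y :* j) :* i) refl y (x ⁻¹) (y ⁻¹) ⟩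
    (y * y ⁻¹) * x ⁻¹ ≈⟨ *-congʳ (⁻¹-inverseʳ y (pos≉0 0<y)) ⟩
    1# * x ⁻¹        ≈⟨ *-identityˡ _ ⟩
    x ⁻¹             ∎
    where 0<y = <-≤-trans 0<x x≤y

  ∣∣-cong : ∀ {x y} → x ≈ y → ∣ x ∣ ≈ ∣ y ∣
  ∣∣-cong {x} {y} x≈y with 0# ≤? x | 0# ≤? y
  ... | yes _ | yes _ = x≈y
  ... | no  _ | no  _ = -‿cong x≈y
  ... | yes p | no  q = contradiction (≤-respʳ-≈ x≈y p) q
  ... | no  p | yes q = contradiction (≤-respʳ-≈ (sym x≈y) q) p

  ∣∣-nonNeg : ∀ {x} → 0# ≤ x → ∣ x ∣ ≈ x
  ∣∣-nonNeg {x} 0≤x with 0# ≤? x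
  ... | yes _ = refl
  ... | no  p = contradiction 0≤x p

  ∣∣-nonPos : ∀ {x} → x ≤ 0# → ∣ x ∣ ≈ - x
  ∣∣-nonPos {x} x≤0 with 0# ≤? x
  ... | yes p = trans x≈0 (sym (trans (-‿cong x≈0) -0#≈0#)) where x≈0 = antisym x≤0 p
  ... | no  _ = refl

  nonPos-neg : ∀ {x} → x ≤ 0# → 0# ≤ - x
  nonPos-neg x≤0 = ≤-respˡ-≈ -0#≈0# (neg-mono-≤ x≤0)

  0≤∣∣ : ∀ x → 0# ≤ ∣ x ∣
  0≤∣∣ x with total 0# x
  ... | inj₁ p = ≤-respʳ-≈ (sym (∣∣-nonNeg p)) p
  ... | inj₂ p = ≤-respʳ-≈ (sym (∣∣-nonPos p)) (nonPos-neg p)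

  x≤∣x∣ : ∀ x → x ≤ ∣ x ∣
  x≤∣x∣ x with total 0# x
  ... | inj₁ p = ≤-reflexive (sym (∣∣-nonNeg p))
  ... | inj₂ p = ≤-trans p (0≤∣∣ x)

  -x≤∣x∣ : ∀ x → - x ≤ ∣ x ∣
  -x≤∣x∣ x with total 0# x
  ... | inj₁ p = ≤-trans (≤-respʳ-≈ -0#≈0# (neg-mono-≤ p)) (0≤∣∣ x)
  ... | inj₂ p = ≤-reflexive (sym (∣∣-nonPos p))

  ∣x+y∣≤∣x∣+∣y∣ : ∀ x y → ∣ x + y ∣ ≤ ∣ x ∣ + ∣ y ∣
  ∣x+y∣≤∣x∣+∣y∣ x y with total 0# (x + y)
  ... | inj₁ p = ≤-respˡ-≈ (sym (∣∣-nonNeg p)) (+-mono-≤ (x≤∣x∣ x) (x≤∣x∣ y))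
  ... | inj₂ p = begin
    ∣ x + y ∣     ≈⟨ ∣∣-nonPos p ⟩
    - (x + y)     ≈⟨ -‿+-comm x y ⟨
    - x - y       ≤⟨ +-mono-≤ (-x≤∣x∣ x) (-x≤∣x∣ y) ⟩
    ∣ x ∣ + ∣ y ∣ ∎

  ∣c*x∣ : ∀ {c} x → 0# ≤ c → ∣ c * x ∣ ≈ c * ∣ x ∣
  ∣c*x∣ {c} x 0≤c with total 0# x
  ... | inj₁ p = trans (∣∣-nonNeg (*-nonNegative 0≤c p)) (*-congˡ (sym (∣∣-nonNeg p)))
  ... | inj₂ p = begin-equality
    ∣ c * x ∣   ≈⟨ ∣∣-nonPos (≤-respʳ-≈ (zeroʳ c) (*-monoˡ-≤ c 0≤c p)) ⟩
    - (c * x)   ≈⟨ -‿distribʳ-* c x ⟩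
    c * - x     ≈⟨ *-congˡ (sym (∣∣-nonPos p)) ⟩
    c * ∣ x ∣   ∎

  sum-mono-≤ : ∀ {n} {f g : Vector Carrier n} → (∀ i → f i ≤ g i) → sum f ≤ sum g
  sum-mono-≤ {zero}  f≤g = ≤-refl
  sum-mono-≤ {suc n} f≤g = +-mono-≤ (f≤g zero) (sum-mono-≤ (f≤g ∘ suc))

  sum-nonNegative : ∀ {n} {f : Vector Carrier n} → (∀ i → 0# ≤ f i) → 0# ≤ sum f
  sum-nonNegative {zero}  0≤f = ≤-refl
  sum-nonNegative {suc n} 0≤f = ≤-respˡ-≈ (+-identityʳ 0#) (+-mono-≤ (0≤f zero) (sum-nonNegative (0≤f ∘ suc)))

  fromℕ-sum : ∀ {n} (f : Vector ℕ n) → fromℕ (sumᴸ (List.tabulate f)) ≈ sum (fromℕ ∘ f)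
  fromℕ-sum {zero}  f = refl
  fromℕ-sum {suc n} f = trans (fromℕ-+ (f zero) _) (+-congˡ (fromℕ-sum (f ∘ suc)))

-- Sorting as a permutation of indices.

module SortingPermutation (O : DecTotalOrder 0ℓ 0ℓ 0ℓ) where
  open DecTotalOrder O using (totalOrder) renaming (Carrier to A; _≤_ to _⊑_)
  open Data.List.Sort O

  module _ {d} (v : Vector A d) where
    private
      xs : List A
      xs = List.tabulate v

      indices : Permutation (length (sort xs)) (length xs)
      indices = onIndices (↭⇒↭ₛ (sort-↭ xs))

      sort-length : length (sort xs) ≡ d
      sort-length = ≡.trans (Permˡₚ.↭-length (sort-↭ xs)) (length-tabulate v)

      lookup-tabulate′ : ∀ {d} (v : Vector A d) i → List.lookup (List.tabulate v) i ≡ v (Fin.cast (length-tabulate v) i)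
      lookup-tabulate′ {suc d} v zero    = ≡.refl
      lookup-tabulate′ {suc d} v (suc i) = lookup-tabulate′ (v ∘ suc) i

    -- Read off from the index bijection behind `sort-↭`, so that other vectors can be reordered
    -- along with the sorted one.
    σ : Permutation′ d
    σ = Perm.cast-id (≡.sym sort-length) Perm.∘ₚ indices Perm.∘ₚ Perm.cast-id (length-tabulate v)

    lookup-sort : ∀ i → List.lookup (sort xs) (Fin.cast (≡.sym sort-length) i) ≡ v (σ ⟨$⟩ʳ i)
    lookup-sort i = ≡.trans
      (Permˢₚ.onIndices-lookup (≡.setoid A) (↭⇒↭ₛ (sort-↭ xs)) (Fin.cast (≡.sym sort-length) i))
      (lookup-tabulate′ v _)

    σ-sorted : ∀ i j → i Fin.≤ j → v (σ ⟨$⟩ʳ i) ⊑ v (σ ⟨$⟩ʳ j)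
    σ-sorted i j i≤j = ≡.subst₂ _⊑_ (lookup-sort i) (lookup-sort j)
      (Sortedₚ.lookup-mono-≤ totalOrder (sort-↗ xs)
        (≡.subst₂ ℕ._≤_ (≡.sym (Finₚ.toℕ-cast _ i)) (≡.sym (Finₚ.toℕ-cast _ j)) i≤j))

tabulate-removeAt-↭ : ∀ {A : Set} {n} (v : Vector A (suc n)) i → List.tabulate v ↭ v i ∷ List.tabulate (v ∘ Fin.punchIn i)
tabulate-removeAt-↭         v zero    = ↭-refl
tabulate-removeAt-↭ {n = suc n} v (suc i) =
  ↭-trans (Permˡ.prep (v zero) (tabulate-removeAt-↭ (v ∘ suc) i)) (Permˡ.swap (v zero) (v (suc i)) ↭-refl)

-- Both lists lose the entry at `π 0`; on the remaining positions `π` acts as `Perm.remove zero π`.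
tabulate-permute-↭ : ∀ {A : Set} {n} (v : Vector A n) (π : Permutation′ n) → List.tabulate (λ i → v (π ⟨$⟩ʳ i)) ↭ List.tabulate v
tabulate-permute-↭ {n = zero}  v π = ↭-refl
tabulate-permute-↭ {n = suc n} v π = ↭-trans
  (Permˡ.prep (v (π ⟨$⟩ʳ zero)) (↭-trans
    (Permˡ.↭-reflexive (tabulate-cong (λ j → ≡.cong v (Perm.punchIn-permute π zero j))))
    (tabulate-permute-↭ (v ∘ Fin.punchIn (π ⟨$⟩ʳ zero)) (Perm.remove zero π))))
  (↭-sym (tabulate-removeAt-↭ v (π ⟨$⟩ʳ zero)))

-- The rearrangement inequality.

module Rearrangement (R : RealField) where
  open RealField R hiding (zero)
  open OrderedField R
  open Solver using (solve; _:=_; _:+_; _:*_; _:-_)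
  open ≤-Reasoning

  Decreasing : ∀ {n} → Vector Carrier n → Set
  Decreasing w = ∀ i j → i Fin.≤ j → w j ≤ w i

  decreasing-tail : ∀ {n} {w : Vector Carrier (suc n)} → Decreasing w → Decreasing (w ∘ suc)
  decreasing-tail w↘ i j i≤j = w↘ (suc i) (suc j) (s≤s i≤j)

  private
    -- The pairing stops at the shorter argument, so that entries can be taken out of a list or put
    -- into it without any account of lengths.
    dot : ∀ {n} → Vector Carrier n → List Carrier → Carrier
    dot {zero}  w xs       = 0#
    dot {suc n} w []       = 0#
    dot {suc n} w (x ∷ xs) = w zero * x + dot (w ∘ suc) xs

    dot-tabulate : ∀ {n} (w z : Vector Carrier n) → dot w (List.tabulate z) ≡ sum (λ i → w i * z i)
    dot-tabulate {zero}  w z = ≡.refl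
    dot-tabulate {suc n} w z = ≡.cong (λ s → w zero * z zero + s) (dot-tabulate (w ∘ suc) (z ∘ suc))

    exchange : ∀ {a b y x D} → b ≤ a → y ≤ x → a * y + (b * x + D) ≤ a * x + (b * y + D)
    exchange {a} {b} {y} {x} {D} b≤a y≤x = 0≤y-x⇒x≤y (≤-respʳ-≈
      (solve 5 (λ a b y x D → (a :- b) :* (x :- y) := (a :* x :+ (b :* y :+ D)) :- (a :* y :+ (b :* x :+ D))) refl a b y x D)
      (*-nonNegative (x≤y⇒0≤y-x b≤a) (x≤y⇒0≤y-x y≤x)))

    -- Moves `y` to the right past larger entries; each exchange of neighbours hands the larger
    -- entry to the larger weight. When the last weight is reached, a larger entry takes the place
    -- of `y` there, which `0# ≤ w` makes harmless.
    dot-insert : ∀ {n} (w : Vector Carrier n) {y} as bs → Decreasing w → (∀ i → 0# ≤ w i) →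
                 All (y ≤_) as → dot w (y ∷ as List.++ bs) ≤ dot w (as List.++ y ∷ bs)
    dot-insert w [] bs w↘ 0≤w [] = ≤-refl
    dot-insert {zero} w (a ∷ as) bs w↘ 0≤w _ = ≤-refl
    dot-insert {suc zero} w (a ∷ as) bs w↘ 0≤w (y≤a ∷ _) = +-monoˡ-≤ 0# (*-monoˡ-≤ (w zero) (0≤w zero) y≤a)
    dot-insert {suc (suc n)} w (a ∷ as) bs w↘ 0≤w (y≤a ∷ y≤as) = ≤-trans
      (exchange (w↘ zero (suc zero) z≤n) y≤a)
      (+-monoʳ-≤ _ (dot-insert (w ∘ suc) as bs (decreasing-tail w↘) (0≤w ∘ suc) y≤as))

    drop-middle : ∀ as {y} {bs : List Carrier} → AllPairs (λ x y → y ≤ x) (as List.++ y ∷ bs) →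
                  All (y ≤_) as × AllPairs (λ x y → y ≤ x) (as List.++ bs)
    drop-middle []       (_ ∷ ps) = [] , ps
    drop-middle (a ∷ as) (p ∷ ps) with drop-middle as ps | Allₚ.++⁻ˡ as p | Allₚ.++⁻ʳ as p
    ... | q , qs | pas | p₁ ∷ pbs = p₁ ∷ q , Allₚ.++⁺ pas pbs ∷ qs

    -- Insertion sort: the tail is sorted first, under the weights `w ∘ suc`, then the head moves to
    -- its place in `zs`.
    dot-sorted : ∀ {n} (w : Vector Carrier n) ys zs → Decreasing w → (∀ i → 0# ≤ w i) →
                 ys ↭ zs → AllPairs (λ x y → y ≤ x) zs → dot w ys ≤ dot w zs
    dot-sorted w [] zs w↘ 0≤w ys↭zs zs↘ with ≡.refl ← Permˡₚ.↭-empty-inv (↭-sym ys↭zs) = ≤-refl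
    dot-sorted {zero} w (y ∷ ys) zs w↘ 0≤w ys↭zs zs↘ = ≤-refl
    dot-sorted {suc n} w (y ∷ ys) zs w↘ 0≤w ys↭zs zs↘
      with as , bs , ≡.refl ← ∈ₚ.∈-∃++ (Permˡₚ.∈-resp-↭ ys↭zs (here ≡.refl))
      with y≤as , rest↘ ← drop-middle as zs↘ = ≤-trans
        (+-monoʳ-≤ _ (dot-sorted (w ∘ suc) ys (as List.++ bs) (decreasing-tail w↘) (0≤w ∘ suc)
          (Permˡₚ.drop-mid [] as ys↭zs) rest↘))
        (dot-insert w as bs w↘ 0≤w y≤as)

    tabulate-allPairs : ∀ {n} {z : Vector Carrier n} → Decreasing z → AllPairs (λ x y → y ≤ x) (List.tabulate z)
    tabulate-allPairs {zero}  z↘ = []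
    tabulate-allPairs {suc n} z↘ = Allₚ.tabulate⁺ (λ i → z↘ zero (suc i) z≤n) ∷ tabulate-allPairs (decreasing-tail z↘)

  rearrangement : ∀ {n} (w z : Vector Carrier n) → Decreasing w → (∀ i → 0# ≤ w i) →
                  (τ : Permutation′ n) → Decreasing (λ i → z (τ ⟨$⟩ʳ i)) → (π : Permutation′ n) →
                  sum (λ i → w i * z (π ⟨$⟩ʳ i)) ≤ sum (λ i → w i * z (τ ⟨$⟩ʳ i))
  rearrangement w z w↘ 0≤w τ z↘ π = ≡.subst₂ _≤_ (dot-tabulate w _) (dot-tabulate w _)
    (dot-sorted w _ _ w↘ 0≤w (↭-trans (tabulate-permute-↭ z π) (↭-sym (tabulate-permute-↭ z τ))) (tabulate-allPairs z↘))

-- Ordered norms and symmetric monotonic norms as gauges.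

module Gauges (R : RealField) (L : NaturalLog R) where
  open RealField R hiding (zero)
  open OrderedField R
  open Rearrangement R
  open Portfolios R L
  open ≤-Reasoning

  -- The properties that ordered norms and symmetric monotonic norms share,
  -- as far as they are needed.
  record IsGauge {d} (f : Point d → Carrier) : Set where
    field
      cong        : ∀ {x y} → (∀ i → x i ≈ y i) → f x ≈ f y
      nonNegative : ∀ x → 0# ≤ f x
      homogeneous : ∀ {c} x → 0# ≤ c → f (λ i → c * x i) ≤ c * f x
      triangle    : ∀ x y → f (λ i → x i + y i) ≤ f x + f y
      symmetric   : ∀ (σ : Permutation′ d) x → f (λ i → x (σ ⟨$⟩ʳ i)) ≤ f x
      monotone    : ∀ {x y} → (∀ i → 0# ≤ x i) → (∀ i → x i ≤ y i) → f x ≤ f y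

    -- `symmetric` for the inverse permutation, applied to the permuted vector.
    symmetric⁻¹ : ∀ (σ : Permutation′ d) x → f x ≤ f (λ i → x (σ ⟨$⟩ʳ i))
    symmetric⁻¹ σ x = ≤-trans
      (≤-reflexive (cong λ i → reflexive (≡.cong x (≡.sym (Perm.inverseʳ σ)))))
      (symmetric (Perm.flip σ) (λ i → x (σ ⟨$⟩ʳ i)))

  symmetricMonotonicNorm⇒gauge : ∀ {d} {f : Point d → Carrier} → IsSymmetricMonotonicNorm f → IsGauge f
  symmetricMonotonicNorm⇒gauge N = record
    { cong        = cong
    ; nonNegative = nonNegative
    ; homogeneous = λ {c} x 0≤c → ≤-reflexive (trans (homogeneous c x) (*-congʳ (∣∣-nonNeg 0≤c)))
    ; triangle    = triangle
    ; symmetric   = λ σ x → ≤-reflexive (symmetric σ x)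
    ; monotone    = monotone _ _
    }
    where
    open IsSymmetricMonotonicNorm N
    open IsNorm isNorm

  sorting : ∀ {d} (z : Point d) → ∃ λ (τ : Permutation′ d) → Decreasing (λ i → z (τ ⟨$⟩ʳ i))
  sorting z = S.σ z , S.σ-sorted z
    where module S = SortingPermutation (Flip.decTotalOrder decTotalOrder)

  module _ {d} {w : Point d} (W : IsWeight w) where
    open IsWeight W

    private
      module S = SortingPermutation (Flip.decTotalOrder decTotalOrder)

      pair : Permutation′ d → Point d → Carrier
      pair π x = sum (λ i → w i * ∣ x (π ⟨$⟩ʳ i) ∣)

      sorter : Point d → Permutation′ d
      sorter x = S.σ (λ i → ∣ x i ∣)

      norm≡pair : ∀ x → ‖ x ‖⟨ w ⟩ ≈ pair (sorter x) x
      norm≡pair x = sum-cong-≋ λ i → *-congˡ (reflexive (S.lookup-sort (λ j → ∣ x j ∣) i))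

      pair-mono : ∀ π {x y} → (∀ i → ∣ x i ∣ ≤ ∣ y i ∣) → pair π x ≤ pair π y
      pair-mono π x≤y = sum-mono-≤ λ i → *-monoˡ-≤ (w i) (nonNegative i) (x≤y _)

    -- By rearrangement, the ordered norm is the maximum of these sums over all `π`, attained by
    -- sorting. As a maximum of permuted sums it inherits the triangle inequality, symmetry and
    -- monotonicity.
    pair≤norm : ∀ π x → sum (λ i → w i * ∣ x (π ⟨$⟩ʳ i) ∣) ≤ ‖ x ‖⟨ w ⟩
    pair≤norm π x = ≤-respʳ-≈ (sym (norm≡pair x))
      (rearrangement w (λ i → ∣ x i ∣) decreasing nonNegative (sorter x) (S.σ-sorted (λ i → ∣ x i ∣)) π)

    norm-attained : ∀ x → ∃ λ π → ‖ x ‖⟨ w ⟩ ≈ sum (λ i → w i * ∣ x (π ⟨$⟩ʳ i) ∣)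
                              × Decreasing (λ i → ∣ x (π ⟨$⟩ʳ i) ∣)
    norm-attained x = sorter x , norm≡pair x , S.σ-sorted (λ i → ∣ x i ∣)

    private
      norm-mono : ∀ {x y} → (∀ i → ∣ x i ∣ ≤ ∣ y i ∣) → ‖ x ‖⟨ w ⟩ ≤ ‖ y ‖⟨ w ⟩
      norm-mono {x} {y} x≤y = begin
        ‖ x ‖⟨ w ⟩          ≈⟨ norm≡pair x ⟩
        pair (sorter x) x   ≤⟨ pair-mono (sorter x) x≤y ⟩
        pair (sorter x) y   ≤⟨ pair≤norm (sorter x) y ⟩
        ‖ y ‖⟨ w ⟩          ∎

    orderedNorm-gauge : IsGauge ‖_‖⟨ w ⟩
    orderedNorm-gauge = record
      { cong        = λ x≈y → antisym (norm-mono λ i → ≤-reflexive (∣∣-cong (x≈y i)))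
                                      (norm-mono λ i → ≤-reflexive (∣∣-cong (sym (x≈y i))))
      ; nonNegative = λ x → ≤-respʳ-≈ (sym (norm≡pair x))
                              (sum-nonNegative λ i → *-nonNegative (nonNegative i) (0≤∣∣ _))
      ; homogeneous = λ {c} x 0≤c → let cx = λ i → c * x i ; π = sorter cx in begin
          ‖ cx ‖⟨ w ⟩      ≈⟨ norm≡pair cx ⟩
          pair π cx        ≈⟨ sum-cong-≋ (λ i → trans (*-congˡ (∣c*x∣ (x _) 0≤c)) (x∙yz≈y∙xz (w i) c _)) ⟩
          sum (λ i → c * (w i * ∣ x (π ⟨$⟩ʳ i) ∣)) ≈⟨ *-distribˡ-sum c (λ i → w i * ∣ x (π ⟨$⟩ʳ i) ∣) ⟨
          c * pair π x     ≤⟨ *-monoˡ-≤ c 0≤c (pair≤norm π x) ⟩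
          c * ‖ x ‖⟨ w ⟩   ∎
      ; triangle    = λ x y → let x+y = λ i → x i + y i ; π = sorter x+y in begin
          ‖ x+y ‖⟨ w ⟩     ≈⟨ norm≡pair x+y ⟩
          pair π x+y       ≤⟨ sum-mono-≤ (λ i → ≤-respʳ-≈ (distribˡ _ _ _) (*-monoˡ-≤ (w i) (nonNegative i) (∣x+y∣≤∣x∣+∣y∣ (x _) (y _)))) ⟩
          sum (λ i → w i * ∣ x (π ⟨$⟩ʳ i) ∣ + w i * ∣ y (π ⟨$⟩ʳ i) ∣) ≈⟨ ∑-distrib-+ (λ i → w i * ∣ x (π ⟨$⟩ʳ i) ∣) (λ i → w i * ∣ y (π ⟨$⟩ʳ i) ∣) ⟩
          pair π x + pair π y ≤⟨ +-mono-≤ (pair≤norm π x) (pair≤norm π y) ⟩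
          ‖ x ‖⟨ w ⟩ + ‖ y ‖⟨ w ⟩ ∎
      ; symmetric   = λ σ x → let y = λ i → x (σ ⟨$⟩ʳ i) in
          ≤-respˡ-≈ (sym (norm≡pair y)) (pair≤norm (sorter y Perm.∘ₚ σ) x)
      ; monotone    = λ {x} {y} 0≤x x≤y → norm-mono λ i → ≤-trans (≤-reflexive (∣∣-nonNeg (0≤x i))) (≤-trans (x≤y i) (x≤∣x∣ (y i)))
      }
      where
      open Solver using (solve; _:=_; _:*_)
      x∙yz≈y∙xz : ∀ x y z → x * (y * z) ≈ y * (x * z)
      x∙yz≈y∙xz = solve 3 (λ x y z → x :* (y :* z) := y :* (x :* z)) refl

    f-resp-gauge : ∀ {f : Point d → Carrier} → (∀ x → f x ≈ ‖ x ‖⟨ w ⟩) → IsGauge f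
    f-resp-gauge f≈ = record
      { cong        = λ {x} {y} x≈y → trans (f≈ x) (trans (cong x≈y) (sym (f≈ y)))
      ; nonNegative = λ x → ≤-respʳ-≈ (sym (f≈ x)) (G.nonNegative x)
      ; homogeneous = λ x 0≤c → resp (homogeneous x 0≤c) (f≈ _) (*-congˡ (f≈ x))
      ; triangle    = λ x y → resp (triangle x y) (f≈ _) (+-cong (f≈ x) (f≈ y))
      ; symmetric   = λ σ x → resp (symmetric σ x) (f≈ _) (f≈ x)
      ; monotone    = λ {x} {y} 0≤x x≤y → resp (monotone 0≤x x≤y) (f≈ x) (f≈ y)
      }
      where
      module G = IsGauge orderedNorm-gauge
      open G hiding (nonNegative)
      resp : ∀ {a b u v} → a ≤ b → u ≈ a → v ≈ b → u ≤ v
      resp a≤b u≈a v≈b = ≤-respˡ-≈ (sym u≈a) (≤-respʳ-≈ (sym v≈b) a≤b)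

-- Prefix sums, averages and summation by parts.

module PrefixSums (R : RealField) where
  open RealField R hiding (zero)
  open OrderedField R
  open Rearrangement R
  open Solver using (solve; con; _:=_; _:+_; _:*_; _:-_)
  open ≤-Reasoning

  indicator : ∀ {n} → ℕ → Vector Carrier n
  indicator k i = if toℕ i <ᵇ k then 1# else 0#

  -- A sum over all indices, so that prefixes of different lengths can be compared term by term,
  -- with the same indicator vectors whose norms enter the fractional cost.
  prefix : ∀ {n} → Vector Carrier n → ℕ → Carrier
  prefix x k = sum λ i → indicator k i * x i

  indicator-< : ∀ {n k} {i : Fin n} → toℕ i ℕ.< k → indicator k i ≡ 1#
  indicator-< {k = k} {i} i<k with toℕ i <ᵇ k | ℕₚ.<⇒<ᵇ i<k
  ... | true | _ = ≡.refl

  indicator-≥ : ∀ {n k} {i : Fin n} → k ℕ.≤ toℕ i → indicator k i ≡ 0#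
  indicator-≥ {k = k} {i} k≤i with toℕ i <ᵇ k | ℕₚ.<ᵇ⇒< (toℕ i) k
  ... | false | _ = ≡.refl
  ... | true  | q = contradiction (q tt) (ℕₚ.≤⇒≯ k≤i)

  0≤indicator : ∀ {n} k (i : Fin n) → 0# ≤ indicator k i
  0≤indicator k i with toℕ i <ᵇ k
  ... | true  = <⇒≤ 0<1
  ... | false = ≤-refl

  indicator-mono : ∀ {n j k} → j ℕ.≤ k → (i : Fin n) → indicator j i ≤ indicator k i
  indicator-mono {j = j} {k} j≤k i with toℕ i ℕₚ.<? j
  ... | yes i<j rewrite indicator-< {i = i} i<j | indicator-< {i = i} (ℕₚ.<-≤-trans i<j j≤k) = ≤-refl
  ... | no  i≮j rewrite indicator-≥ {i = i} (ℕₚ.≮⇒≥ i≮j) = 0≤indicator k i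

  indicator-decreasing : ∀ {n} k → Decreasing (indicator {n} k)
  indicator-decreasing k i j i≤j with toℕ j ℕₚ.<? k
  ... | yes j<k rewrite indicator-< {i = j} j<k | indicator-< {i = i} (ℕₚ.≤-<-trans i≤j j<k) = ≤-refl
  ... | no  j≮k rewrite indicator-≥ {i = j} (ℕₚ.≮⇒≥ j≮k) = 0≤indicator k i

  sum-zero : ∀ {n} {x : Vector Carrier n} → (∀ i → x i ≈ 0#) → sum x ≈ 0#
  sum-zero {zero}  x≈0 = refl
  sum-zero {suc n} x≈0 = trans (+-cong (x≈0 zero) (sum-zero (x≈0 ∘ suc))) (+-identityʳ 0#)

  sum-indicator : ∀ {n k} → k ℕ.≤ n → sum (indicator {n} k) ≈ fromℕ k
  sum-indicator {n}     z≤n       = sum-zero {n} (λ i → refl)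
  sum-indicator {suc n} (s≤s k≤n) = +-congˡ (sum-indicator k≤n)

  prefix-zero : ∀ {n} (x : Vector Carrier n) → prefix x 0 ≈ 0#
  prefix-zero x = sum-zero (λ i → zeroˡ (x i))

  0≤prefix : ∀ {n} {x : Vector Carrier n} k → (∀ i → 0# ≤ x i) → 0# ≤ prefix x k
  0≤prefix k 0≤x = sum-nonNegative λ i → *-nonNegative (0≤indicator k i) (0≤x i)

  prefix-first-pos : ∀ {n} {x : Vector Carrier n} (κ : Fin n) → (∀ i → 0# < x i) → 0# < prefix x (suc (toℕ κ))
  prefix-first-pos {suc n} {x} κ 0<x = <-≤-trans (<-respʳ-≈ (sym (*-identityˡ _)) (0<x zero))
    (≤-respˡ-≈ (+-identityʳ _) (+-monoʳ-≤ _ (0≤prefix {x = x ∘ suc} (toℕ κ) (λ i → <⇒≤ (0<x (suc i))))))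

  module _ {n} {x : Vector Carrier n} (x↘ : Decreasing x) (κ : Fin n) where
    private
      k : ℕ
      k = suc (toℕ κ)

      sum-indicator* : ∀ {j} c → j ℕ.≤ n → sum (λ i → indicator {n} j i * c) ≈ fromℕ j * c
      sum-indicator* {j} c j≤n = trans (sym (*-distribʳ-sum c (indicator {n} j))) (*-congʳ (sum-indicator j≤n))

    last≤average : fromℕ k * x κ ≤ prefix x k
    last≤average = ≤-respˡ-≈ (sum-indicator* (x κ) (Finₚ.toℕ<n κ)) (sum-mono-≤ pointwise)
      where
      pointwise : ∀ i → indicator k i * x κ ≤ indicator k i * x i
      pointwise i with toℕ i ℕₚ.<? k
      ... | yes i<k = *-monoˡ-≤ _ (0≤indicator k i) (x↘ i κ (ℕₚ.≤-pred i<k))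
      ... | no  i≮k rewrite indicator-≥ {i = i} (ℕₚ.≮⇒≥ i≮k) = ≤-reflexive (trans (zeroˡ _) (sym (zeroˡ _)))

    -- The `j - k` entries beyond `κ` are at most `x κ`. Both sides are arranged without
    -- subtraction, so that the inequality holds for each term.
    tail-bound : ∀ {j} → k ℕ.≤ j → j ℕ.≤ n → prefix x j + fromℕ k * x κ ≤ prefix x k + fromℕ j * x κ
    tail-bound {j} k≤j j≤n = begin
      prefix x j + fromℕ k * x κ                       ≈⟨ +-congˡ (sum-indicator* (x κ) (Finₚ.toℕ<n κ)) ⟨
      prefix x j + sum (λ (i : Fin n) → indicator k i * x κ)     ≈⟨ ∑-distrib-+ (λ i → indicator j i * x i) (λ i → indicator k i * x κ) ⟨
      sum (λ i → indicator j i * x i + indicator k i * x κ) ≤⟨ sum-mono-≤ pointwise ⟩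
      sum (λ i → indicator k i * x i + indicator j i * x κ) ≈⟨ ∑-distrib-+ (λ i → indicator k i * x i) (λ i → indicator j i * x κ) ⟩
      prefix x k + sum (λ (i : Fin n) → indicator j i * x κ)     ≈⟨ +-congˡ (sum-indicator* (x κ) j≤n) ⟩
      prefix x k + fromℕ j * x κ                       ∎
      where
      pointwise : ∀ i → indicator j i * x i + indicator k i * x κ ≤ indicator k i * x i + indicator j i * x κ
      pointwise i with toℕ i ℕₚ.<? k | toℕ i ℕₚ.<? j
      ... | yes i<k | _ rewrite indicator-< {i = i} i<k | indicator-< {i = i} (ℕₚ.<-≤-trans i<k k≤j) = ≤-refl
      ... | no  i≮k | yes i<j rewrite indicator-≥ {i = i} (ℕₚ.≮⇒≥ i≮k) | indicator-< {i = i} i<j = begin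
        1# * x i + 0# * x κ ≤⟨ +-monoˡ-≤ _ (*-monoˡ-≤ 1# (<⇒≤ 0<1) (x↘ κ i (ℕₚ.<⇒≤ (ℕₚ.≮⇒≥ i≮k)))) ⟩
        1# * x κ + 0# * x κ ≈⟨ +-congˡ (trans (zeroˡ _) (sym (zeroˡ _))) ⟩
        1# * x κ + 0# * x i ≈⟨ +-comm _ _ ⟩
        0# * x i + 1# * x κ ∎
      ... | no  i≮k | no i≮j rewrite indicator-≥ {i = i} (ℕₚ.≮⇒≥ i≮k) | indicator-≥ {i = i} (ℕₚ.≮⇒≥ i≮j) =
        ≤-reflexive (trans (+-cong (zeroˡ _) (zeroˡ _)) (sym (+-cong (zeroˡ _) (zeroˡ _))))

    average-antitone : ∀ {j} → k ℕ.≤ j → j ℕ.≤ n → fromℕ k * prefix x j ≤ fromℕ j * prefix x k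
    average-antitone {j} k≤j j≤n = 0≤y-x⇒x≤y (≤-respʳ-≈
        -- The difference of the two sides as a nonnegative combination of the slacks of
        -- `last≤average` and `tail-bound`.
        (solve 5 (λ K J Sj Sk q → (J :- K) :* (Sk :- K :* q) :+ K :* ((Sk :+ J :* q) :- (Sj :+ K :* q)) := J :* Sk :- K :* Sj)
          refl (fromℕ k) (fromℕ j) (prefix x j) (prefix x k) (x κ))
        (≤-respˡ-≈ (+-identityʳ 0#) (+-mono-≤
          (*-nonNegative (x≤y⇒0≤y-x (fromℕ-mono-≤ k≤j)) (x≤y⇒0≤y-x last≤average))
          (*-nonNegative (fromℕ-nonNegative k) (x≤y⇒0≤y-x (tail-bound k≤j j≤n))))))

  -- Summation by parts: z is a nonnegative combination of the indicators of
  -- initial segments.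
  0<Σzg : ∀ {n} (z g : Vector Carrier (suc n)) → Decreasing z → (∀ i → 0# ≤ z i) → 0# < z zero →
          (∀ r → 0# < z r → 0# < prefix g (suc (toℕ r))) → 0# < sum λ i → z i * g i
  0<Σzg z g z↘ 0≤z 0<z₀ 0<G = <-respʳ-≈ (trans (+-congʳ (zeroʳ _)) (+-identityˡ _))
    (offset z g 0# z↘ 0≤z 0<z₀ λ r 0<zᵣ → <-respʳ-≈ (sym (+-identityˡ _)) (0<G r 0<zᵣ))
    where
    -- `c` is the sum of the entries of the original `g` already passed. With it the claim carries
    -- over to tails: one step of the summation splits off `(z 0 - z 1) * (c + g 0)`.
    offset : ∀ {n} (z g : Vector Carrier (suc n)) c → Decreasing z → (∀ i → 0# ≤ z i) → 0# < z zero →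
             (∀ r → 0# < z r → 0# < c + prefix g (suc (toℕ r))) → 0# < z zero * c + sum λ i → z i * g i
    offset {n} z g c z↘ 0≤z 0<z₀ 0<G = helper n z g z↘ 0≤z 0<z₀ 0<G 0<c+g₀
      where
      0<c+g₀ : 0# < c + g zero
      0<c+g₀ = <-respʳ-≈ (+-congˡ (trans (+-cong (*-identityˡ _) (prefix-zero (g ∘ suc))) (+-identityʳ _))) (0<G zero 0<z₀)

      helper : ∀ n (z g : Vector Carrier (suc n)) → Decreasing z → (∀ i → 0# ≤ z i) → 0# < z zero →
               (∀ r → 0# < z r → 0# < c + prefix g (suc (toℕ r))) → 0# < c + g zero →
               0# < z zero * c + sum λ i → z i * g i
      helper zero z g z↘ 0≤z 0<z₀ 0<G 0<c+g₀ = <-respʳ-≈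
        (solve 3 (λ z c g → z :* (c :+ g) := z :* c :+ (z :* g :+ con (+ 0))) refl (z zero) c (g zero))
        (*-pos 0<z₀ 0<c+g₀)
      helper (suc n) z g z↘ 0≤z 0<z₀ 0<G 0<c+g₀ with z (suc zero) ≤? 0#
      -- As `z` is decreasing and nonnegative, it vanishes from index 1 on and only the first term
      -- remains.
      ... | yes z₁≤0 = <-respʳ-≈ (begin-equality
          z zero * (c + g zero)               ≈⟨ distribˡ _ _ _ ⟩
          z zero * c + z zero * g zero        ≈⟨ +-congˡ (+-identityʳ _) ⟨
          z zero * c + (z zero * g zero + 0#) ≈⟨ +-congˡ (+-congˡ (sum-zero (λ i →
            trans (*-congʳ (antisym (≤-trans (z↘ (suc zero) (suc i) (s≤s z≤n)) z₁≤0) (0≤z (suc i)))) (zeroˡ (g (suc i)))))) ⟨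
          z zero * c + (z zero * g zero + sum (λ i → z (suc i) * g (suc i))) ∎)
          (*-pos 0<z₀ 0<c+g₀)
      ... | no  z₁≰0 = <-respʳ-≈
          (solve 5 (λ z₀ z₁ c g s → (z₀ :- z₁) :* (c :+ g) :+ (z₁ :* (c :+ g) :+ s) := z₀ :* c :+ (z₀ :* g :+ s))
            refl (z zero) (z (suc zero)) c (g zero) (sum (λ i → z (suc i) * g (suc i))))
          (<-respˡ-≈ (+-identityʳ 0#) (+-mono-≤-<
            (*-nonNegative (x≤y⇒0≤y-x (z↘ zero (suc zero) z≤n)) (<⇒≤ 0<c+g₀))
            (offset (z ∘ suc) (g ∘ suc) (c + g zero) (decreasing-tail z↘) (0≤z ∘ suc) (≰⇒> z₁≰0)
              λ r 0<zᵣ → <-respʳ-≈ (trans (+-congˡ (+-congʳ (*-identityˡ _))) (sym (+-assoc _ _ _))) (0<G (suc r) 0<zᵣ))))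

permutation-injective : ∀ {n} (π : Permutation′ n) {i j} → π ⟨$⟩ʳ i ≡ π ⟨$⟩ʳ j → i ≡ j
permutation-injective π πi≡πj =
  ≡.trans (≡.sym (Perm.inverseˡ π)) (≡.trans (≡.cong (π ⟨$⟩ˡ_) πi≡πj) (Perm.inverseˡ π))

module Reflection where
  reflect : ∀ {d} → Fin d → Fin d → Fin d
  reflect κ i with toℕ i ℕₚ.≤? toℕ κ
  ... | yes _ = fromℕ< (ℕₚ.≤-<-trans (ℕₚ.m∸n≤m (toℕ κ) (toℕ i)) (Finₚ.toℕ<n κ))
  ... | no  _ = i

  toℕ-reflect : ∀ {d} (κ i : Fin d) → toℕ i ℕ.≤ toℕ κ → toℕ (reflect κ i) ≡ toℕ κ ℕ.∸ toℕ i
  toℕ-reflect κ i i≤κ with toℕ i ℕₚ.≤? toℕ κ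
  ... | yes _ = Finₚ.toℕ-fromℕ< _
  ... | no  p = contradiction i≤κ p

  reflect-fixed : ∀ {d} (κ i : Fin d) → ¬ toℕ i ℕ.≤ toℕ κ → reflect κ i ≡ i
  reflect-fixed κ i i≰κ with toℕ i ℕₚ.≤? toℕ κ
  ... | yes p = contradiction p i≰κ
  ... | no  _ = ≡.refl

  reflect-≤ : ∀ {d} (κ i : Fin d) → toℕ i ℕ.≤ toℕ κ → toℕ (reflect κ i) ℕ.≤ toℕ κ
  reflect-≤ κ i i≤κ = ≡.subst (ℕ._≤ toℕ κ) (≡.sym (toℕ-reflect κ i i≤κ)) (ℕₚ.m∸n≤m (toℕ κ) (toℕ i))

  reflect-involutive : ∀ {d} (κ i : Fin d) → reflect κ (reflect κ i) ≡ i
  reflect-involutive κ i = case toℕ i ℕₚ.≤? toℕ κ of λ where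
    (yes i≤κ) → Finₚ.toℕ-injective (≡.trans (toℕ-reflect κ _ (reflect-≤ κ i i≤κ))
      (≡.trans (≡.cong (toℕ κ ℕ.∸_) (toℕ-reflect κ i i≤κ)) (ℕₚ.m∸[m∸n]≡n i≤κ)))
    (no i≰κ) → ≡.trans (≡.cong (reflect κ) (reflect-fixed κ i i≰κ)) (reflect-fixed κ i i≰κ)

  reflection : ∀ {d} → Fin d → Permutation′ d
  reflection κ = Perm.permutation (reflect κ) (reflect κ) (reflect-involutive κ) (reflect-involutive κ)

-- Cost of balanced schedules against a given schedule.

module SortedMachines (R : RealField) (L : NaturalLog R) where
  open RealField R hiding (zero)
  open NaturalLog L
  open OrderedField R
  open Rearrangement R
  open PrefixSums R
  open Portfolios R L
  open Gauges R L
  open Solver using (solve; con; _:=_; _:+_; _:*_; _:-_)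
  open ≤-Reasoning

  harmonic : ℕ → Carrier
  harmonic d = sum {d} λ r → fromℕ (suc (toℕ r)) ⁻¹

  1≤harmonic : ∀ d → 1# ≤ harmonic (suc d)
  1≤harmonic d = begin
    1#                       ≈⟨ ⁻¹-inverseʳ (fromℕ 1) (pos≉0 (fromℕ-pos {1} z<s)) ⟨
    fromℕ 1 * fromℕ 1 ⁻¹     ≈⟨ *-congʳ (+-identityʳ 1#) ⟩
    1# * fromℕ 1 ⁻¹          ≈⟨ *-identityˡ _ ⟩
    fromℕ 1 ⁻¹               ≈⟨ +-identityʳ _ ⟨
    fromℕ 1 ⁻¹ + 0#          ≤⟨ +-monoʳ-≤ _ (sum-nonNegative {d} λ i → <⇒≤ (⁻¹-pos (fromℕ-pos {suc (suc (toℕ i))} z<s))) ⟩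
    harmonic (suc d)         ∎

  -- Reverses `homogeneous`, by applying it with the factor `c ⁻¹` to the scaled vector.
  gauge-scale : ∀ {d} {f : Point d → Carrier} → IsGauge f → ∀ {c} x → 0# < c → c * f x ≤ f (λ i → c * x i)
  gauge-scale {f = f} gauge {c} x 0<c = begin
    c * f x                             ≤⟨ *-monoˡ-≤ c (<⇒≤ 0<c) (≤-respˡ-≈ (cong (λ i → c⁻¹cx (x i))) (homogeneous cx (<⇒≤ (⁻¹-pos 0<c)))) ⟩
    c * (c ⁻¹ * f cx)                   ≈⟨ *-assoc _ _ _ ⟨
    (c * c ⁻¹) * f cx                   ≈⟨ *-congʳ (⁻¹-inverseʳ c (pos≉0 0<c)) ⟩
    1# * f cx                           ≈⟨ *-identityˡ _ ⟩
    f cx                                ∎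
    where
    open IsGauge gauge
    cx = λ i → c * x i
    c⁻¹cx : ∀ y → c ⁻¹ * (c * y) ≈ y
    c⁻¹cx y = trans (solve 3 (λ c i y → i :* (c :* y) := (c :* i) :* y) refl c (c ⁻¹) y)
      (trans (*-congʳ (⁻¹-inverseʳ c (pos≉0 0<c))) (*-identityˡ y))

  module Machines {d} (P : Point d) (0<P : ∀ r → 0# < P r) (P↗ : ∀ i j → i Fin.≤ j → P i ≤ P j)
                  {N : Carrier} (0<N : 0# < N) where

    Q : Point d
    Q r = P r ⁻¹

    0<Q : ∀ r → 0# < Q r
    0<Q r = ⁻¹-pos (0<P r)

    Q↘ : Decreasing Q
    Q↘ i j i≤j = ⁻¹-antimono-≤ (0<P i) (P↗ i j i≤j)

    S : Fin d → Carrier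
    S κ = prefix Q (suc (toℕ κ))

    0<S : ∀ κ → 0# < S κ
    0<S κ = prefix-first-pos κ 0<Q

    -- The common load of the machines 0, …, κ in the fractional schedule
    -- that balances N jobs on them.
    level : Fin d → Carrier
    level κ = N / S κ

    0≤level : ∀ κ → 0# ≤ level κ
    0≤level κ = <⇒≤ (*-pos 0<N (⁻¹-pos (0<S κ)))

    initial : Fin d → Point d
    initial κ = indicator (suc (toℕ κ))

    -- An upper bound only: rounding up to whole jobs exceeds the level by at most one job on each
    -- machine, and surplus jobs may then be dropped.
    Balanced : Fin d → Point d → Set
    Balanced κ x = ∀ r → x r ≤ initial κ r * (level κ + P r)

    -- Average speed decreases along the sorted machines, so at most `b` times as many machines have
    -- at most `b` times the total speed.
    level-rounding : ∀ {b κ j} → κ Fin.≤ j → suc (toℕ j) ℕ.≤ b ℕ.* suc (toℕ κ) → level κ ≤ fromℕ b * level j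
    level-rounding {b} {κ} {j} κ≤j j≤bκ = x≤y*z⇒x/z≤y (0<S κ) (begin
      N                          ≈⟨ x*y/x N (0<S j) ⟨
      S j * level j              ≤⟨ *-monoʳ-≤ _ (0≤level j) (*-cancelˡ-≤ (fromℕ-pos {suc (toℕ κ)} z<s) (begin
        fromℕ (suc (toℕ κ)) * S j            ≤⟨ average-antitone Q↘ κ (s≤s κ≤j) (Finₚ.toℕ<n j) ⟩
        fromℕ (suc (toℕ j)) * S κ            ≤⟨ *-monoʳ-≤ _ (<⇒≤ (0<S κ)) (fromℕ-mono-≤ j≤bκ) ⟩
        fromℕ (b ℕ.* suc (toℕ κ)) * S κ      ≈⟨ *-congʳ (fromℕ-* b (suc (toℕ κ))) ⟩
        (fromℕ b * fromℕ (suc (toℕ κ))) * S κ ≈⟨ solve 3 (λ b k s → (b :* k) :* s := k :* (s :* b)) refl (fromℕ b) (fromℕ (suc (toℕ κ))) (S κ) ⟩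
        fromℕ (suc (toℕ κ)) * (S κ * fromℕ b) ∎)) ⟩
      (S κ * fromℕ b) * level j  ≈⟨ *-assoc _ _ _ ⟩
      S κ * (fromℕ b * level j)  ∎)

    module _ {f : Point d → Carrier} (gauge : IsGauge f) where
      open IsGauge gauge

      F : Fin d → Carrier
      F κ = f (initial κ)

      G : Fin d → Carrier
      G κ = f λ r → initial κ r * P r

      balanced-bound : ∀ κ {x} → (∀ r → 0# ≤ x r) → Balanced κ x → f x ≤ level κ * F κ + G κ
      balanced-bound κ {x} 0≤x bal = begin
        f x                                                  ≤⟨ monotone 0≤x bal ⟩
        f (λ r → initial κ r * (level κ + P r))              ≈⟨ cong (λ r → solve 3 (λ i t p → i :* (t :+ p) := t :* i :+ i :* p) refl (initial κ r) (level κ) (P r)) ⟩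
        f (λ r → level κ * initial κ r + initial κ r * P r)  ≤⟨ triangle _ _ ⟩
        f (λ r → level κ * initial κ r) + G κ                ≤⟨ +-monoˡ-≤ _ (homogeneous (initial κ) (0≤level κ)) ⟩
        level κ * F κ + G κ                                  ∎

      module Lower (y : Point d) (y-jobs : N ≈ sum λ r → Q r * y r)
                   (y-integral : ∀ r → y r ≈ 0# ⊎ P r ≤ y r) where

        τ : Permutation′ d
        τ = proj₁ (sorting y)

        z : Point d
        z r = y (τ ⟨$⟩ʳ r)

        z↘ : Decreasing z
        z↘ = proj₂ (sorting y)

        0≤y : ∀ r → 0# ≤ y r
        0≤y r with y-integral r
        ... | inj₁ y≈0 = ≤-reflexive (sym y≈0)
        ... | inj₂ P≤y = ≤-trans (<⇒≤ (0<P r)) P≤y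

        0≤z : ∀ r → 0# ≤ z r
        0≤z r = 0≤y _

        P≤y : ∀ r → 0# < y r → P r ≤ y r
        P≤y r 0<y with y-integral r
        ... | inj₁ y≈0 = contradiction y≈0 (pos≉0 0<y)
        ... | inj₂ P≤y = P≤y

        -- Giving the largest loads to the fastest machines can only increase the work done.
        N≤ΣQz : N ≤ sum λ r → Q r * z r
        N≤ΣQz = ≤-respˡ-≈ (sym y-jobs) (rearrangement Q y Q↘ (λ r → <⇒≤ (0<Q r)) τ z↘ Perm.id)

        fz≤fy : f z ≤ f y
        fz≤fy = symmetric τ y

        -- The κ + 1 largest loads belong to different machines, so at least κ + 1 - i
        -- of them are at least P i; reversing their order makes this pointwise.
        integrality : ∀ κ → 0# < z κ → G κ ≤ f z
        integrality κ 0<zκ = ≤-trans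
          (monotone (λ i → *-nonNegative (0≤indicator (suc (toℕ κ)) i) (<⇒≤ (0<P i))) pointwise)
          (symmetric (reflection κ) z)
          where
          open Reflection

          pointwise : ∀ i → initial κ i * P i ≤ z (reflect κ i)
          pointwise i with toℕ i ℕₚ.≤? toℕ κ
          ... | no i≰κ = ≤-respˡ-≈ (sym (trans (*-congʳ (reflexive (indicator-≥ {i = i} (ℕₚ.≰⇒> i≰κ)))) (zeroˡ _))) (0≤z _)
          -- The machines that carry the loads `reflect κ 0`, ..., `reflect κ i` are `i + 1`
          -- distinct ones, so one of them has index at least `i` and hence a processing time of at
          -- least `P i`. Since `j ≤ i`, its load is no larger than the load at `reflect κ i`.
          ... | yes i≤κ with j , j≤i , i≤ρj ← Finₚ.injective⇒existsPivot {f = λ i → τ ⟨$⟩ʳ reflect κ i}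
                  (λ eq → permutation-injective (reflection κ) (permutation-injective τ eq)) i = begin
            initial κ i * P i             ≈⟨ trans (*-congʳ (reflexive (indicator-< {i = i} (s≤s i≤κ)))) (*-identityˡ _) ⟩
            P i                           ≤⟨ P↗ i _ i≤ρj ⟩
            P (τ ⟨$⟩ʳ reflect κ j)        ≤⟨ P≤y _ (<-≤-trans 0<zκ (z↘ (reflect κ j) κ (reflect-≤ κ j (ℕₚ.≤-trans j≤i i≤κ)))) ⟩
            z (reflect κ j)               ≤⟨ z↘ _ _ reflected ⟩
            z (fromℕ< (ℕₚ.≤-<-trans (ℕₚ.m∸n≤m (toℕ κ) (toℕ i)) (Finₚ.toℕ<n κ))) ∎
            where
            reflected : toℕ (fromℕ< (ℕₚ.≤-<-trans (ℕₚ.m∸n≤m (toℕ κ) (toℕ i)) (Finₚ.toℕ<n κ))) ℕ.≤ toℕ (reflect κ j)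
            reflected = ≡.subst₂ ℕ._≤_ (≡.sym (Finₚ.toℕ-fromℕ< _)) (≡.sym (toℕ-reflect κ j (ℕₚ.≤-trans j≤i i≤κ))) (ℕₚ.∸-monoʳ-≤ (toℕ κ) j≤i)

        zF≤fz : ∀ κ → 0# < z κ → z κ * F κ ≤ f z
        zF≤fz κ 0<zκ = ≤-trans (gauge-scale gauge (initial κ) 0<zκ)
          (monotone (λ r → *-nonNegative (<⇒≤ 0<zκ) (0≤indicator (suc (toℕ κ)) r)) pointwise)
          where
          pointwise : ∀ r → z κ * initial κ r ≤ z r
          pointwise r with toℕ r ℕₚ.≤? toℕ κ
          ... | yes r≤κ = ≤-respˡ-≈ (sym (trans (*-congˡ (reflexive (indicator-< {i = r} (s≤s r≤κ)))) (*-identityʳ _))) (z↘ r κ r≤κ)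
          ... | no  r≰κ = ≤-respˡ-≈ (sym (trans (*-congˡ (reflexive (indicator-≥ {i = r} (ℕₚ.≰⇒> r≰κ)))) (zeroʳ _))) (0≤z r)

        -- Some fractional balanced schedule on at most as many machines as
        -- y uses costs at most c times as much as y.
        Competitive : Carrier → Set
        Competitive c = ∃ λ j → 0# < z j × level j * F j ≤ c * f z

        -- The refutation is given with `S j` multiplied out, in the form that the summations over
        -- `j` combine to a contradiction.
        competitive? : ∀ c → Competitive c ⊎ (∀ j → 0# < z j → (c * f z) * S j < N * F j)
        competitive? c with Finₚ.any? (λ j → pos? (z j) ×-dec ((level j * F j) ≤? (c * f z)))
          where
          pos? : ∀ x → Dec (0# < x)
          pos? x with x ≤? 0#
          ... | yes x≤0 = no (≤⇒≯ x≤0)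
          ... | no  x≰0 = yes (≰⇒> x≰0)
        ... | yes p = inj₁ p
        ... | no ¬p = inj₂ λ j 0<zj → begin-strict
          (c * f z) * S j      ≈⟨ *-comm _ _ ⟩
          S j * (c * f z)      <⟨ *-monoˡ-< (S j) (0<S j) (≰⇒> λ le → ¬p (j , 0<zj , le)) ⟩
          S j * (level j * F j) ≈⟨ *-assoc _ _ _ ⟨
          (S j * level j) * F j ≈⟨ *-congʳ (x*y/x N (0<S j)) ⟩
          N * F j              ∎

        -- Passing from `j` down to `κ` costs the factor `b` in the fractional part alone. The part
        -- `G κ` caused by rounding up is at most `f z` by `integrality`, because `κ ≤ j` has
        -- positive load too; it is absorbed as one more `c * f z`.
        rounding-bound : ∀ {c b} → 1# ≤ c → ((j , _) : Competitive c) → ∀ κ {x} → κ Fin.≤ j →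
                         suc (toℕ j) ℕ.≤ b ℕ.* suc (toℕ κ) → (∀ r → 0# ≤ x r) → Balanced κ x →
                         f x ≤ fromℕ (suc b) * (c * f y)
        rounding-bound {c} {b} 1≤c (j , 0<zj , comp) κ {x} κ≤j j≤bκ 0≤x bal = begin
          f x                                    ≤⟨ balanced-bound κ 0≤x bal ⟩
          level κ * F κ + G κ                    ≤⟨ +-mono-≤ (*-mono-≤ (0≤level κ) (nonNegative _) (level-rounding {b} κ≤j j≤bκ) (monotone (0≤indicator (suc (toℕ κ))) (indicator-mono (s≤s κ≤j))))
                                                             (integrality κ (<-≤-trans 0<zj (z↘ κ j κ≤j))) ⟩
          (fromℕ b * level j) * F j + f z        ≈⟨ +-congʳ (*-assoc _ _ _) ⟩
          fromℕ b * (level j * F j) + f z        ≤⟨ +-mono-≤ (*-monoˡ-≤ _ (fromℕ-nonNegative b) comp) (≤-respˡ-≈ (*-identityˡ _) (*-monoʳ-≤ _ (nonNegative z) 1≤c)) ⟩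
          fromℕ b * (c * f z) + c * f z          ≈⟨ +-comm _ _ ⟩
          c * f z + fromℕ b * (c * f z)          ≈⟨ +-congʳ (*-identityˡ _) ⟨
          1# * (c * f z) + fromℕ b * (c * f z)   ≈⟨ distribʳ _ _ _ ⟨
          fromℕ (suc b) * (c * f z)              ≤⟨ *-monoˡ-≤ _ (fromℕ-nonNegative (suc b)) (*-monoˡ-≤ c (≤-trans (<⇒≤ 0<1) 1≤c) fz≤fy) ⟩
          fromℕ (suc b) * (c * f y)              ∎

-- The natural logarithm and harmonic sums.

module Logarithms (R : RealField) (L : NaturalLog R) where
  open RealField R hiding (zero)
  open NaturalLog L
  open OrderedField R
  open Solver using (solve; con; _:=_; _:+_; _:*_; _:-_)
  open ≤-Reasoning

  -- `ln-≤` at the quotient `x / y`. Monotonicity, the estimate of the harmonic sum and `1<ln3` all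
  -- come from this one inequality.
  ln-gap : ∀ {x y} → 0# < x → 0# < y → ln x + (1# - x / y) ≤ ln y
  ln-gap {x} {y} 0<x 0<y = begin
    ln x + (1# - x / y)                          ≈⟨ +-congʳ (ln-cong 0<x (sym (x*y/x x 0<y))) ⟩
    ln (y * (x / y)) + (1# - x / y)              ≈⟨ +-congʳ (ln-* 0<y 0<x/y) ⟩
    (ln y + ln (x / y)) + (1# - x / y)           ≤⟨ +-monoˡ-≤ _ (+-monoʳ-≤ (ln y) (ln-≤ 0<x/y)) ⟩
    (ln y + (x / y - 1#)) + (1# - x / y)         ≈⟨ solve 3 (λ l q o → (l :+ (q :- o)) :+ (o :- q) := l) refl (ln y) (x / y) 1# ⟩
    ln y                                         ∎
    where 0<x/y = *-pos 0<x (⁻¹-pos 0<y)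

  ln-mono-≤ : ∀ {x y} → 0# < x → x ≤ y → ln x ≤ ln y
  ln-mono-≤ {x} {y} 0<x x≤y = begin
    ln x                  ≈⟨ +-identityʳ _ ⟨
    ln x + 0#             ≤⟨ +-monoʳ-≤ (ln x) (x≤y⇒0≤y-x (x≤y*z⇒x/z≤y 0<y (≤-respʳ-≈ (sym (*-identityʳ y)) x≤y))) ⟩
    ln x + (1# - x / y)   ≤⟨ ln-gap 0<x 0<y ⟩
    ln y                  ∎
    where 0<y = <-≤-trans 0<x x≤y

  ln-1 : ln 1# ≈ 0#
  ln-1 = begin-equality
    ln 1#                        ≈⟨ solve 1 (λ l → l := (l :+ l) :- l) refl (ln 1#) ⟩
    (ln 1# + ln 1#) - ln 1#      ≈⟨ +-congʳ (ln-* 0<1 0<1) ⟨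
    ln (1# * 1#) - ln 1#         ≈⟨ +-congʳ (ln-cong (*-pos 0<1 0<1) (*-identityʳ 1#)) ⟩
    ln 1# - ln 1#                ≈⟨ -‿inverseʳ _ ⟩
    0#                           ∎

  ln-nonNegative : ∀ {x} → 1# ≤ x → 0# ≤ ln x
  ln-nonNegative 1≤x = ≤-respˡ-≈ ln-1 (ln-mono-≤ 0<1 1≤x)

  ln-pos : ∀ {x} → 1# < x → 0# < ln x
  ln-pos {x} 1<x = <-≤-trans (≤-<-trans (≤-reflexive (sym (-‿inverseʳ (1# / x)))) (<-respˡ-≈ (+-comm _ _)
      (<-respʳ-≈ (+-comm _ _) (+-mono-≤-< ≤-refl 1/x<1))))
    (≤-respˡ-≈ (trans (+-congʳ ln-1) (+-identityˡ _)) (ln-gap 0<1 0<x))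
    where
    0<x = <-≤-trans 0<1 (<⇒≤ 1<x)
    1/x<1 : 1# / x < 1#
    1/x<1 = ≤-<-trans (≤-reflexive (*-comm _ _)) (<-respʳ-≈ (trans (*-comm _ _) (⁻¹-inverseʳ x (pos≉0 0<x))) (*-monoˡ-< (x ⁻¹) (⁻¹-pos 0<x) 1<x))

  ln-^ : ∀ {b} n → 0 ℕ.< b → ln (fromℕ (b ℕ.^ n)) ≈ fromℕ n * ln (fromℕ b)
  ln-^ {b} zero    0<b = trans (ln-cong (fromℕ-pos {1} z<s) (+-identityʳ 1#)) (trans ln-1 (sym (zeroˡ _)))
  ln-^ {b} (suc n) 0<b = begin-equality
    ln (fromℕ (b ℕ.* b ℕ.^ n))             ≈⟨ ln-cong (fromℕ-pos (ℕₚ.m^n>0 b {{ℕ.>-nonZero 0<b}} (suc n))) (fromℕ-* b (b ℕ.^ n)) ⟩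
    ln (fromℕ b * fromℕ (b ℕ.^ n))         ≈⟨ ln-* (fromℕ-pos 0<b) (fromℕ-pos (ℕₚ.m^n>0 b {{ℕ.>-nonZero 0<b}} n)) ⟩
    ln (fromℕ b) + ln (fromℕ (b ℕ.^ n))    ≈⟨ +-cong (sym (*-identityˡ _)) (ln-^ n 0<b) ⟩
    1# * ln (fromℕ b) + fromℕ n * ln (fromℕ b) ≈⟨ distribʳ _ _ _ ⟨
    fromℕ (suc n) * ln (fromℕ b)           ∎

  open SortedMachines R L using (harmonic)

  private
    reciprocal-step : ∀ {m} → 0 ℕ.< m → fromℕ (suc m) ⁻¹ + ln (fromℕ m) ≤ ln (fromℕ (suc m))
    reciprocal-step {m} 0<m = ≤-respˡ-≈ (trans (+-comm _ _) (+-congʳ (begin-equality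
      1# - M / M⁺                        ≈⟨ +-congʳ (⁻¹-inverseʳ M⁺ (pos≉0 0<M⁺)) ⟨
      M⁺ / M⁺ - M / M⁺                   ≈⟨ solve 3 (λ o m i → (o :+ m) :* i :- m :* i := o :* i) refl 1# M (M⁺ ⁻¹) ⟩
      1# * M⁺ ⁻¹                         ≈⟨ *-identityˡ _ ⟩
      M⁺ ⁻¹                              ∎))) (ln-gap (fromℕ-pos 0<m) 0<M⁺)
      where
      M = fromℕ m
      M⁺ = fromℕ (suc m)
      0<M⁺ = fromℕ-pos {suc m} z<s

    -- Telescopes `reciprocal-step`. The induction removes the first term, hence the variable
    -- starting point `m`.
    reciprocals : ∀ d m → 0 ℕ.< m → sum {d} (λ r → fromℕ (suc (m ℕ.+ toℕ r)) ⁻¹) + ln (fromℕ m) ≤ ln (fromℕ (m ℕ.+ d))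
    reciprocals zero    m 0<m = ≤-reflexive (trans (+-identityˡ _) (reflexive (≡.cong (ln ∘ fromℕ) (≡.sym (ℕₚ.+-identityʳ m)))))
    reciprocals (suc d) m 0<m = begin
      (fromℕ (suc (m ℕ.+ 0)) ⁻¹ + s) + ln (fromℕ m)
        ≡⟨ ≡.cong (λ k → (fromℕ (suc k) ⁻¹ + s) + ln (fromℕ m)) (ℕₚ.+-identityʳ m) ⟩
      (fromℕ (suc m) ⁻¹ + s) + ln (fromℕ m)      ≈⟨ solve 3 (λ a s l → (a :+ s) :+ l := s :+ (a :+ l)) refl _ s _ ⟩
      s + (fromℕ (suc m) ⁻¹ + ln (fromℕ m))      ≤⟨ +-monoʳ-≤ s (reciprocal-step 0<m) ⟩
      s + ln (fromℕ (suc m))                     ≈⟨ +-congʳ (sum-cong-≋ {d} λ r → reflexive (≡.cong (λ k → fromℕ (suc k) ⁻¹) (ℕₚ.+-suc m (toℕ r)))) ⟩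
      sum {d} (λ r → fromℕ (suc (suc m ℕ.+ toℕ r)) ⁻¹) + ln (fromℕ (suc m)) ≤⟨ reciprocals d (suc m) z<s ⟩
      ln (fromℕ (suc m ℕ.+ d))                   ≡⟨ ≡.cong (ln ∘ fromℕ) (ℕₚ.+-suc m d) ⟨
      ln (fromℕ (m ℕ.+ suc d))                   ∎
      where s = sum {d} (λ r → fromℕ (suc (m ℕ.+ suc (toℕ r))) ⁻¹)

  harmonic≤1+ln : ∀ d → harmonic (suc d) ≤ 1# + ln (fromℕ (suc d))
  harmonic≤1+ln d = +-mono-≤ (≤-reflexive 1/1) (≤-respˡ-≈ (trans (+-congˡ ln-fromℕ1) (+-identityʳ _)) (reciprocals d 1 z<s))
    where
    1/1 : fromℕ 1 ⁻¹ ≈ 1#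
    1/1 = trans (sym (*-identityˡ _)) (trans (*-congʳ (sym (+-identityʳ 1#))) (⁻¹-inverseʳ (fromℕ 1) (pos≉0 (fromℕ-pos {1} z<s))))
    ln-fromℕ1 : ln (fromℕ 1) ≈ 0#
    ln-fromℕ1 = trans (ln-cong (fromℕ-pos {1} z<s) (+-identityʳ 1#)) ln-1

-- Existence of a competitive fractional schedule.

module Competitiveness (R : RealField) (L : NaturalLog R) where
  open RealField R hiding (zero)
  open OrderedField R
  open Rearrangement R
  open PrefixSums R
  open Portfolios R L
  open Gauges R L
  open SortedMachines R L
  open Solver using (solve; con; _:=_; _:+_; _:*_; _:-_)
  open ≤-Reasoning

  sum-combination : ∀ {n} {t u v : Vector Carrier n} a b → (∀ i → t i ≈ a * u i - b * v i) → sum t ≈ a * sum u - b * sum v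
  sum-combination {zero}  a b t≈ = solve 2 (λ a b → con (+ 0) := a :* con (+ 0) :- b :* con (+ 0)) refl a b
  sum-combination {suc n} {u = u} {v} a b t≈ = trans (+-cong (t≈ zero) (sum-combination a b (t≈ ∘ suc)))
    (solve 6 (λ a b u v U V → (a :* u :- b :* v) :+ (a :* U :- b :* V) := a :* (u :+ U) :- b :* (v :+ V))
      refl a b (u zero) (v zero) (sum (u ∘ suc)) (sum (v ∘ suc)))

  module _ {d} (P : Point (suc d)) (0<P : ∀ r → 0# < P r) (P↗ : ∀ i j → i Fin.≤ j → P i ≤ P j)
           {N : Carrier} (0<N : 0# < N) {f : Point (suc d) → Carrier} (gauge : IsGauge f)
           (y : Point (suc d)) (y-jobs : N ≈ sum λ r → P r ⁻¹ * y r)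
           (y-integral : ∀ r → y r ≈ 0# ⊎ P r ≤ y r) where
    open Machines P 0<P P↗ 0<N
    open Lower gauge y y-jobs y-integral
    open IsGauge gauge

    private
      0<z₀ : 0# < z zero
      0<z₀ = ≰⇒> λ z₀≤0 → ≤⇒≯ (begin
        N                       ≤⟨ N≤ΣQz ⟩
        sum (λ r → Q r * z r)   ≈⟨ sum-zero (λ r → trans (*-congˡ (antisym (≤-trans (z↘ zero r z≤n) z₀≤0) (0≤z r))) (zeroʳ (Q r))) ⟩
        0#                      ∎) 0<N

    -- Otherwise every prefix sum of `g r = N * w r - f z * Q r` that ends in the support of `z` is
    -- positive, as `F` is at most the prefix sum of the weights. Summation by parts makes the
    -- pairing of `z` with `g` positive. But this pairing is at most `N * f z - f z * N`, since `z`
    -- costs at least its pairing with `w` and does at least the work `N`.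
    orderedNorm-competitive : ∀ {w} → IsWeight w → (∀ x → f x ≈ ‖ x ‖⟨ w ⟩) → Competitive 1#
    orderedNorm-competitive {w} W f≈ with competitive? 1#
    ... | inj₁ c = c
    ... | inj₂ h = contradiction (0<Σzg z g z↘ 0≤z 0<z₀ 0<G) (≤⇒≯ (begin
        sum (λ r → z r * g r)                                       ≈⟨ sum-combination N (f z) (λ r → solve 5 (λ z N w f q → z :* (N :* w :- f :* q) := N :* (w :* z) :- f :* (q :* z)) refl (z r) N (w r) (f z) (Q r)) ⟩
        N * sum (λ r → w r * z r) - f z * sum (λ r → Q r * z r)     ≤⟨ +-mono-≤ (*-monoˡ-≤ N (<⇒≤ 0<N) Σwz≤fz) (neg-mono-≤ (*-monoˡ-≤ (f z) (nonNegative z) N≤ΣQz)) ⟩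
        N * f z - f z * N                                           ≈⟨ solve 2 (λ N f → N :* f :- f :* N := con (+ 0)) refl N (f z) ⟩
        0#                                                          ∎))
      where
      module W = IsWeight W

      g : Vector Carrier (suc d)
      g r = N * w r - f z * Q r

      Σwz≤fz : sum (λ r → w r * z r) ≤ f z
      Σwz≤fz = begin
        sum (λ r → w r * z r)        ≈⟨ sum-cong-≋ (λ r → *-congˡ {w r} (∣∣-nonNeg (0≤z r))) ⟨
        sum (λ r → w r * ∣ z r ∣)    ≤⟨ pair≤norm W Perm.id z ⟩
        ‖ z ‖⟨ w ⟩                   ≈⟨ f≈ z ⟨
        f z                          ∎

      F≤prefix : ∀ κ → F gauge κ ≤ prefix w (suc (toℕ κ))
      F≤prefix κ with π , attained , _ ← norm-attained W (initial κ) = begin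
        f (initial κ)                               ≈⟨ f≈ (initial κ) ⟩
        ‖ initial κ ‖⟨ w ⟩                          ≈⟨ attained ⟩
        sum (λ r → w r * ∣ initial κ (π ⟨$⟩ʳ r) ∣)  ≈⟨ sum-cong-≋ (λ r → *-congˡ {w r} (∣∣-nonNeg (0≤indicator (suc (toℕ κ)) (π ⟨$⟩ʳ r)))) ⟩
        sum (λ r → w r * initial κ (π ⟨$⟩ʳ r))      ≤⟨ rearrangement w (initial κ) W.decreasing W.nonNegative Perm.id (indicator-decreasing (suc (toℕ κ))) π ⟩
        sum (λ r → w r * initial κ r)               ≈⟨ sum-cong-≋ (λ r → *-comm (w r) (initial κ r)) ⟩
        prefix w (suc (toℕ κ))                      ∎

      0<G : ∀ κ → 0# < z κ → 0# < prefix g (suc (toℕ κ))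
      0<G κ 0<zκ = <-respʳ-≈
        (sym (sum-combination N (f z) (λ r → solve 5 (λ i N w f q → i :* (N :* w :- f :* q) := N :* (i :* w) :- f :* (i :* q)) refl (initial κ r) N (w r) (f z) (Q r))))
        (<-respˡ-≈ (-‿inverseʳ (f z * S κ)) (<-respʳ-≈ (+-comm _ _) (<-respˡ-≈ (+-comm _ _) (+-mono-≤-< ≤-refl (begin-strict
          f z * S κ                    ≈⟨ *-congʳ (*-identityˡ (f z)) ⟨
          (1# * f z) * S κ             <⟨ h κ 0<zκ ⟩
          N * F gauge κ                ≤⟨ *-monoˡ-≤ N (<⇒≤ 0<N) (F≤prefix κ) ⟩
          N * prefix w (suc (toℕ κ))   ∎)))))

    -- Otherwise `z r * F r ≤ f z` yields `H * S r * z r < N`, and `(r + 1) * Q r ≤ S r` turns this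
    -- into `H * Q r * z r < N / (r + 1)`. Summed over all `r` this reads `H * N < N * H`; the
    -- harmonic sum is exactly the loss for which the argument closes.
    gauge-competitive : Competitive (harmonic (suc d))
    gauge-competitive with competitive? (harmonic (suc d))
    ... | inj₁ c = c
    ... | inj₂ h = contradiction (begin-strict
        H * N                              ≤⟨ *-monoˡ-≤ H 0≤H N≤ΣQz ⟩
        H * sum (λ r → Q r * z r)          ≈⟨ *-distribˡ-sum H (λ r → Q r * z r) ⟩
        sum (λ r → H * (Q r * z r))        <⟨ sum-mono-< HQz<N/r ⟩
        sum (λ (r : Fin (suc d)) → N * fromℕ (suc (toℕ r)) ⁻¹) ≈⟨ *-distribˡ-sum N (λ (r : Fin (suc d)) → fromℕ (suc (toℕ r)) ⁻¹) ⟨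
        N * H                              ≈⟨ *-comm N H ⟩
        H * N                              ∎) <-irrefl
      where
      H = harmonic (suc d)
      0≤H = ≤-trans (<⇒≤ 0<1) (1≤harmonic d)

      sum-mono-< : ∀ {n} {s t : Vector Carrier (suc n)} → (∀ i → s i < t i) → sum s < sum t
      sum-mono-< s<t = <-respˡ-≈ (+-comm _ _) (<-respʳ-≈ (+-comm _ _) (+-mono-≤-< (sum-mono-≤ (<⇒≤ ∘ s<t ∘ suc)) (s<t zero)))

      HSz<N : ∀ r → 0# < z r → (H * S r) * z r < N
      -- Argued by contradiction, so that no division by `f z` occurs.
      HSz<N r 0<zr = ≰⇒> λ N≤HSz → contradiction (begin-strict
        f z * ((H * S r) * z r)  ≈⟨ solve 4 (λ f H S z → f :* ((H :* S) :* z) := z :* ((H :* f) :* S)) refl (f z) H (S r) (z r) ⟩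
        z r * ((H * f z) * S r)  <⟨ *-monoˡ-< (z r) 0<zr (h r 0<zr) ⟩
        z r * (N * F gauge r)    ≈⟨ solve 3 (λ z N F → z :* (N :* F) := N :* (z :* F)) refl (z r) N (F gauge r) ⟩
        N * (z r * F gauge r)    ≤⟨ *-monoˡ-≤ N (<⇒≤ 0<N) (zF≤fz r 0<zr) ⟩
        N * f z                  ≈⟨ *-comm N (f z) ⟩
        f z * N                  ≤⟨ *-monoˡ-≤ (f z) (nonNegative z) N≤HSz ⟩
        f z * ((H * S r) * z r)  ∎) <-irrefl

      HQz<N/r : ∀ r → H * (Q r * z r) < N * fromℕ (suc (toℕ r)) ⁻¹
      HQz<N/r r with z r ≤? 0#
      ... | yes zr≤0 = ≤-<-trans (≤-reflexive (trans (*-congˡ (trans (*-congˡ (antisym zr≤0 (0≤z r))) (zeroʳ _))) (zeroʳ _))) (*-pos 0<N (⁻¹-pos (fromℕ-pos {suc (toℕ r)} z<s)))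
      ... | no  zr≰0 = begin-strict
        H * (Q r * z r)                          ≈⟨ *-identityˡ _ ⟨
        1# * (H * (Q r * z r))                   ≈⟨ *-congʳ (⁻¹-inverseʳ k (pos≉0 0<k)) ⟨
        (k * k ⁻¹) * (H * (Q r * z r))           ≈⟨ solve 5 (λ k i H q z → (k :* i) :* (H :* (q :* z)) := i :* ((H :* (k :* q)) :* z)) refl k (k ⁻¹) H (Q r) (z r) ⟩
        k ⁻¹ * ((H * (k * Q r)) * z r)           ≤⟨ *-monoˡ-≤ (k ⁻¹) (<⇒≤ (⁻¹-pos 0<k)) (*-monoʳ-≤ (z r) (0≤z r) (*-monoˡ-≤ H 0≤H (last≤average Q↘ r))) ⟩
        k ⁻¹ * ((H * S r) * z r)                 <⟨ *-monoˡ-< (k ⁻¹) (⁻¹-pos 0<k) (HSz<N r (≰⇒> zr≰0)) ⟩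
        k ⁻¹ * N                                 ≈⟨ *-comm _ _ ⟩
        N * k ⁻¹                                 ∎
        where
        k = fromℕ (suc (toℕ r))
        0<k = fromℕ-pos {suc (toℕ r)} z<s

-- Powers of `b` and integral schedules.

n<b^n : ∀ {b} → 2 ℕ.≤ b → ∀ n → n ℕ.< b ℕ.^ n
n<b^n 2≤b zero = z<s
n<b^n {b} 2≤b (suc n) = begin
  2 ℕ.+ n              ≤⟨ s≤s (n<b^n 2≤b n) ⟩
  suc (b ℕ.^ n)        ≤⟨ ℕₚ.+-monoˡ-≤ _ (ℕₚ.m^n>0 b {{ℕ.>-nonZero (ℕₚ.<-≤-trans z<s 2≤b)}} n) ⟩
  b ℕ.^ n ℕ.+ b ℕ.^ n  ≡⟨ ≡.cong (b ℕ.^ n ℕ.+_) (ℕₚ.+-identityʳ _) ⟨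
  2 ℕ.* b ℕ.^ n        ≤⟨ ℕₚ.*-monoˡ-≤ _ 2≤b ⟩
  b ℕ.* b ℕ.^ n        ∎
  where open ℕₚ.≤-Reasoning

-- A search for the largest power of `b` up to `j`, downwards from any `E` with `j < b ^ E`.
power-bracket : ∀ b E {j} → 1 ℕ.≤ j → j ℕ.< b ℕ.^ E → ∃ λ e → e ℕ.< E × b ℕ.^ e ℕ.≤ j × j ℕ.< b ℕ.^ suc e
power-bracket b zero    1≤j j<1 = contradiction 1≤j (ℕₚ.<⇒≱ j<1)
power-bracket b (suc E) {j} 1≤j j<bᴱ⁺¹ with j ℕₚ.<? b ℕ.^ E
... | no  j≮bᴱ = E , ℕₚ.≤-refl , ℕₚ.≮⇒≥ j≮bᴱ , j<bᴱ⁺¹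
... | yes j<bᴱ with e , e<E , p , q ← power-bracket b E 1≤j j<bᴱ = e , ℕₚ.m<n⇒m<1+n e<E , p , q

index : ∀ {k d} → 0 ℕ.< k → k ℕ.≤ d → ∃ λ (κ : Fin d) → suc (toℕ κ) ≡ k
index {suc k} _ k<d = fromℕ< k<d , ≡.cong suc (Finₚ.toℕ-fromℕ< k<d)

jobs : ∀ {d} → Vector ℕ d → ℕ
jobs m = sumᴸ (List.tabulate m)

jobs-permute : ∀ {d} (m : Vector ℕ d) (σ : Permutation′ d) → jobs (λ i → m (σ ⟨$⟩ʳ i)) ≡ jobs m
jobs-permute m σ = ListActionₚ.sum-↭ (tabulate-permute-↭ m σ)

jobs-zero⇒zero : ∀ {d} {m : Vector ℕ d} → jobs m ≡ 0 → ∀ i → m i ≡ 0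
jobs-zero⇒zero {m = m} Σ≡0 zero    = ℕₚ.m+n≡0⇒m≡0 (m zero) Σ≡0
jobs-zero⇒zero {m = m} Σ≡0 (suc i) = jobs-zero⇒zero (ℕₚ.m+n≡0⇒n≡0 (m zero) Σ≡0) i

jobs-const-zero : ∀ d → jobs {d} (λ _ → 0) ≡ 0
jobs-const-zero zero    = ≡.refl
jobs-const-zero (suc d) = jobs-const-zero d

spread : ∀ {d} → ℕ → ℕ → Vector ℕ d
spread k c i = if toℕ i <ᵇ k then c else 0

jobs-spread : ∀ {d k} c → k ℕ.≤ d → jobs (spread {d} k c) ≡ k ℕ.* c
jobs-spread {d}     c z≤n       = jobs-const-zero d
jobs-spread {suc d} c (s≤s k≤d) = ≡.cong (c ℕ.+_) (jobs-spread c k≤d)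

truncate : ∀ {d} (u : Vector ℕ d) n → n ℕ.≤ jobs u → ∃ λ m → jobs m ≡ n × (∀ i → m i ℕ.≤ u i)
truncate {zero}  u zero n≤ = (λ ()) , ≡.refl , λ ()
truncate {suc d} u n    n≤ with m , Σm , m≤u ← truncate (u ∘ suc) (n ℕ.∸ u zero) (ℕₚ.m≤n+o⇒m∸n≤o n (u zero) n≤) =
  (u zero ℕ.⊓ n) Vector.∷ m ,
  ≡.trans (≡.cong (u zero ℕ.⊓ n ℕ.+_) Σm) (ℕₚ.m⊓n+n∸m≡n (u zero) n) ,
  λ { zero → ℕₚ.m⊓n≤m (u zero) n ; (suc i) → m≤u i }

-- From balanced schedules to a portfolio.

module Construction (R : RealField) (L : NaturalLog R) where
  open RealField R hiding (zero)
  open NaturalLog L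
  open OrderedField R
  open Rearrangement R
  open PrefixSums R
  open Portfolios R L
  open Gauges R L
  open SortedMachines R L
  open Logarithms R L
  open Competitiveness R L
  open Solver using (solve; con; _:=_; _:+_; _:*_; _:-_)
  open ≤-Reasoning

  argmin : ∀ {A : Set} (g : A → Carrier) x xs → ∃ λ y → y ∈ (x ∷ xs) × (∀ z → z ∈ (x ∷ xs) → g y ≤ g z)
  argmin g x [] = x , here ≡.refl , λ { z (here ≡.refl) → ≤-refl }
  argmin g x (x′ ∷ xs) with argmin g x′ xs
  ... | y , y∈ , min with g x ≤? g y
  ... | yes gx≤gy = x , here ≡.refl , λ { z (here ≡.refl) → ≤-refl ; z (there z∈) → ≤-trans gx≤gy (min z z∈) }
  ... | no  gx≰gy = y , there y∈ , λ { z (here ≡.refl) → <⇒≤ (≰⇒> gx≰gy) ; z (there z∈) → min z z∈ }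

  -- `IsPortfolio` asks for an actual minimiser over all feasible vectors. There are finitely many
  -- schedules: the recursion is on the machines, with the number of jobs on the first one minimised
  -- over.
  optimalSchedule : ∀ d n (g : Vector ℕ (suc d) → Carrier) → (∀ {m m′} → (∀ i → m i ≡ m′ i) → g m ≈ g m′) →
                    ∃ λ m → jobs m ≡ n × (∀ m′ → jobs m′ ≡ n → g m ≤ g m′)
  optimalSchedule zero n g ext = (λ _ → n) , ℕₚ.+-identityʳ n ,
    λ m′ Σm′ → ≤-reflexive (ext λ { zero → ≡.trans (≡.sym Σm′) (ℕₚ.+-identityʳ _) })
  -- The list consists of 0, ..., `n`, with `n` in front so that it is visibly nonempty.
  optimalSchedule (suc d) n g ext = combine (argmin (λ k → g (k Vector.∷ proj₁ (rest k))) n (List.upTo n))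
    where
    rest : ∀ k → ∃ λ m → jobs m ≡ n ℕ.∸ k × (∀ m′ → jobs m′ ≡ n ℕ.∸ k → g (k Vector.∷ m) ≤ g (k Vector.∷ m′))
    rest k = optimalSchedule d (n ℕ.∸ k) (λ m → g (k Vector.∷ m)) (λ eq → ext λ { zero → ≡.refl ; (suc i) → eq i })

    ∈⇒≤ : ∀ {k} → k ∈ (n ∷ List.upTo n) → k ℕ.≤ n
    ∈⇒≤ (here ≡.refl) = ℕₚ.≤-refl
    ∈⇒≤ (there k∈)    = ℕₚ.<⇒≤ (∈ₚ.∈-upTo⁻ k∈)

    ≤⇒∈ : ∀ {k} → k ℕ.≤ n → k ∈ (n ∷ List.upTo n)
    ≤⇒∈ k≤n = case ℕₚ.m≤n⇒m<n∨m≡n k≤n of λ where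
      (inj₁ k<n)    → there (∈ₚ.∈-upTo⁺ k<n)
      (inj₂ ≡.refl) → here ≡.refl

    combine : (∃ λ k → k ∈ (n ∷ List.upTo n) × (∀ k′ → k′ ∈ (n ∷ List.upTo n) → g (k Vector.∷ proj₁ (rest k)) ≤ g (k′ Vector.∷ proj₁ (rest k′)))) →
              ∃ λ m → jobs m ≡ n × (∀ m′ → jobs m′ ≡ n → g m ≤ g m′)
    combine (k , k∈ , min) =
      k Vector.∷ proj₁ (rest k) ,
      ≡.trans (≡.cong (k ℕ.+_) (proj₁ (proj₂ (rest k)))) (ℕₚ.m+[n∸m]≡n (∈⇒≤ k∈)) ,
      λ m′ Σm′ → ≤-trans (min (m′ zero) (≤⇒∈ (ℕₚ.m+n≤o⇒m≤o (m′ zero) (ℕₚ.≤-reflexive Σm′))))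
        (≤-trans (proj₂ (proj₂ (rest (m′ zero))) (m′ ∘ suc) (≡.trans (≡.sym (ℕₚ.m+n∸m≡n (m′ zero) _)) (≡.cong (ℕ._∸ m′ zero) Σm′)))
          (≤-reflexive (ext λ { zero → ≡.refl ; (suc i) → ≡.refl })))

  module _ {d} (I : MLIJ (suc d)) where
    open MLIJ I

    0≤loads : ∀ m i → 0# ≤ loads m i
    0≤loads m i = *-nonNegative (fromℕ-nonNegative (m i)) (<⇒≤ (p>0 i))

    module _ (X : List (Vector ℕ (suc d))) (X-schedules : All IsSchedule X)
             {m₀ : Vector ℕ (suc d)} (m₀∈X : m₀ ∈ X) where

      -- It suffices to beat every single schedule up to the factor `α`: an optimum exists by
      -- `optimalSchedule`, and a best element of `X` by `argmin`, as `m₀` shows that `X` is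
      -- nonempty.
      isPortfolio : ∀ (C : Pred (Point (suc d) → Carrier) 0ℓ) α → (∀ f → C f → IsGauge f) →
                    (∀ f → C f → ∀ m′ → IsSchedule m′ → ∃ λ m → m ∈ X × f (loads m) ≤ α * f (loads m′)) →
                    IsPortfolio I C α (map loads X)
      isPortfolio C α gauge approx = record
        { feasible = Allₚ.map⁺ (All.map (λ {m} Σm → m , Σm , λ i → refl) X-schedules)
        ; approximate = λ f Cf → approximate f Cf X m₀∈X (approx f Cf)
        }
        where
        approximate : ∀ f → C f → ∀ X → m₀ ∈ X →
                      (∀ m′ → IsSchedule m′ → ∃ λ m → m ∈ X × f (loads m) ≤ α * f (loads m′)) →
                      ∃₂ λ x y → IsMinimiser f (_∈ map loads X) x × IsMinimiser f Feasible y × f x ≤ α * f y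
        approximate f Cf (m₁ ∷ X′) _ approx
          with argmin f (loads m₁) (map loads X′)
             | optimalSchedule d n (f ∘ loads) (λ eq → IsGauge.cong (gauge f Cf) λ i → *-congʳ (reflexive (≡.cong fromℕ (eq i))))
        ... | x , x∈ , x-min | m′ , Σm′ , m′-min with m , m∈ , bound ← approx m′ Σm′ =
          x , loads m′ , (x∈ , x-min) ,
          ((m′ , Σm′ , λ i → refl) , λ { y (m″ , Σm″ , y≈) →
            ≤-respʳ-≈ (IsGauge.cong (gauge f Cf) (λ i → sym (y≈ i))) (m′-min m″ Σm″) }) ,
          ≤-trans (x-min (loads m) (∈ₚ.∈-map⁺ loads m∈)) bound

    module _ (σ : Permutation′ (suc d)) (p↗ : ∀ i j → i Fin.≤ j → p (σ ⟨$⟩ʳ i) ≤ p (σ ⟨$⟩ʳ j)) where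

      P : Point (suc d)
      P r = p (σ ⟨$⟩ʳ r)

      0<P : ∀ r → 0# < P r
      0<P r = p>0 _

      -- The level presupposes a positive number of jobs; with no jobs the condition is vacuous.
      BalancedSchedule : Fin (suc d) → Vector ℕ (suc d) → Set
      BalancedSchedule κ m = (0<n : 0# < fromℕ n) → Machines.Balanced P 0<P p↗ 0<n κ (λ r → loads m (σ ⟨$⟩ʳ r))

      -- The common interface of the existence proof and the program: each supplies schedules
      -- balanced on 1, `b`, ..., `b ^ E` machines. In `b-large`, the first alternative stands for a
      -- `b` that was capped.
      module _ {α} (4<α : fromℕ 4 < α)
               {b} (2≤b : 2 ℕ.≤ b) (b+1≤α : fromℕ (suc b) ≤ α) (b-large : suc d ℕ.< b ⊎ α ≤ fromℕ 4 * fromℕ b)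
               {E} (bᴱ≤d : b ℕ.^ E ℕ.≤ suc d) (d<bᴱ⁺¹ : suc d ℕ.< b ℕ.^ suc E)
               (X : List (Vector ℕ (suc d))) (X-length : length X ≡ suc E) (X-schedules : All IsSchedule X)
               (X-balanced : ∀ e (κ : Fin (suc d)) → e ℕ.≤ E → suc (toℕ κ) ≡ b ℕ.^ e → ∃ λ m → m ∈ X × BalancedSchedule κ m)
               where

        private
          0<b = ℕₚ.<-≤-trans z<s 2≤b
          0<α = <-≤-trans (fromℕ-pos {suc b} z<s) b+1≤α

          0<α/4 : 0# < α / fromℕ 4
          0<α/4 = *-pos 0<α (⁻¹-pos (fromℕ-pos {4} z<s))

          1<α/4 : 1# < α / fromℕ 4
          1<α/4 = ≰⇒> λ α/4≤1 → ≤⇒≯ (begin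
            α                          ≈⟨ x*y/x α (fromℕ-pos {4} z<s) ⟨
            fromℕ 4 * (α / fromℕ 4)    ≤⟨ *-monoˡ-≤ _ (fromℕ-nonNegative 4) α/4≤1 ⟩
            fromℕ 4 * 1#               ≈⟨ *-identityʳ _ ⟩
            fromℕ 4                    ∎) 4<α

          1≤fromℕ-d : 1# ≤ fromℕ (suc d)
          1≤fromℕ-d = ≤-respˡ-≈ (+-identityʳ 1#) (fromℕ-mono-≤ {1} {suc d} (s≤s z≤n))

          -- Logarithms of `b ^ E ≤ suc d`, with `α / 4 ≤ b`. A capped `b` exceeds the number of
          -- machines and leaves only the exponent 0.
          E*ln≤ln : ∀ E → b ℕ.^ E ℕ.≤ suc d → fromℕ E * ln (α / fromℕ 4) ≤ ln (fromℕ (suc d))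
          E*ln≤ln zero    _ = ≤-respˡ-≈ (sym (zeroˡ _)) (ln-nonNegative 1≤fromℕ-d)
          E*ln≤ln (suc E) bᴱ≤d = begin
            fromℕ (suc E) * ln (α / fromℕ 4)  ≤⟨ *-monoˡ-≤ _ (fromℕ-nonNegative (suc E)) (ln-mono-≤ 0<α/4 α/4≤b) ⟩
            fromℕ (suc E) * ln (fromℕ b)      ≈⟨ ln-^ (suc E) 0<b ⟨
            ln (fromℕ (b ℕ.^ suc E))          ≤⟨ ln-mono-≤ (fromℕ-pos (ℕₚ.m^n>0 b {{ℕ.>-nonZero 0<b}} (suc E))) (fromℕ-mono-≤ bᴱ≤d) ⟩
            ln (fromℕ (suc d))                ∎
            where
            α/4≤b : α / fromℕ 4 ≤ fromℕ b
            α/4≤b = case b-large of λ where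
              (inj₁ d<b)  → contradiction (ℕₚ.≤-trans (ℕₚ.m≤m*n b (b ℕ.^ E) {{ℕ.>-nonZero (ℕₚ.m^n>0 b {{ℕ.>-nonZero 0<b}} E)}}) bᴱ≤d) (ℕₚ.<⇒≱ d<b)
              (inj₂ α≤4b) → x≤y*z⇒x/z≤y (fromℕ-pos {4} z<s) α≤4b

          1≤α : 1# ≤ α
          1≤α = ≤-trans (≤-respˡ-≈ (+-identityʳ 1#) (fromℕ-mono-≤ {1} {suc b} (s≤s z≤n))) b+1≤α

          first : ∃ λ m → m ∈ X × BalancedSchedule zero m
          first = X-balanced 0 zero z≤n ≡.refl

          gauge-approx : ∀ {f : Point (suc d) → Carrier} (gauge : IsGauge f) {c} → 1# ≤ c →
            (∀ (0<n : 0# < fromℕ n) y y-jobs y-integral →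
              Machines.Lower.Competitive P 0<P p↗ 0<n gauge y y-jobs y-integral c) →
            ∀ m′ → IsSchedule m′ → ∃ λ m → m ∈ X × f (loads m) ≤ (α * c) * f (loads m′)
          gauge-approx {f} gauge {c} 1≤c comp m′ Σm′ with n ℕₚ.≟ 0
          -- With no jobs all loads are 0, so any two schedules cost the same.
          ... | yes n≡0 = proj₁ first , proj₁ (proj₂ first) , (begin
              f (loads (proj₁ first))      ≈⟨ cong (λ i → *-congʳ (reflexive (≡.cong fromℕ (≡.trans
                                                (jobs-zero⇒zero {m = proj₁ first} (≡.trans (All.lookup X-schedules (proj₁ (proj₂ first))) n≡0) i)
                                                (≡.sym (jobs-zero⇒zero {m = m′} (≡.trans Σm′ n≡0) i)))))) ⟩
              f (loads m′)                 ≈⟨ *-identityˡ _ ⟨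
              1# * f (loads m′)            ≤⟨ *-monoʳ-≤ _ (nonNegative _) (begin
                1#      ≤⟨ 1≤α ⟩
                α       ≈⟨ *-identityʳ α ⟨
                α * 1#  ≤⟨ *-monoˡ-≤ α (<⇒≤ 0<α) 1≤c ⟩
                α * c   ∎) ⟩
              (α * c) * f (loads m′)       ∎)
              where open IsGauge gauge
          ... | no n≢0 = result
            where
            open IsGauge gauge
            0<n : 0# < fromℕ n
            0<n = fromℕ-pos (ℕₚ.n≢0⇒n>0 n≢0)

            y : Point (suc d)
            y r = loads m′ (σ ⟨$⟩ʳ r)

            y-jobs : fromℕ n ≈ sum λ r → P r ⁻¹ * y r
            y-jobs = begin-equality
              fromℕ n                                  ≡⟨ ≡.cong fromℕ Σm′ ⟨
              fromℕ (jobs m′)                         ≈⟨ fromℕ-sum m′ ⟩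
              sum (fromℕ ∘ m′)                         ≈⟨ sum-permute (fromℕ ∘ m′) σ ⟩
              sum (λ r → fromℕ (m′ (σ ⟨$⟩ʳ r)))        ≈⟨ sum-cong-≋ (λ r → trans
                (solve 3 (λ i m p → i :* (m :* p) := (p :* i) :* m) refl (P r ⁻¹) (fromℕ (m′ (σ ⟨$⟩ʳ r))) (P r))
                (trans (*-congʳ (⁻¹-inverseʳ (P r) (pos≉0 (0<P r)))) (*-identityˡ _))) ⟨
              sum (λ r → P r ⁻¹ * y r)                 ∎

            y-integral : ∀ r → y r ≈ 0# ⊎ P r ≤ y r
            y-integral r with m′ (σ ⟨$⟩ʳ r)
            ... | zero  = inj₁ (zeroˡ _)
            ... | suc k = inj₂ (≤-respˡ-≈ (*-identityˡ _) (*-monoʳ-≤ (P r) (<⇒≤ (0<P r))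
                            (≤-respˡ-≈ (+-identityʳ 1#) (+-monoʳ-≤ 1# (fromℕ-nonNegative k)))))

            open Machines P 0<P p↗ 0<n using (module Lower)
            open Lower gauge y y-jobs y-integral using (rounding-bound; Competitive)

            result : ∃ λ m → m ∈ X × f (loads m) ≤ (α * c) * f (loads m′)
            result = round (comp 0<n y y-jobs y-integral)
              where
              0≤c = ≤-trans (<⇒≤ 0<1) 1≤c

              round : Competitive c → ∃ λ m → m ∈ X × f (loads m) ≤ (α * c) * f (loads m′)
              round competitive@(j , _)
                -- `j + 1` machines are rounded down to the power `b ^ e = κ + 1`; indices start at
                -- 0.
                with e , e<1+E , bᵉ≤j , j<bᵉ⁺¹ ← power-bracket b (suc E) {suc (toℕ j)} (s≤s z≤n) (ℕₚ.≤-<-trans (Finₚ.toℕ<n j) d<bᴱ⁺¹)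
                with κ , κ≡bᵉ ← index (ℕₚ.m^n>0 b {{ℕ.>-nonZero 0<b}} e) (ℕₚ.≤-trans bᵉ≤j (Finₚ.toℕ<n j))
                with m , m∈ , balanced ← X-balanced e κ (ℕₚ.≤-pred e<1+E) κ≡bᵉ = m , m∈ , (begin
                  f (loads m)                         ≤⟨ symmetric⁻¹ σ (loads m) ⟩
                  f (λ r → loads m (σ ⟨$⟩ʳ r))        ≤⟨ rounding-bound {b = b} 1≤c competitive κ
                      (ℕₚ.≤-pred (≡.subst (ℕ._≤ suc (toℕ j)) (≡.sym κ≡bᵉ) bᵉ≤j))
                      (≡.subst (λ k → suc (toℕ j) ℕ.≤ b ℕ.* k) (≡.sym κ≡bᵉ) (ℕₚ.<⇒≤ j<bᵉ⁺¹))
                      (λ r → 0≤loads m _) (balanced 0<n) ⟩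
                  fromℕ (suc b) * (c * f y)           ≤⟨ *-mono-≤ (fromℕ-nonNegative (suc b)) (*-nonNegative 0≤c (nonNegative _)) b+1≤α (*-monoˡ-≤ c 0≤c (symmetric σ (loads m′))) ⟩
                  α * (c * f (loads m′))              ≈⟨ *-assoc _ _ _ ⟨
                  (α * c) * f (loads m′)              ∎)

        isGoodPortfolio : IsGoodPortfolio 1# I α (map loads X)
        isGoodPortfolio = record
          { size = begin
              fromℕ (length (map loads X))   ≡⟨ ≡.cong fromℕ (≡.trans (length-map loads X) X-length) ⟩
              1# + fromℕ E                   ≤⟨ +-monoʳ-≤ 1# (x*z≤y⇒x≤y/z (ln-pos 1<α/4) (≤-respˡ-≈ (*-comm _ _) (E*ln≤ln E bᴱ≤d))) ⟩
              1# + ln (fromℕ (suc d)) / ln (α / fromℕ 4) ≈⟨ *-identityˡ _ ⟨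
              1# * (1# + ln (fromℕ (suc d)) / ln (α / fromℕ 4)) ∎
          ; ordered = isPortfolio X X-schedules (proj₁ (proj₂ first)) IsOrderedNorm α
              (λ { f (w , W , f≈) → f-resp-gauge W f≈ })
              λ { f (w , W , f≈) m′ Σm′ →
                let m , m∈ , bound = gauge-approx (f-resp-gauge W f≈) ≤-refl
                                       (λ 0<n y y-jobs int → orderedNorm-competitive P 0<P p↗ 0<n (f-resp-gauge W f≈) y y-jobs int W f≈) m′ Σm′
                in m , m∈ , ≤-respʳ-≈ (*-congʳ (*-identityʳ α)) bound }
          ; symmetric = isPortfolio X X-schedules (proj₁ (proj₂ first)) IsSymmetricMonotonicNorm (1# * (α * (1# + ln (fromℕ (suc d)))))
              (λ f N → symmetricMonotonicNorm⇒gauge N)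
              λ f N m′ Σm′ →
                let gauge = symmetricMonotonicNorm⇒gauge N
                    m , m∈ , bound = gauge-approx gauge (1≤harmonic d) (λ 0<n y y-jobs int → gauge-competitive P 0<P p↗ 0<n gauge y y-jobs int) m′ Σm′
                in m , m∈ , ≤-trans bound (*-monoʳ-≤ _ (IsGauge.nonNegative gauge _)
                     (≤-respʳ-≈ (sym (*-identityˡ _)) (*-monoˡ-≤ α (<⇒≤ 0<α) (harmonic≤1+ln d))))
          }

-- Existence for real processing times.

module Existence (R : RealField) (L : NaturalLog R) where
  open RealField R hiding (zero)
  open OrderedField R
  open Rearrangement R
  open PrefixSums R
  open Portfolios R L
  open SortedMachines R L
  open Construction R L
  open Solver using (solve; con; _:=_; _:+_; _:*_; _:-_)
  open ≤-Reasoning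

  term≤sum : ∀ {n} {x : Vector Carrier n} → (∀ i → 0# ≤ x i) → ∀ i → x i ≤ sum x
  term≤sum {suc n} {x} 0≤x zero    = ≤-respˡ-≈ (+-identityʳ _) (+-monoʳ-≤ _ (sum-nonNegative (0≤x ∘ suc)))
  term≤sum {suc n} {x} 0≤x (suc i) = ≤-respˡ-≈ (+-identityˡ _) (+-mono-≤ (0≤x zero) (term≤sum (0≤x ∘ suc) i))

  -- A downward search from a known bound `n`; the first failure `fromℕ n * p < T` gives the upper
  -- estimate.
  ceiling : ∀ {T p} n → 0# ≤ T → 0# < p → T ≤ fromℕ n * p → ∃ λ u → T ≤ fromℕ u * p × fromℕ u * p ≤ T + p
  ceiling {T} {p} zero    0≤T 0<p T≤np = 0 , T≤np , ≤-trans (≤-reflexive (zeroˡ p)) (≤-respˡ-≈ (+-identityʳ 0#) (+-mono-≤ 0≤T (<⇒≤ 0<p)))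
  ceiling {T} {p} (suc n) 0≤T 0<p T≤np with T ≤? (fromℕ n * p)
  ... | yes T≤ = ceiling n 0≤T 0<p T≤
  ... | no  T≰ = suc n , T≤np , (begin
      (1# + fromℕ n) * p      ≈⟨ distribʳ _ _ _ ⟩
      1# * p + fromℕ n * p    ≈⟨ +-comm _ _ ⟩
      fromℕ n * p + 1# * p    ≤⟨ +-mono-≤ (<⇒≤ (≰⇒> T≰)) (≤-reflexive (*-identityˡ p)) ⟩
      T + p                   ∎)

  -- A search for `⌊α⌋ - 1` upwards from 3, stopped after `D` increments. With `D` one less than the
  -- number of machines, a `b` that reaches the cap exceeds this number, and then the portfolio has
  -- a single element however large `α` is.
  boundedFloor : ∀ {α} → fromℕ 4 ≤ α → ∀ D → ∃ λ b → 3 ℕ.≤ b × fromℕ (suc b) ≤ α × (3 ℕ.+ D ℕ.≤ b ⊎ α ≤ fromℕ (suc (suc b)))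
  boundedFloor 4≤α zero = 3 , ℕₚ.≤-refl , 4≤α , inj₁ ℕₚ.≤-refl
  boundedFloor {α} 4≤α (suc D) with boundedFloor 4≤α D
  ... | b , 3≤b , b+1≤α , inj₂ α≤b+2 = b , 3≤b , b+1≤α , inj₂ α≤b+2
  ... | b , 3≤b , b+1≤α , inj₁ D≤b with fromℕ (suc (suc b)) ≤? α
  ... | yes b+2≤α = suc b , ℕₚ.m≤n⇒m≤1+n 3≤b , b+2≤α , inj₁ (ℕₚ.≤-trans (ℕₚ.≤-reflexive (ℕₚ.+-suc 3 D)) (s≤s D≤b))
  ... | no  b+2≰α = b , 3≤b , b+1≤α , inj₂ (<⇒≤ (≰⇒> b+2≰α))

  ≤b+2⇒≤4b : ∀ {α b} → 3 ℕ.≤ b → α ≤ fromℕ (suc (suc b)) → α ≤ fromℕ 4 * fromℕ b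
  ≤b+2⇒≤4b {α} {b} 3≤b α≤b+2 = ≤-trans α≤b+2 (≤-respʳ-≈ (fromℕ-* 4 b) (fromℕ-mono-≤
    (ℕₚ.≤-trans (ℕₚ.+-monoˡ-≤ b (ℕₚ.≤-trans (ℕₚ.n≤1+n 2) 3≤b)) (ℕₚ.+-monoʳ-≤ b (ℕₚ.m≤m+n b _)))))

  module _ {d} (I : MLIJ (suc d)) where
    open MLIJ I

    module _ (σ : Permutation′ (suc d)) (p↗ : ∀ i j → i Fin.≤ j → p (σ ⟨$⟩ʳ i) ≤ p (σ ⟨$⟩ʳ j)) where

      private
        p′ : Point (suc d)
        p′ = P I σ p↗

        0<p′ : ∀ r → 0# < p′ r
        0<p′ = 0<P I σ p↗

      module _ (0<n : 0# < fromℕ n) (κ : Fin (suc d)) where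
        open Machines p′ 0<p′ p↗ 0<n

        -- One of the selected machines alone is no faster than all of them together. This is the
        -- bound from which `ceiling` searches.
        level≤n*p : ∀ r → r Fin.≤ κ → level κ ≤ fromℕ n * p′ r
        level≤n*p r r≤κ = x≤y*z⇒x/z≤y (0<S κ) (begin
          fromℕ n                        ≈⟨ *-identityˡ _ ⟨
          1# * fromℕ n                   ≈⟨ *-congʳ (trans (sym (⁻¹-inverseʳ (p′ r) (pos≉0 (0<p′ r)))) (*-comm _ _)) ⟩
          (Q r * p′ r) * fromℕ n         ≤⟨ *-monoʳ-≤ _ (fromℕ-nonNegative n) (*-monoʳ-≤ _ (<⇒≤ (0<p′ r)) Q≤S) ⟩
          (S κ * p′ r) * fromℕ n         ≈⟨ solve 3 (λ s p n → (s :* p) :* n := s :* (n :* p)) refl (S κ) (p′ r) (fromℕ n) ⟩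
          S κ * (fromℕ n * p′ r)         ∎)
          where
          Q≤S : Q r ≤ S κ
          Q≤S = ≤-respˡ-≈ (trans (*-congʳ (reflexive (indicator-< {i = r} (s≤s r≤κ)))) (*-identityˡ _))
            (term≤sum {x = λ i → initial κ i * Q i} (λ i → *-nonNegative (0≤indicator (suc (toℕ κ)) i) (<⇒≤ (0<Q i))) r)

        Rounded : Fin (suc d) → ℕ → Set
        Rounded r u = initial κ r * level κ ≤ fromℕ u * p′ r × fromℕ u * p′ r ≤ initial κ r * (level κ + p′ r)

        choice : ∀ r → ∃ (Rounded r)
        choice r = case toℕ r ℕₚ.≤? toℕ κ of λ where
            (no  r≰κ) → 0 , ≤-reflexive (trans (off r≰κ (level κ)) (sym (zeroˡ (p′ r)))) , ≤-reflexive (trans (zeroˡ (p′ r)) (sym (off r≰κ (level κ + p′ r))))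
            (yes r≤κ) → rounded r≤κ (ceiling n (0≤level κ) (0<p′ r) (level≤n*p r r≤κ))
          where
          off : ¬ r Fin.≤ κ → ∀ x → initial κ r * x ≈ 0#
          off r≰κ x = trans (*-congʳ (reflexive (indicator-≥ {i = r} (ℕₚ.≰⇒> r≰κ)))) (zeroˡ x)

          on : r Fin.≤ κ → ∀ x → initial κ r * x ≈ x
          on r≤κ x = trans (*-congʳ (reflexive (indicator-< {i = r} (s≤s r≤κ)))) (*-identityˡ x)

          rounded : r Fin.≤ κ → (∃ λ u → level κ ≤ fromℕ u * p′ r × fromℕ u * p′ r ≤ level κ + p′ r) → ∃ (Rounded r)
          rounded r≤κ (u , T≤up , up≤T+p) = u , ≤-respˡ-≈ (sym (on r≤κ (level κ))) T≤up , ≤-respʳ-≈ (sym (on r≤κ (level κ + p′ r))) up≤T+p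

        u : Vector ℕ (suc d)
        u r = proj₁ (choice r)

        u-upper : ∀ r → fromℕ (u r) * p′ r ≤ initial κ r * (level κ + p′ r)
        u-upper r = proj₂ (proj₂ (choice r))

        -- After rounding up, each machine `r` up to `κ` receives at least its fractional share
        -- `Q r * level κ`, and these shares add up to `n`.
        n≤Σu : n ℕ.≤ jobs u
        n≤Σu = fromℕ-cancel-≤ (begin
          fromℕ n                                        ≈⟨ x*y/x (fromℕ n) (0<S κ) ⟨
          S κ * level κ                                  ≈⟨ *-distribʳ-sum (level κ) (λ r → initial κ r * Q r) ⟩
          sum (λ r → (initial κ r * Q r) * level κ)      ≤⟨ sum-mono-≤ (λ r → begin
            (initial κ r * Q r) * level κ   ≈⟨ solve 3 (λ i q l → (i :* q) :* l := q :* (i :* l)) refl (initial κ r) (Q r) (level κ) ⟩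
            Q r * (initial κ r * level κ)   ≤⟨ *-monoˡ-≤ (Q r) (<⇒≤ (0<Q r)) (proj₁ (proj₂ (choice r))) ⟩
            Q r * (fromℕ (u r) * p′ r)      ≈⟨ solve 3 (λ q u p → q :* (u :* p) := (p :* q) :* u) refl (Q r) (fromℕ (u r)) (p′ r) ⟩
            (p′ r * Q r) * fromℕ (u r)      ≈⟨ *-congʳ (⁻¹-inverseʳ (p′ r) (pos≉0 (0<p′ r))) ⟩
            1# * fromℕ (u r)                ≈⟨ *-identityˡ _ ⟩
            fromℕ (u r)                     ∎) ⟩
          sum (fromℕ ∘ u)                                ≈⟨ fromℕ-sum u ⟨
          fromℕ (jobs u)                                 ∎)

        m : Vector ℕ (suc d)
        m = proj₁ (truncate u n n≤Σu)

        Σm : jobs m ≡ n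
        Σm = proj₁ (proj₂ (truncate u n n≤Σu))

        m≤u : ∀ r → m r ℕ.≤ u r
        m≤u = proj₂ (proj₂ (truncate u n n≤Σu))

        balancedJobs : Vector ℕ (suc d)
        balancedJobs i = m (σ ⟨$⟩ˡ i)

        balancedJobs-schedule : IsSchedule balancedJobs
        balancedJobs-schedule = ≡.trans (jobs-permute m (Perm.flip σ)) Σm

        balancedJobs-balanced : BalancedSchedule I σ p↗ κ balancedJobs
        balancedJobs-balanced _ r = begin
          fromℕ (m (σ ⟨$⟩ˡ (σ ⟨$⟩ʳ r))) * p′ r   ≡⟨ ≡.cong (λ i → fromℕ (m i) * p′ r) (Perm.inverseˡ σ) ⟩
          fromℕ (m r) * p′ r                     ≤⟨ *-monoʳ-≤ (p′ r) (<⇒≤ (0<p′ r)) (fromℕ-mono-≤ (m≤u r)) ⟩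
          fromℕ (u r) * p′ r                     ≤⟨ u-upper r ⟩
          initial κ r * (level κ + p′ r)         ∎

      balancedSchedule : ∀ κ → ∃ λ m → IsSchedule m × BalancedSchedule I σ p↗ κ m
      balancedSchedule κ = case n ℕₚ.≟ 0 of λ where
          (yes n≡0) → (λ _ → 0) , ≡.trans (jobs-const-zero (suc d)) (≡.sym n≡0) ,
            λ 0<n → contradiction (≡.subst (λ k → 0# < fromℕ k) n≡0 0<n) <-irrefl
          (no n≢0) → positive (fromℕ-pos (ℕₚ.n≢0⇒n>0 n≢0))
        where
        positive : 0# < fromℕ n → ∃ λ m → IsSchedule m × BalancedSchedule I σ p↗ κ m
        positive 0<n = balancedJobs 0<n κ , balancedJobs-schedule 0<n κ , balancedJobs-balanced 0<n κ

  existence : ∀ d .{{_ : NonZero d}} (I : MLIJ d) α → fromℕ 4 < α → ∃ λ X → IsGoodPortfolio 1# I α X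
  existence (suc d) I α 4<α =
    let b , 3≤b , b+1≤α , b-large = boundedFloor (<⇒≤ 4<α) d
        2≤b = ℕₚ.≤-trans (ℕₚ.n≤1+n 2) 3≤b
        E , _ , bᴱ≤d , d<bᴱ⁺¹ = power-bracket b (suc d) {suc d} (s≤s z≤n) (n<b^n 2≤b (suc d))
    in map (MLIJ.loads I) (X E 2≤b bᴱ≤d) , good E 2≤b bᴱ≤d 3≤b b+1≤α b-large d<bᴱ⁺¹
    where
    open MLIJ I using (p)
    open SortingPermutation decTotalOrder

    module _ {b} E (2≤b : 2 ℕ.≤ b) (bᴱ≤d : b ℕ.^ E ℕ.≤ suc d) where
      instance
        b≢0 : NonZero b
        b≢0 = ℕ.>-nonZero (ℕₚ.<-≤-trans z<s 2≤b)

      machine : (e : Fin (suc E)) → ∃ λ (κ : Fin (suc d)) → suc (toℕ κ) ≡ b ℕ.^ toℕ e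
      machine e = index (ℕₚ.m^n>0 b (toℕ e)) (ℕₚ.≤-trans (ℕₚ.^-monoʳ-≤ b (ℕₚ.≤-pred (Finₚ.toℕ<n e))) bᴱ≤d)

      schedule : Fin (suc E) → Vector ℕ (suc d)
      schedule e = proj₁ (balancedSchedule I (σ p) (σ-sorted p) (proj₁ (machine e)))

      X : List (Vector ℕ (suc d))
      X = List.tabulate schedule

      covering : ∀ e (κ : Fin (suc d)) → e ℕ.≤ E → suc (toℕ κ) ≡ b ℕ.^ e →
                 ∃ λ m → m ∈ X × BalancedSchedule I (σ p) (σ-sorted p) κ m
      covering e κ e≤E κ≡bᵉ = schedule e′ , ∈ₚ.∈-tabulate⁺ {f = schedule} e′ ,
        ≡.subst (λ κ → BalancedSchedule I (σ p) (σ-sorted p) κ (schedule e′)) κ′≡κ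
          (proj₂ (proj₂ (balancedSchedule I (σ p) (σ-sorted p) (proj₁ (machine e′)))))
        where
        e′ = fromℕ< (s≤s e≤E)
        κ′≡κ : proj₁ (machine e′) ≡ κ
        κ′≡κ = Finₚ.toℕ-injective (ℕₚ.suc-injective (≡.trans (proj₂ (machine e′))
          (≡.trans (≡.cong (b ℕ.^_) (Finₚ.toℕ-fromℕ< (s≤s e≤E))) (≡.sym κ≡bᵉ))))

      good : 3 ℕ.≤ b → fromℕ (suc b) ≤ α → (3 ℕ.+ d ℕ.≤ b ⊎ α ≤ fromℕ (suc (suc b))) → suc d ℕ.< b ℕ.^ suc E →
             IsGoodPortfolio 1# I α (map (MLIJ.loads I) X)
      good 3≤b b+1≤α b-large d<bᴱ⁺¹ = isGoodPortfolio I (σ p) (σ-sorted p) 4<α 2≤b b+1≤α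
        ([ (λ 3+d≤b → inj₁ (ℕₚ.<-≤-trans (ℕₚ.n<1+n _) (ℕₚ.≤-trans (ℕₚ.n≤1+n _) 3+d≤b))) , inj₂ ∘ ≤b+2⇒≤4b 3≤b ]′ b-large)
        bᴱ≤d d<bᴱ⁺¹ X (length-tabulate schedule)
        (Allₚ.tabulate⁺ {f = schedule} (λ e → proj₁ (proj₂ (balancedSchedule I (σ p) (σ-sorted p) (proj₁ (machine e))))))
        covering

-- The lower bound on the size of portfolios.

module LowerBound (R : RealField) (L : NaturalLog R) where
  open RealField R hiding (zero)
  open NaturalLog L
  open OrderedField R
  open Rearrangement R
  open PrefixSums R
  open Portfolios R L
  open Gauges R L
  open Logarithms R L
  open Solver using (solve; con; _:=_; _:+_; _:*_; _:-_)
  open ≤-Reasoning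

  private
    bracket : ∀ i → ∃ λ e → e ℕ.< suc i × 4 ℕ.^ e ℕ.≤ suc i × suc i ℕ.< 4 ℕ.^ suc e
    bracket i = power-bracket 4 (suc i) {suc i} (s≤s z≤n) (n<b^n (s≤s (s≤s z≤n)) (suc i))

  ⌊log₄1+_⌋ : ℕ → ℕ
  ⌊log₄1+ i ⌋ = proj₁ (bracket i)

  private
    4^-cancel-≤ : ∀ {m n} → 4 ℕ.^ m ℕ.< 4 ℕ.^ suc n → m ℕ.≤ n
    4^-cancel-≤ p = ℕₚ.≮⇒≥ λ n<m → ℕₚ.<⇒≱ p (ℕₚ.^-monoʳ-≤ 4 n<m)

    log₄-≥ : ∀ {t i} → 4 ℕ.^ t ℕ.≤ suc i → t ℕ.≤ ⌊log₄1+ i ⌋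
    log₄-≥ {i = i} p = 4^-cancel-≤ (ℕₚ.≤-<-trans p (proj₂ (proj₂ (proj₂ (bracket i)))))

    log₄-≤ : ∀ {t i} → suc i ℕ.≤ 4 ℕ.^ t → ⌊log₄1+ i ⌋ ℕ.≤ t
    log₄-≤ {t} {i} p = 4^-cancel-≤ (ℕₚ.≤-<-trans (proj₁ (proj₂ (proj₂ (bracket i))))
      (ℕₚ.≤-<-trans p (ℕₚ.^-monoʳ-< 4 (s≤s (s≤s z≤n)) (ℕₚ.n<1+n t))))

    log₄-mono : ∀ {i j} → i ℕ.≤ j → ⌊log₄1+ i ⌋ ℕ.≤ ⌊log₄1+ j ⌋
    log₄-mono {i} i≤j = log₄-≥ (ℕₚ.≤-trans (proj₁ (proj₂ (proj₂ (bracket i)))) (s≤s i≤j))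

    0<2^ : ∀ k → 0 ℕ.< 2 ℕ.^ k
    0<2^ = ℕₚ.m^n>0 2

    4^≡2^*2^ : ∀ t → 4 ℕ.^ t ≡ 2 ℕ.^ t ℕ.* 2 ℕ.^ t
    4^≡2^*2^ t = ≡.trans (ℕₚ.^-*-assoc 2 2 t) (≡.trans (≡.cong (2 ℕ.^_) (≡.cong (t ℕ.+_) (ℕₚ.+-identityʳ t))) (ℕₚ.^-distribˡ-+-* 2 t t))

  -- Machine i has speed about 1/√(1 + i), so that k fast machines have
  -- total speed about √k.
  family : (d : ℕ) → MLIJ d
  family d = record { n = 4 ℕ.^ d ; p = λ i → fromℕ (2 ℕ.^ ⌊log₄1+ toℕ i ⌋) ; p>0 = λ i → fromℕ-pos (0<2^ ⌊log₄1+ toℕ i ⌋) }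

  module _ (d : ℕ) where
    open MLIJ (family (suc d))

    private
      Q : Vector Carrier (suc d)
      Q i = p i ⁻¹

      0<Q : ∀ i → 0# < Q i
      0<Q i = ⁻¹-pos (p>0 i)

      Q↘ : Decreasing Q
      Q↘ i j i≤j = ⁻¹-antimono-≤ (p>0 i) (fromℕ-mono-≤ (ℕₚ.^-monoʳ-≤ 2 (log₄-mono i≤j)))

      Q*2^≤1 : ∀ s i → 4 ℕ.^ s ℕ.≤ suc (toℕ i) → Q i * fromℕ (2 ℕ.^ s) ≤ 1#
      Q*2^≤1 s i 4ˢ≤ = ≤-respʳ-≈ (trans (*-comm _ _) (⁻¹-inverseʳ (p i) (pos≉0 (p>0 i))))
        (*-monoˡ-≤ (Q i) (<⇒≤ (0<Q i)) (fromℕ-mono-≤ (ℕₚ.^-monoʳ-≤ 2 (log₄-≥ {s} 4ˢ≤))))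

      -- Each of the 3 * 4 ^ s machines added in a step has speed at most 1 / 2 ^ s.
      total-speed : ∀ s → 4 ℕ.^ s ℕ.≤ suc d → prefix Q (4 ℕ.^ s) ≤ fromℕ 3 * fromℕ (2 ℕ.^ s)
      total-speed zero    _ = begin
        1# * Q zero + prefix (Q ∘ suc) 0   ≈⟨ +-cong (*-identityˡ _) (prefix-zero (Q ∘ suc)) ⟩
        Q zero + 0#                        ≈⟨ +-identityʳ _ ⟩
        Q zero                             ≈⟨ trans (*-congˡ (+-identityʳ 1#)) (*-identityʳ _) ⟨
        Q zero * fromℕ 1                   ≤⟨ Q*2^≤1 0 zero (s≤s z≤n) ⟩
        1#                                 ≈⟨ *-identityʳ 1# ⟨
        1# * 1#                            ≤⟨ *-mono-≤ (<⇒≤ 0<1) (fromℕ-nonNegative 1) 1≤3 (≤-reflexive (sym (+-identityʳ 1#))) ⟩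
        fromℕ 3 * fromℕ 1                  ∎
        where
        1≤3 : 1# ≤ fromℕ 3
        1≤3 = ≤-respˡ-≈ (+-identityʳ 1#) (fromℕ-mono-≤ {1} {3} (s≤s z≤n))
      total-speed (suc s) 4ˢ⁺¹≤d with κ , κ≡4ˢ ← index (ℕₚ.m^n>0 4 s) (ℕₚ.≤-trans (ℕₚ.^-monoʳ-≤ 4 (ℕₚ.n≤1+n s)) 4ˢ⁺¹≤d) =
        -- `S⁺ ≤ S + 3 * B * B * q ≤ 3 * B + 3 * B`. The three summands are the slacks of
        -- `tail-bound`, of the induction hypothesis and of `q * B ≤ 1`, the last one multiplied by
        -- `3 * B`.
        0≤y-x⇒x≤y (≤-respʳ-≈ (begin-equality
          ((S + fromℕ (4 ℕ.^ suc s) * q) - (S⁺ + K * q)) + (fromℕ 3 * B - S) + fromℕ 3 * B * (1# - q * B)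
            ≈⟨ +-congʳ (+-congʳ (+-congʳ (+-congˡ (*-congʳ (trans (fromℕ-* 4 (4 ℕ.^ s)) (*-congˡ K≈B*B)))))) ⟩
          ((S + (fromℕ 4 * (B * B)) * q) - (S⁺ + K * q)) + (fromℕ 3 * B - S) + fromℕ 3 * B * (1# - q * B)
            ≈⟨ +-congʳ (+-congʳ (+-congˡ (-‿cong (+-congˡ (*-congʳ K≈B*B))))) ⟩
          ((S + (fromℕ 4 * (B * B)) * q) - (S⁺ + (B * B) * q)) + (fromℕ 3 * B - S) + fromℕ 3 * B * (1# - q * B)
            ≈⟨ +-congˡ (*-congˡ (+-congʳ (sym (+-identityʳ 1#)))) ⟩
          ((S + (fromℕ 4 * (B * B)) * q) - (S⁺ + (B * B) * q)) + (fromℕ 3 * B - S) + fromℕ 3 * B * (fromℕ 1 - q * B)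
            ≈⟨ solve 4 (λ S S⁺ B q → ((S :+ (con (+ 4) :* (B :* B)) :* q) :- (S⁺ :+ (B :* B) :* q)) :+ (con (+ 3) :* B :- S) :+ con (+ 3) :* B :* (con (+ 1) :- q :* B)
                 := con (+ 3) :* (con (+ 2) :* B) :- S⁺) refl S S⁺ B q ⟩
          fromℕ 3 * (fromℕ 2 * B) - S⁺
            ≈⟨ +-congʳ (*-congˡ (fromℕ-* 2 (2 ℕ.^ s))) ⟨
          fromℕ 3 * fromℕ (2 ℕ.^ suc s) - S⁺ ∎)
          (≤-respˡ-≈ (trans (+-identityʳ _) (+-identityʳ _)) (+-mono-≤ (+-mono-≤
            (x≤y⇒0≤y-x (≡.subst (λ k → S⁺ + fromℕ k * q ≤ prefix Q k + fromℕ (4 ℕ.^ suc s) * q) κ≡4ˢ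
              (tail-bound Q↘ κ (≡.subst (ℕ._≤ 4 ℕ.^ suc s) (≡.sym κ≡4ˢ) (ℕₚ.^-monoʳ-≤ 4 (ℕₚ.n≤1+n s))) 4ˢ⁺¹≤d)))
            (x≤y⇒0≤y-x (total-speed s (ℕₚ.≤-trans (ℕₚ.^-monoʳ-≤ 4 (ℕₚ.n≤1+n s)) 4ˢ⁺¹≤d))))
            (*-nonNegative (*-nonNegative (fromℕ-nonNegative 3) (fromℕ-nonNegative (2 ℕ.^ s)))
              (x≤y⇒0≤y-x (Q*2^≤1 s κ (ℕₚ.≤-reflexive (≡.sym κ≡4ˢ))))))))
        where
        S = prefix Q (4 ℕ.^ s)
        S⁺ = prefix Q (4 ℕ.^ suc s)
        K = fromℕ (4 ℕ.^ s)
        B = fromℕ (2 ℕ.^ s)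
        q = Q κ
        K≈B*B : K ≈ B * B
        K≈B*B = trans (reflexive (≡.cong fromℕ (4^≡2^*2^ s))) (fromℕ-* (2 ℕ.^ s) (2 ℕ.^ s))

    weight : ℕ → Point (suc d)
    weight t zero    = fromℕ (4 ℕ.^ t) + 1#
    weight t (suc i) = 1#

    private
      0≤4^ : ∀ t → 0# ≤ fromℕ (4 ℕ.^ t)
      0≤4^ t = fromℕ-nonNegative (4 ℕ.^ t)

      1≤4^+1 : ∀ t → 1# ≤ fromℕ (4 ℕ.^ t) + 1#
      1≤4^+1 t = ≤-respˡ-≈ (+-identityˡ 1#) (+-monoˡ-≤ 1# (0≤4^ t))

      0<weight : ∀ t i → 0# < weight t i
      0<weight t zero    = <-≤-trans 0<1 (1≤4^+1 t)
      0<weight t (suc i) = 0<1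

    isWeight : ∀ t → IsWeight (weight t)
    isWeight t = record
      { nonZero     = zero , pos≉0 (0<weight t zero)
      ; decreasing  = λ { zero zero _ → ≤-refl ; zero (suc j) _ → 1≤4^+1 t ; (suc i) (suc j) _ → ≤-refl }
      ; nonNegative = λ i → <⇒≤ (0<weight t i)
      }

    weighted-sum : ∀ t (a : Vector Carrier (suc d)) → sum (λ i → weight t i * a i) ≈ fromℕ (4 ℕ.^ t) * a zero + sum a
    weighted-sum t a = trans (+-cong (distribʳ _ _ _) (sum-cong-≋ {d} (λ i → *-identityˡ (a (suc i)))))
      (trans (+-congʳ (+-congˡ (*-identityˡ _))) (+-assoc _ _ _))

    -- A transposition brings coordinate `i` to the front, where the additional weight `4 ^ t` sits;
    -- no arrangement of the coordinates exceeds the norm.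
    norm-lower : ∀ t x i → fromℕ (4 ℕ.^ t) * ∣ x i ∣ + sum (λ i → ∣ x i ∣) ≤ ‖ x ‖⟨ weight t ⟩
    norm-lower t x i = begin
      fromℕ (4 ℕ.^ t) * ∣ x i ∣ + sum (λ i → ∣ x i ∣)                        ≈⟨ +-congˡ (sum-permute (λ i → ∣ x i ∣) π) ⟩
      fromℕ (4 ℕ.^ t) * ∣ x (π ⟨$⟩ʳ zero) ∣ + sum (λ i → ∣ x (π ⟨$⟩ʳ i) ∣)  ≈⟨ weighted-sum t (λ i → ∣ x (π ⟨$⟩ʳ i) ∣) ⟨
      sum (λ i → weight t i * ∣ x (π ⟨$⟩ʳ i) ∣)                              ≤⟨ pair≤norm (isWeight t) π x ⟩
      ‖ x ‖⟨ weight t ⟩                                                      ∎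
      where
      π : Permutation′ (suc d)
      π = Perm.transpose zero i

    norm-upper : ∀ t {x M} → (∀ i → 0# ≤ x i) → (∀ i → x i ≤ M) → ‖ x ‖⟨ weight t ⟩ ≤ fromℕ (4 ℕ.^ t) * M + sum x
    norm-upper t {x} {M} 0≤x x≤M with π , attained , _ ← norm-attained (isWeight t) x = begin
      ‖ x ‖⟨ weight t ⟩                                                      ≈⟨ attained ⟩
      sum (λ i → weight t i * ∣ x (π ⟨$⟩ʳ i) ∣)                              ≈⟨ weighted-sum t (λ i → ∣ x (π ⟨$⟩ʳ i) ∣) ⟩
      fromℕ (4 ℕ.^ t) * ∣ x (π ⟨$⟩ʳ zero) ∣ + sum (λ i → ∣ x (π ⟨$⟩ʳ i) ∣)  ≈⟨ +-cong (*-congˡ (∣∣-nonNeg (0≤x _))) (sum-cong-≋ {suc d} λ i → ∣∣-nonNeg (0≤x (π ⟨$⟩ʳ i))) ⟩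
      fromℕ (4 ℕ.^ t) * x (π ⟨$⟩ʳ zero) + sum (λ i → x (π ⟨$⟩ʳ i))          ≈⟨ +-congˡ (sum-permute x π) ⟨
      fromℕ (4 ℕ.^ t) * x (π ⟨$⟩ʳ zero) + sum x                             ≤⟨ +-monoˡ-≤ _ (*-monoˡ-≤ _ (0≤4^ t) (x≤M _)) ⟩
      fromℕ (4 ℕ.^ t) * M + sum x                                           ∎

    -- The first `4 ^ t` machines share the jobs equally, which is possible because `n` is a larger
    -- power of 4. Their processing times are at most `2 ^ t`, so the loads are at most `n / 2 ^ t`,
    -- and both parts of the norm are at most `n * 2 ^ t`.
    optimum-bound : ∀ t → 4 ℕ.^ t ℕ.≤ suc d → ∃ λ m → IsSchedule m ×
                    ‖ loads m ‖⟨ weight t ⟩ ≤ fromℕ 2 * (fromℕ n * fromℕ (2 ℕ.^ t))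
    optimum-bound t 4ᵗ≤d = m , Σm≡n , (begin
        ‖ loads m ‖⟨ weight t ⟩                                 ≤⟨ norm-upper t (λ i → *-nonNegative (fromℕ-nonNegative (m i)) (<⇒≤ (p>0 i))) load≤ ⟩
        fromℕ (4 ℕ.^ t) * (C * B) + sum (loads m)               ≤⟨ +-monoʳ-≤ _ (sum-mono-≤ loads≤) ⟩
        fromℕ (4 ℕ.^ t) * (C * B) + sum (λ i → fromℕ (m i) * B) ≈⟨ +-congˡ (*-distribʳ-sum B (fromℕ ∘ m)) ⟨
        fromℕ (4 ℕ.^ t) * (C * B) + sum (fromℕ ∘ m) * B         ≈⟨ +-congˡ (*-congʳ (trans (sym (fromℕ-sum m)) (reflexive (≡.cong fromℕ Σm≡n)))) ⟩
        fromℕ (4 ℕ.^ t) * (C * B) + fromℕ n * B                 ≈⟨ +-congʳ (trans (sym (*-assoc _ _ _)) (*-congʳ (trans (sym (fromℕ-* (4 ℕ.^ t) c)) (reflexive (≡.cong fromℕ 4ᵗ*c≡n))))) ⟩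
        fromℕ n * B + fromℕ n * B                               ≈⟨ solve 1 (λ x → x :+ x := con (+ 2) :* x) refl (fromℕ n * B) ⟩
        fromℕ 2 * (fromℕ n * B)                                 ∎)
      where
      t≤d : t ℕ.≤ suc d
      t≤d = ℕₚ.≤-trans (ℕₚ.<⇒≤ (n<b^n {4} (s≤s (s≤s z≤n)) t)) 4ᵗ≤d

      c : ℕ
      c = 4 ℕ.^ (suc d ℕ.∸ t)
      B = fromℕ (2 ℕ.^ t)
      C = fromℕ c

      4ᵗ*c≡n : 4 ℕ.^ t ℕ.* c ≡ n
      4ᵗ*c≡n = ≡.trans (≡.sym (ℕₚ.^-distribˡ-+-* 4 t (suc d ℕ.∸ t))) (≡.cong (4 ℕ.^_) (ℕₚ.m+[n∸m]≡n t≤d))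

      m : Vector ℕ (suc d)
      m = spread (4 ℕ.^ t) c

      Σm≡n : jobs m ≡ n
      Σm≡n = ≡.trans (jobs-spread c 4ᵗ≤d) 4ᵗ*c≡n

      mp≤mB : ∀ i → m i ℕ.* 2 ℕ.^ ⌊log₄1+ toℕ i ⌋ ℕ.≤ m i ℕ.* 2 ℕ.^ t
      mp≤mB i with toℕ i <ᵇ 4 ℕ.^ t | ℕₚ.<ᵇ⇒< (toℕ i) (4 ℕ.^ t)
      ... | true  | q = ℕₚ.*-monoʳ-≤ c (ℕₚ.^-monoʳ-≤ 2 (log₄-≤ {t} (q tt)))
      ... | false | _ = z≤n

      m≤c : ∀ i → m i ℕ.≤ c
      m≤c i with toℕ i <ᵇ 4 ℕ.^ t
      ... | true  = ℕₚ.≤-refl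
      ... | false = z≤n

      loads≤ : ∀ i → loads m i ≤ fromℕ (m i) * B
      loads≤ i = ≤-respˡ-≈ (fromℕ-* (m i) _) (≤-respʳ-≈ (fromℕ-* (m i) _) (fromℕ-mono-≤ (mp≤mB i)))

      load≤ : ∀ i → loads m i ≤ C * B
      load≤ i = ≤-trans (loads≤ i) (*-monoʳ-≤ B (fromℕ-nonNegative (2 ℕ.^ t)) (fromℕ-mono-≤ (m≤c i)))

    -- A vector that is approximately optimal for the t-th norm has
    -- coordinates of order n / 2 ^ t and coordinate sum of order n * 2 ^ t.
    -- Few machines are fast, so the total work then contradicts this for
    -- two far apart values of t.
    separation : ∀ {α x} a h → 1# ≤ α → Feasible x → 4 ℕ.^ (a ℕ.+ h ℕ.+ h) ℕ.≤ suc d →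
                 (∀ t → t ≡ a ⊎ t ≡ a ℕ.+ h ℕ.+ h → ‖ x ‖⟨ weight t ⟩ ≤ α * (fromℕ 2 * (fromℕ n * fromℕ (2 ℕ.^ t)))) →
                 fromℕ (2 ℕ.^ h) ≤ fromℕ 8 * α
    separation {α} {x} a h 1≤α (m , Σm , x≈) 4ᵗ≤d bound = *-cancelˡ-≤ (*-pos 0<n (*-pos 0<A 0<H)) (begin
        (N * (A * H)) * H                              ≈⟨ solve 3 (λ N A H → (N :* (A :* H)) :* H := (A :* (H :* H)) :* N) refl N A H ⟩
        (A * (H * H)) * N                              ≈⟨ *-congˡ (trans (reflexive (≡.cong fromℕ (≡.sym Σm))) (fromℕ-sum m)) ⟩
        (A * (H * H)) * sum (fromℕ ∘ m)                ≈⟨ *-distribˡ-sum (A * (H * H)) (fromℕ ∘ m) ⟩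
        sum (λ i → (A * (H * H)) * fromℕ (m i))        ≤⟨ sum-mono-≤ pointwise ⟩
        sum (λ i → (indicator (4 ℕ.^ s) i * Q i) * Z + H * x i) ≈⟨ ∑-distrib-+ (λ i → (indicator (4 ℕ.^ s) i * Q i) * Z) (λ i → H * x i) ⟩
        sum (λ i → (indicator (4 ℕ.^ s) i * Q i) * Z) + sum (λ i → H * x i)
          ≈⟨ +-cong (sym (*-distribʳ-sum Z (λ i → indicator (4 ℕ.^ s) i * Q i))) (sym (*-distribˡ-sum H x)) ⟩
        prefix Q (4 ℕ.^ s) * Z + H * sum x             ≤⟨ +-mono-≤ (*-monoʳ-≤ Z 0≤Z (total-speed s 4ˢ≤d)) (*-monoˡ-≤ H (<⇒≤ 0<H) Σx≤) ⟩
        (fromℕ 3 * fromℕ (2 ℕ.^ s)) * Z + H * (Z * A)  ≈⟨ +-congʳ (*-congʳ (*-congˡ 2ˢ≈A*H)) ⟩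
        (fromℕ 3 * (A * H)) * Z + H * (Z * A)
          ≈⟨ solve 4 (λ A H α N → (con (+ 3) :* (A :* H)) :* (α :* (con (+ 2) :* N)) :+ H :* ((α :* (con (+ 2) :* N)) :* A)
                                  := (N :* (A :* H)) :* (con (+ 8) :* α)) refl A H α N ⟩
        (N * (A * H)) * (fromℕ 8 * α)                  ∎)
      where
      -- The first `4 ^ s` machines count as fast. With `s` midway between the two exponents, the
      -- fast ones contribute at most `6 * α` and the others at most `2 * α` times `N * A * H`,
      -- which explains the 8.
      s = a ℕ.+ h
      N = fromℕ n
      A = fromℕ (2 ℕ.^ a)
      H = fromℕ (2 ℕ.^ h)
      Z = α * (fromℕ 2 * N)
      0<n = fromℕ-pos (ℕₚ.m^n>0 4 (suc d))
      0<A = fromℕ-pos (0<2^ a)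
      0<H = fromℕ-pos (0<2^ h)
      0≤α = ≤-trans (<⇒≤ 0<1) 1≤α
      0≤Z : 0# ≤ Z
      0≤Z = *-nonNegative 0≤α (*-nonNegative (fromℕ-nonNegative 2) (<⇒≤ 0<n))

      2ˢ≈A*H : fromℕ (2 ℕ.^ s) ≈ A * H
      2ˢ≈A*H = trans (reflexive (≡.cong fromℕ (ℕₚ.^-distribˡ-+-* 2 a h))) (fromℕ-* (2 ℕ.^ a) (2 ℕ.^ h))

      2ᵗ≈A*H*H : fromℕ (2 ℕ.^ (a ℕ.+ h ℕ.+ h)) ≈ A * (H * H)
      2ᵗ≈A*H*H = trans (reflexive (≡.cong fromℕ (ℕₚ.^-distribˡ-+-* 2 s h)))
        (trans (fromℕ-* (2 ℕ.^ s) (2 ℕ.^ h)) (trans (*-congʳ 2ˢ≈A*H) (*-assoc A H H)))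

      4ˢ≤d : 4 ℕ.^ s ℕ.≤ suc d
      4ˢ≤d = ℕₚ.≤-trans (ℕₚ.^-monoʳ-≤ 4 (ℕₚ.m≤m+n s h)) 4ᵗ≤d

      0≤x : ∀ i → 0# ≤ x i
      0≤x i = ≤-respʳ-≈ (sym (x≈ i)) (*-nonNegative (fromℕ-nonNegative (m i)) (<⇒≤ (p>0 i)))

      Σ∣x∣≈Σx : sum (λ i → ∣ x i ∣) ≈ sum x
      Σ∣x∣≈Σx = sum-cong-≋ {suc d} λ i → ∣∣-nonNeg (0≤x i)

      Σx≤ : sum x ≤ Z * A
      Σx≤ = begin
        sum x                                                      ≈⟨ Σ∣x∣≈Σx ⟨
        sum (λ i → ∣ x i ∣)                                        ≈⟨ +-identityˡ _ ⟨
        0# + sum (λ i → ∣ x i ∣)                                   ≤⟨ +-monoˡ-≤ _ (*-nonNegative (0≤4^ a) (0≤∣∣ (x zero))) ⟩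
        fromℕ (4 ℕ.^ a) * ∣ x zero ∣ + sum (λ i → ∣ x i ∣)         ≤⟨ norm-lower a x zero ⟩
        ‖ x ‖⟨ weight a ⟩                                          ≤⟨ bound a (inj₁ ≡.refl) ⟩
        α * (fromℕ 2 * (N * A))                                    ≈⟨ solve 4 (λ α t N A → α :* (t :* (N :* A)) := (α :* (t :* N)) :* A) refl α (fromℕ 2) N A ⟩
        Z * A                                                      ∎

      T : Carrier
      T = fromℕ (2 ℕ.^ (a ℕ.+ h ℕ.+ h))

      Tx≤ : ∀ i → T * x i ≤ Z
      Tx≤ i = *-cancelˡ-≤ (fromℕ-pos (0<2^ (a ℕ.+ h ℕ.+ h))) (begin
        T * (T * x i)                                              ≈⟨ *-assoc _ _ _ ⟨
        (T * T) * x i                                              ≈⟨ *-cong (trans (sym (fromℕ-* (2 ℕ.^ (a ℕ.+ h ℕ.+ h)) (2 ℕ.^ (a ℕ.+ h ℕ.+ h)))) (reflexive (≡.cong fromℕ (≡.sym (4^≡2^*2^ (a ℕ.+ h ℕ.+ h)))))) (sym (∣∣-nonNeg (0≤x i))) ⟩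
        fromℕ (4 ℕ.^ (a ℕ.+ h ℕ.+ h)) * ∣ x i ∣                    ≈⟨ +-identityʳ _ ⟨
        fromℕ (4 ℕ.^ (a ℕ.+ h ℕ.+ h)) * ∣ x i ∣ + 0#               ≤⟨ +-monoʳ-≤ _ (sum-nonNegative {suc d} λ i → 0≤∣∣ (x i)) ⟩
        fromℕ (4 ℕ.^ (a ℕ.+ h ℕ.+ h)) * ∣ x i ∣ + sum (λ i → ∣ x i ∣) ≤⟨ norm-lower (a ℕ.+ h ℕ.+ h) x i ⟩
        ‖ x ‖⟨ weight (a ℕ.+ h ℕ.+ h) ⟩                            ≤⟨ bound (a ℕ.+ h ℕ.+ h) (inj₂ ≡.refl) ⟩
        α * (fromℕ 2 * (N * T))                                    ≈⟨ solve 4 (λ α t N T → α :* (t :* (N :* T)) := T :* (α :* (t :* N))) refl α (fromℕ 2) N T ⟩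
        T * Z                                                      ∎)

      m≈Qx : ∀ i → fromℕ (m i) ≈ Q i * x i
      m≈Qx i = begin-equality
        fromℕ (m i)                     ≈⟨ *-identityˡ _ ⟨
        1# * fromℕ (m i)                ≈⟨ *-congʳ (⁻¹-inverseʳ (p i) (pos≉0 (p>0 i))) ⟨
        (p i * Q i) * fromℕ (m i)       ≈⟨ solve 3 (λ p q m → (p :* q) :* m := q :* (m :* p)) refl (p i) (Q i) (fromℕ (m i)) ⟩
        Q i * (fromℕ (m i) * p i)       ≈⟨ *-congˡ (x≈ i) ⟨
        Q i * x i                       ∎

      -- On fast machines the work is bounded through the maximal load, on the others through their
      -- speed of at most `1 / 2 ^ s`.
      pointwise : ∀ i → (A * (H * H)) * fromℕ (m i) ≤ (indicator (4 ℕ.^ s) i * Q i) * Z + H * x i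
      pointwise i = case toℕ i ℕₚ.<? 4 ℕ.^ s of λ where
        (yes i<4ˢ) → begin
          (A * (H * H)) * fromℕ (m i)     ≈⟨ *-cong (sym 2ᵗ≈A*H*H) (m≈Qx i) ⟩
          T * (Q i * x i)                 ≈⟨ solve 3 (λ t q x → t :* (q :* x) := q :* (t :* x)) refl T (Q i) (x i) ⟩
          Q i * (T * x i)                 ≤⟨ *-monoˡ-≤ (Q i) (<⇒≤ (0<Q i)) (Tx≤ i) ⟩
          Q i * Z                         ≈⟨ *-congʳ (trans (*-congʳ (reflexive (indicator-< {i = i} i<4ˢ))) (*-identityˡ _)) ⟨
          (indicator (4 ℕ.^ s) i * Q i) * Z             ≈⟨ +-identityʳ _ ⟨
          (indicator (4 ℕ.^ s) i * Q i) * Z + 0#        ≤⟨ +-monoʳ-≤ _ (*-nonNegative (<⇒≤ 0<H) (0≤x i)) ⟩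
          (indicator (4 ℕ.^ s) i * Q i) * Z + H * x i   ∎
        (no i≮4ˢ) → begin
          (A * (H * H)) * fromℕ (m i)     ≈⟨ *-congˡ (m≈Qx i) ⟩
          (A * (H * H)) * (Q i * x i)     ≈⟨ solve 4 (λ A H q x → (A :* (H :* H)) :* (q :* x) := (q :* (A :* H)) :* (H :* x)) refl A H (Q i) (x i) ⟩
          (Q i * (A * H)) * (H * x i)     ≤⟨ *-monoʳ-≤ _ (*-nonNegative (<⇒≤ 0<H) (0≤x i)) (≤-respˡ-≈ (*-congˡ 2ˢ≈A*H) (Q*2^≤1 s i (ℕₚ.m≤n⇒m≤1+n (ℕₚ.≮⇒≥ i≮4ˢ)))) ⟩
          1# * (H * x i)                  ≈⟨ *-identityˡ _ ⟩
          H * x i                         ≈⟨ +-identityˡ _ ⟨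
          0# + H * x i                    ≤⟨ +-monoˡ-≤ _ (*-nonNegative (*-nonNegative (0≤indicator (4 ℕ.^ s) i) (<⇒≤ (0<Q i))) 0≤Z) ⟩
          (indicator (4 ℕ.^ s) i * Q i) * Z + H * x i   ∎

  -- Makes `ln (ln d)` positive from `d = 3` on. By `ln-gap`, `ln 6 - ln 5 ≥ 1 / 6`, so the
  -- logarithm of `(6 / 5) ^ 6` is at least 1, while `6 ^ 6 = 46656 < 46875 = 3 * 5 ^ 6`. The
  -- exponent 6 is the first that works: `(5 / 4) ^ 5` exceeds 3.
  1<ln3 : 1# < ln (fromℕ 3)
  1<ln3 = ≰⇒> λ ln3≤1 → <-irrefl (begin-strict
    fromℕ 6 * l₆                       ≈⟨ ln-^ {6} 6 z<s ⟨
    ln (fromℕ (6 ℕ.^ 6))               <⟨ ln-6⁶<ln-3*5⁶ ⟩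
    ln (fromℕ (3 ℕ.* 5 ℕ.^ 6))         ≈⟨ ln-cong (fromℕ-pos {3 ℕ.* 5 ℕ.^ 6} z<s) (fromℕ-* 3 (5 ℕ.^ 6)) ⟩
    ln (fromℕ 3 * fromℕ (5 ℕ.^ 6))     ≈⟨ ln-* (fromℕ-pos {3} z<s) (fromℕ-pos {5 ℕ.^ 6} z<s) ⟩
    ln (fromℕ 3) + ln (fromℕ (5 ℕ.^ 6)) ≈⟨ +-congˡ (ln-^ {5} 6 z<s) ⟩
    ln (fromℕ 3) + fromℕ 6 * l₅        ≤⟨ +-monoˡ-≤ _ ln3≤1 ⟩
    1# + fromℕ 6 * l₅                  ≈⟨ +-congʳ 1≈6*[1-5/6] ⟩
    fromℕ 6 * (1# - fromℕ 5 / fromℕ 6) + fromℕ 6 * l₅ ≈⟨ trans (+-comm _ _) (sym (distribˡ _ _ _)) ⟩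
    fromℕ 6 * (l₅ + (1# - fromℕ 5 / fromℕ 6)) ≤⟨ *-monoˡ-≤ _ (fromℕ-nonNegative 6) (ln-gap (fromℕ-pos {5} z<s) (fromℕ-pos {6} z<s)) ⟩
    fromℕ 6 * l₆                       ∎)
    where
    l₅ = ln (fromℕ 5)
    l₆ = ln (fromℕ 6)

    1≈6*[1-5/6] : 1# ≈ fromℕ 6 * (1# - fromℕ 5 / fromℕ 6)
    1≈6*[1-5/6] = begin-equality
      1#                                              ≈⟨ solve 1 (λ o → o := (o :+ con (+ 5)) :- con (+ 5)) refl 1# ⟩
      fromℕ 6 - fromℕ 5                               ≈⟨ +-cong (sym (*-identityʳ (fromℕ 6))) (-‿cong (sym (x*y/x (fromℕ 5) (fromℕ-pos {6} z<s)))) ⟩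
      fromℕ 6 * 1# - fromℕ 6 * (fromℕ 5 / fromℕ 6)    ≈⟨ solve 3 (λ s o q → s :* o :- s :* q := s :* (o :- q)) refl (fromℕ 6) 1# (fromℕ 5 / fromℕ 6) ⟩
      fromℕ 6 * (1# - fromℕ 5 / fromℕ 6)              ∎

    ln-mono-< : ∀ {x y} → 0# < x → x < y → ln x < ln y
    ln-mono-< {x} {y} 0<x x<y = <-≤-trans
      (<-respˡ-≈ (+-identityʳ _) (+-mono-≤-< (≤-refl {ln x}) (<-respˡ-≈ (-‿inverseʳ (x / y))
        (<-respʳ-≈ (+-comm _ _) (<-respˡ-≈ (+-comm _ _) (+-mono-≤-< (≤-refl { - (x / y)}) x/y<1))))))
      (ln-gap 0<x 0<y)
      where
      0<y = <-≤-trans 0<x (<⇒≤ x<y)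
      x/y<1 : x / y < 1#
      x/y<1 = <-respˡ-≈ (*-comm _ _) (<-respʳ-≈ (trans (*-comm _ _) (⁻¹-inverseʳ y (pos≉0 0<y))) (*-monoˡ-< (y ⁻¹) (⁻¹-pos 0<y) x<y))

    ln-6⁶<ln-3*5⁶ : ln (fromℕ (6 ℕ.^ 6)) < ln (fromℕ (3 ℕ.* 5 ℕ.^ 6))
    ln-6⁶<ln-3*5⁶ = ln-mono-< (fromℕ-pos {6 ℕ.^ 6} z<s) (fromℕ-mono-< {6 ℕ.^ 6} {3 ℕ.* 5 ℕ.^ 6} (ℕₚ.<ᵇ⇒< _ _ tt))

  -- The exponents `0`, `2 * h`, ..., `2 * h * length X` are one more than the elements of `X` and
  -- stay below `E` if `h` is the integral part of `E / (2 * length X)`. Two of them share an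
  -- element, and `separation` applies to it. Elements are identified by their position in the list,
  -- so repetitions do no harm.
  few-schedules : ∀ d {α} → 1# ≤ α → ∀ X → IsPortfolio (family (suc d)) IsOrderedNorm α X →
                  ∀ E → 4 ℕ.^ E ℕ.≤ suc d →
                  ∃ λ h → E ℕ.< length X ℕ.* (2 ℕ.* suc h) × fromℕ (2 ℕ.^ h) ≤ fromℕ 8 * α
  few-schedules d {α} 1≤α X portfolio E 4ᴱ≤d = h , E< , separated (Finₚ.pigeonhole (ℕₚ.n<1+n (length X)) choice)
    where
    module I = MLIJ (family (suc d))
    open IsPortfolio portfolio

    norm : ℕ → Point (suc d) → Carrier
    norm t x = ‖ x ‖⟨ weight d t ⟩

    Near : ℕ → Point (suc d) → Set
    Near t x = norm t x ≤ α * (fromℕ 2 * (fromℕ I.n * fromℕ (2 ℕ.^ t)))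

    near-optimal : ∀ t → 4 ℕ.^ t ℕ.≤ suc d → ∃ λ x → x ∈ X × Near t x
    near-optimal t 4ᵗ≤d = combine (approximate (norm t) (weight d t , isWeight d t , λ x → refl)) (optimum-bound d t 4ᵗ≤d)
      where
      combine : (∃₂ λ x y → IsMinimiser (norm t) (_∈ X) x × IsMinimiser (norm t) I.Feasible y × norm t x ≤ α * norm t y) →
                (∃ λ m → I.IsSchedule m × norm t (I.loads m) ≤ fromℕ 2 * (fromℕ I.n * fromℕ (2 ℕ.^ t))) →
                ∃ λ x → x ∈ X × Near t x
      combine (x , y , (x∈X , _) , (_ , y-min) , fx≤αfy) (m , Σm , bound) =
        x , x∈X , ≤-trans fx≤αfy (*-monoˡ-≤ α (≤-trans (<⇒≤ 0<1) 1≤α) (≤-trans (y-min (I.loads m) (m , Σm , λ i → refl)) bound))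

    0<∣X∣ : 0 ℕ.< length X
    0<∣X∣ = nonEmpty (proj₁ (proj₂ (near-optimal 0 (s≤s z≤n))))
      where
      nonEmpty : ∀ {x} {X : List (Point (suc d))} → x ∈ X → 0 ℕ.< length X
      nonEmpty (here _)  = z<s
      nonEmpty (there _) = z<s

    instance
      2∣X∣≢0 : NonZero (length X ℕ.* 2)
      2∣X∣≢0 = ℕ.>-nonZero (ℕₚ.*-mono-≤ 0<∣X∣ (s≤s {n = 1} z≤n))

    h : ℕ
    h = E ℕᵈ./ (length X ℕ.* 2)

    E< : E ℕ.< length X ℕ.* (2 ℕ.* suc h)
    E< = ≡.subst (E ℕ.<_) (≡.trans (ℕₚ.*-comm (suc h) (length X ℕ.* 2)) (ℕₚ.*-assoc (length X) 2 (suc h)))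
      (ℕₚ.≤-<-trans (ℕₚ.≤-reflexive (ℕᵈ.m≡m%n+[m/n]*n E (length X ℕ.* 2))) (ℕₚ.+-monoˡ-< _ (ℕᵈ.m%n<n E (length X ℕ.* 2))))

    exponent : ℕ → ℕ
    exponent j = j ℕ.* (2 ℕ.* h)

    exponent≤ : ∀ {j} → j ℕ.≤ length X → 4 ℕ.^ exponent j ℕ.≤ suc d
    exponent≤ {j} j≤ = ℕₚ.≤-trans (ℕₚ.^-monoʳ-≤ 4 (ℕₚ.≤-trans (ℕₚ.*-monoˡ-≤ (2 ℕ.* h) j≤)
      (ℕₚ.≤-trans (ℕₚ.≤-reflexive (≡.trans (≡.sym (ℕₚ.*-assoc (length X) 2 h)) (ℕₚ.*-comm (length X ℕ.* 2) h))) (ℕᵈ.m/n*n≤m E (length X ℕ.* 2))))) 4ᴱ≤d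

    chosen : (j : Fin (suc (length X))) → ∃ λ x → x ∈ X × Near (exponent (toℕ j)) x
    chosen j = near-optimal (exponent (toℕ j)) (exponent≤ (ℕₚ.≤-pred (Finₚ.toℕ<n j)))

    choice : Fin (suc (length X)) → Fin (length X)
    choice j = Any.index (proj₁ (proj₂ (chosen j)))

    separated : (∃₂ λ i j → i Fin.< j × choice i ≡ choice j) → fromℕ (2 ℕ.^ h) ≤ fromℕ 8 * α
    separated (i , j , i<j , ci≡cj) = ≤-trans
      -- The two exponents differ by `2 * (k * h)` with `k` positive, so `separation` even bounds
      -- `2 ^ (k * h)`.
      (fromℕ-mono-≤ (ℕₚ.^-monoʳ-≤ 2 (ℕₚ.m≤n*m h k {{ℕ.>-nonZero (ℕₚ.m<n⇒0<n∸m i<j)}})))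
      (apply (proj₁ (chosen i)) (proj₁ (chosen j)) same
        (proj₁ (proj₂ (chosen i))) (proj₂ (proj₂ (chosen i))) (proj₂ (proj₂ (chosen j))))
      where
      k : ℕ
      k = toℕ j ℕ.∸ toℕ i

      same : proj₁ (chosen i) ≡ proj₁ (chosen j)
      same = ≡.trans (Anyₚ.lookup-index (proj₁ (proj₂ (chosen i))))
        (≡.trans (≡.cong (List.lookup X) ci≡cj) (≡.sym (Anyₚ.lookup-index (proj₁ (proj₂ (chosen j))))))

      e≡ : exponent (toℕ j) ≡ exponent (toℕ i) ℕ.+ k ℕ.* h ℕ.+ k ℕ.* h
      e≡ = ≡.trans (≡.cong exponent (≡.sym (ℕₚ.m+[n∸m]≡n (ℕₚ.<⇒≤ i<j))))
        (NS.solve 3 (λ i k h → (i NS.:+ k) NS.:* (NS.con 2 NS.:* h) NS.:= (i NS.:* (NS.con 2 NS.:* h) NS.:+ k NS.:* h) NS.:+ k NS.:* h) ≡.refl (toℕ i) k h)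
        where module NS = Data.Nat.Solver.+-*-Solver

      apply : ∀ x y → x ≡ y → x ∈ X → Near (exponent (toℕ i)) x → Near (exponent (toℕ j)) y → fromℕ (2 ℕ.^ (k ℕ.* h)) ≤ fromℕ 8 * α
      apply x .x ≡.refl x∈X nearᵢ nearⱼ = separation d {x = x} (exponent (toℕ i)) (k ℕ.* h) 1≤α (All.lookup feasible x∈X)
        (≡.subst (λ t → 4 ℕ.^ t ℕ.≤ suc d) e≡ (exponent≤ {toℕ j} (ℕₚ.≤-pred (Finₚ.toℕ<n j)))) near
        where
        near : ∀ t → t ≡ exponent (toℕ i) ⊎ t ≡ exponent (toℕ i) ℕ.+ k ℕ.* h ℕ.+ k ℕ.* h → Near t x
        near t (inj₁ t≡) = ≡.subst (λ t → Near t x) (≡.sym t≡) nearᵢ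
        near t (inj₂ t≡) = ≡.subst (λ t → Near t x) (≡.trans e≡ (≡.sym t≡)) nearⱼ

  -- Write λ for `ln (ln 3)` and `D` for `ln α + ln (ln d)`. Both λ and `ln α` are at most `D`, so
  -- `λ * (ln 16 + ln α) ≤ (λ + ln 16) * D`; this absorbs the additive constant of `counting-bound`
  -- into the denominator.
  constant : Carrier
  constant = ln (ln (fromℕ 3)) / (fromℕ 4 * (ln (ln (fromℕ 3)) + ln (fromℕ 16)))

  private
    λ₃ : Carrier
    λ₃ = ln (ln (fromℕ 3))

    0<λ₃ : 0# < λ₃
    0<λ₃ = ln-pos 1<ln3

    0<denominator : 0# < fromℕ 4 * (λ₃ + ln (fromℕ 16))
    0<denominator = *-pos (fromℕ-pos {4} z<s) (<-≤-trans 0<λ₃ (≤-respˡ-≈ (+-identityʳ _) (+-monoʳ-≤ λ₃ 0≤ln16)))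
      where
      0≤ln16 : 0# ≤ ln (fromℕ 16)
      0≤ln16 = ln-nonNegative (≤-respˡ-≈ (+-identityʳ 1#) (fromℕ-mono-≤ {1} {16} (s≤s z≤n)))

  0<constant : 0# < constant
  0<constant = *-pos 0<λ₃ (⁻¹-pos 0<denominator)

  -- `ln d ≤ 2 * (E + 1) * ln 2 ≤ 4 * N * (h + 1) * ln 2`, and `2 ^ (h + 1) ≤ 16 * α` bounds `(h +
  -- 1) * ln 2` by `ln 16 + ln α`.
  counting-bound : ∀ {d N E h α} → 3 ℕ.≤ d → 1# ≤ α → d ℕ.< 4 ℕ.^ suc E → E ℕ.< N ℕ.* (2 ℕ.* suc h) → fromℕ (2 ℕ.^ h) ≤ fromℕ 8 * α →
                   constant * (ln (fromℕ d) / (ln α + ln (ln (fromℕ d)))) ≤ fromℕ N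
  counting-bound {d} {∣X∣} {E} {h} {α} 3≤d 1≤α d<4ᴱ⁺¹ E< 2ʰ≤8α = *-cancelˡ-≤ 0<denominator (begin
      den * (constant * (l / D))      ≈⟨ solve 5 (λ e λ₃ i l j → e :* ((λ₃ :* i) :* (l :* j)) := (e :* i) :* (λ₃ :* (l :* j))) refl den λ₃ (den ⁻¹) l (D ⁻¹) ⟩
      (den * den ⁻¹) * (λ₃ * (l / D)) ≈⟨ trans (*-congʳ (⁻¹-inverseʳ den (pos≉0 0<denominator))) (*-identityˡ _) ⟩
      λ₃ * (l / D)                    ≤⟨ *-cancelˡ-≤ 0<D (begin
        D * (λ₃ * (l / D))              ≈⟨ solve 3 (λ D λ₃ q → D :* (λ₃ :* q) := λ₃ :* (D :* q)) refl D λ₃ (l / D) ⟩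
        λ₃ * (D * (l / D))              ≈⟨ *-congˡ (x*y/x l 0<D) ⟩
        λ₃ * l                          ≤⟨ *-monoˡ-≤ λ₃ (<⇒≤ 0<λ₃) l≤ ⟩
        λ₃ * ((fromℕ 4 * N) * (l₁₆ + ln α)) ≈⟨ solve 5 (λ λ₃ f N l a → λ₃ :* ((f :* N) :* (l :+ a)) := (f :* N) :* (l :* λ₃ :+ λ₃ :* a)) refl λ₃ (fromℕ 4) N l₁₆ (ln α) ⟩
        (fromℕ 4 * N) * (l₁₆ * λ₃ + λ₃ * ln α) ≤⟨ *-monoˡ-≤ _ (*-nonNegative (fromℕ-nonNegative 4) (fromℕ-nonNegative ∣X∣))
              (+-mono-≤ (*-monoˡ-≤ l₁₆ 0≤l₁₆ λ₃≤D) (*-monoˡ-≤ λ₃ (<⇒≤ 0<λ₃) lnα≤D)) ⟩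
        (fromℕ 4 * N) * (l₁₆ * D + λ₃ * D) ≈⟨ solve 5 (λ f N l λ₃ D → (f :* N) :* (l :* D :+ λ₃ :* D) := D :* ((f :* (λ₃ :+ l)) :* N)) refl (fromℕ 4) N l₁₆ λ₃ D ⟩
        D * (den * N)                   ∎) ⟩
      den * N                         ∎)
      where
      N = fromℕ (∣X∣)
      l = ln (fromℕ d)
      ll = ln l
      D = ln α + ll
      l₁₆ = ln (fromℕ 16)
      den = fromℕ 4 * (λ₃ + l₁₆)

      0≤l₁₆ : 0# ≤ l₁₆
      0≤l₁₆ = ln-nonNegative (≤-respˡ-≈ (+-identityʳ 1#) (fromℕ-mono-≤ {1} {16} (s≤s z≤n)))

      0≤lnα : 0# ≤ ln α
      0≤lnα = ln-nonNegative 1≤α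

      0<α = <-≤-trans 0<1 1≤α

      λ₃≤ll : λ₃ ≤ ll
      λ₃≤ll = ln-mono-≤ (<-≤-trans 0<1 (<⇒≤ 1<ln3)) (ln-mono-≤ (fromℕ-pos {3} z<s) (fromℕ-mono-≤ 3≤d))

      λ₃≤D : λ₃ ≤ D
      λ₃≤D = ≤-respˡ-≈ (+-identityˡ _) (+-mono-≤ 0≤lnα λ₃≤ll)

      lnα≤D : ln α ≤ D
      lnα≤D = ≤-respˡ-≈ (+-identityʳ _) (+-monoʳ-≤ (ln α) (≤-trans (<⇒≤ 0<λ₃) λ₃≤ll))

      0<D : 0# < D
      0<D = <-≤-trans 0<λ₃ λ₃≤D

      l₂ = ln (fromℕ 2)
      0≤l₂ : 0# ≤ l₂
      0≤l₂ = ln-nonNegative (≤-respˡ-≈ (+-identityʳ 1#) (fromℕ-mono-≤ {1} {2} (s≤s z≤n)))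

      [1+h]*l₂≤ : fromℕ (suc h) * l₂ ≤ l₁₆ + ln α
      [1+h]*l₂≤ = begin
        fromℕ (suc h) * l₂           ≈⟨ ln-^ {2} (suc h) z<s ⟨
        ln (fromℕ (2 ℕ.^ suc h))     ≤⟨ ln-mono-≤ (fromℕ-pos (ℕₚ.m^n>0 2 (suc h))) (begin
          fromℕ (2 ℕ.* 2 ℕ.^ h)        ≈⟨ fromℕ-* 2 (2 ℕ.^ h) ⟩
          fromℕ 2 * fromℕ (2 ℕ.^ h)    ≤⟨ *-monoˡ-≤ _ (fromℕ-nonNegative 2) 2ʰ≤8α ⟩
          fromℕ 2 * (fromℕ 8 * α)      ≈⟨ solve 1 (λ α → con (+ 2) :* (con (+ 8) :* α) := con (+ 16) :* α) refl α ⟩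
          fromℕ 16 * α                 ∎) ⟩
        ln (fromℕ 16 * α)            ≈⟨ ln-* (fromℕ-pos {16} z<s) 0<α ⟩
        l₁₆ + ln α                   ∎

      exponent≤ : 2 ℕ.* suc E ℕ.≤ 4 ℕ.* ∣X∣ ℕ.* suc h
      exponent≤ = ℕₚ.≤-trans (ℕₚ.*-monoʳ-≤ 2 E<)
        (ℕₚ.≤-reflexive (NS.solve 2 (λ N h → NS.con 2 NS.:* (N NS.:* (NS.con 2 NS.:* h)) NS.:= NS.con 4 NS.:* N NS.:* h) ≡.refl (∣X∣) (suc h)))
        where module NS = Data.Nat.Solver.+-*-Solver

      l≤ : l ≤ (fromℕ 4 * N) * (l₁₆ + ln α)
      l≤ = begin
        l                                          ≤⟨ ln-mono-≤ (fromℕ-pos (ℕₚ.<-≤-trans z<s 3≤d)) (fromℕ-mono-≤ (ℕₚ.<⇒≤ d<4ᴱ⁺¹)) ⟩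
        ln (fromℕ (4 ℕ.^ suc E))                   ≡⟨ ≡.cong (ln ∘ fromℕ) (ℕₚ.^-*-assoc 2 2 (suc E)) ⟩
        ln (fromℕ (2 ℕ.^ (2 ℕ.* suc E)))           ≈⟨ ln-^ {2} (2 ℕ.* suc E) z<s ⟩
        fromℕ (2 ℕ.* suc E) * l₂                   ≤⟨ *-monoʳ-≤ l₂ 0≤l₂ (fromℕ-mono-≤ exponent≤) ⟩
        fromℕ (4 ℕ.* ∣X∣ ℕ.* suc h) * l₂      ≈⟨ *-congʳ (trans (fromℕ-* (4 ℕ.* ∣X∣) (suc h)) (*-congʳ (fromℕ-* 4 (∣X∣)))) ⟩
        ((fromℕ 4 * N) * fromℕ (suc h)) * l₂       ≈⟨ *-assoc _ _ _ ⟩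
        (fromℕ 4 * N) * (fromℕ (suc h) * l₂)       ≤⟨ *-monoˡ-≤ _ (*-nonNegative (fromℕ-nonNegative 4) (fromℕ-nonNegative ∣X∣)) [1+h]*l₂≤ ⟩
        (fromℕ 4 * N) * (l₁₆ + ln α)               ∎

  lowerBound : ∀ d → 3 ℕ.≤ d → ∀ α → 1# ≤ α → ∀ X → IsPortfolio (family d) IsOrderedNorm α X →
               constant * (ln (fromℕ d) / (ln α + ln (ln (fromℕ d)))) ≤ fromℕ (length X)
  lowerBound (suc d) 3≤d α 1≤α X portfolio =
    let E , _ , 4ᴱ≤d , d<4ᴱ⁺¹ = power-bracket 4 (suc d) {suc d} (s≤s z≤n) (n<b^n (s≤s (s≤s z≤n)) (suc d))
        h , E< , 2ʰ≤8α = few-schedules d 1≤α X portfolio E 4ᴱ≤d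
    in counting-bound {N = length X} {h = h} 3≤d 1≤α d<4ᴱ⁺¹ E< 2ʰ≤8α

-- Programs with counted loops and their cost.

module CountedPrograms where
  open Machine

  infixr 3 _then_

  -- Every loop runs exactly `d` times, so termination and a polynomial bound on the cost follow
  -- from the syntax alone.
  data Program : Set where
    assign : ℕ → Expr → Expr → Program
    _then_ : Program → Program → Program
    when   : Expr → Program → Program
    for    : ℕ → Program → Program

  guard : ℕ → Expr
  guard v = 0 [ lit 1 ] ⊖ v [ lit 0 ]

  increment : ℕ → Expr
  increment v = v [ lit 0 ] ⊕ lit 1

  -- for v c runs c with array v counting from 0 up to the second input number.
  compile : Program → Cmd
  compile (assign a e f) = a [ e ]≔ f
  compile (c then c′)    = compile c ⍮ compile c′
  compile (when e c)     = If e Then compile c Else skip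
  compile (for v c)      = (v [ lit 0 ]≔ lit 0) ⍮ (While guard v Do (compile c ⍮ (v [ lit 0 ]≔ increment v)))

  -- Syntactic, so that for concrete programs the side conditions of the frame rule hold by
  -- computation.
  writes : Cmd → ℕ → Bool
  writes skip                   b = false
  writes (a [ e ]≔ f)           b = b ≡ᵇ a
  writes (c ⍮ c′)               b = writes c b ∨ writes c′ b
  writes (If e Then c Else c′)  b = writes c b ∨ writes c′ b
  writes (While e Do c)         b = writes c b

  ∨-false : ∀ {x y} → x ∨ y ≡ false → x ≡ false × y ≡ false
  ∨-false {false} y≡false = ≡.refl , y≡false

  Frame : Program → Store → Store → Set
  Frame c s s′ = ∀ b → writes (compile c) b ≡ false → ∀ i → s′ b i ≡ s b i

  run-frame : ∀ {c s t s′} → Run c s t s′ → ∀ b → writes c b ≡ false → ∀ i → s′ b i ≡ s b i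
  run-frame skip            b w i = ≡.refl
  run-frame assign          b w i rewrite w = ≡.refl
  run-frame (seq r r′)      b w i = let w₁ , w₂ = ∨-false w in ≡.trans (run-frame r′ b w₂ i) (run-frame r b w₁ i)
  run-frame (if≢0 {c = c} _ r) b w i = run-frame r b (proj₁ (∨-false {writes c b} w)) i
  run-frame (if≡0 {c = c} _ r) b w i = run-frame r b (proj₂ (∨-false {writes c b} w)) i
  run-frame (while≢0 _ r r′) b w i = ≡.trans (run-frame r′ b w i) (run-frame r b w i)
  run-frame (while≡0 _)     b w i = ≡.refl

  ≡ᵇ-refl : ∀ k → (k ≡ᵇ k) ≡ true
  ≡ᵇ-refl zero    = ≡.refl
  ≡ᵇ-refl (suc k) = ≡ᵇ-refl k

  update-hit : ∀ s a i v j → j ≡ i → update s a i v a j ≡ v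
  update-hit s a i v .i ≡.refl rewrite ≡ᵇ-refl a | ≡ᵇ-refl i = ≡.refl

  update-miss : ∀ s a i v j → j ≢ i → update s a i v a j ≡ s a j
  update-miss s a i v j j≢i with (a ≡ᵇ a) | j ≡ᵇ i | ℕₚ.≡ᵇ⇒≡ j i
  ... | true  | false | _ = ≡.refl
  ... | false | _     | _ = ≡.refl
  ... | true  | true  | q = contradiction (q tt) j≢i

  update-other : ∀ s a i v b j → (b ≡ᵇ a) ≡ false → update s a i v b j ≡ s b j
  update-other s a i v b j b≢a rewrite b≢a = ≡.refl

  -- If `N ≥ 2` bounds all cells, then `N ^ degree e` bounds the value of `e`; for literals this is
  -- `n < N ^ n`. Correspondingly, `size` bounds the cost in units of the bit length of `N`.
  degree : Expr → ℕ
  degree (lit n)   = n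
  degree (a [ e ]) = 1
  degree (e ⊕ f)   = suc (degree e ℕ.+ degree f)
  degree (e ⊖ f)   = degree e
  degree (e ⊗ f)   = degree e ℕ.+ degree f
  degree (e ⊘ f)   = degree e

  size : Expr → ℕ
  size₂ : Expr → Expr → ℕ

  size (lit n)   = 2 ℕ.+ n
  size (a [ e ]) = 4 ℕ.+ size e ℕ.+ degree e
  size (e ⊕ f)   = size₂ e f
  size (e ⊖ f)   = size₂ e f
  size (e ⊗ f)   = size₂ e f
  size (e ⊘ f)   = size₂ e f

  size₂ e f = 1 ℕ.+ (size e ℕ.+ size f ℕ.+ suc (degree e) ℕ.+ suc (degree f))

  -- Chosen such that the cost is at most `weight c * suc β * suc d ^ depth c`. For compositions the
  -- depths are added, which keeps the estimates simple and is still a constant of the program.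
  weight : Program → ℕ
  weight (assign a e f) = size₂ e f
  weight (c then c′)    = suc (weight c ℕ.+ weight c′)
  weight (when e c)     = 2 ℕ.+ size e ℕ.+ weight c
  weight (for v c)      = 2 ℕ.+ size₂ (lit 0) (lit 0) ℕ.+ size (guard v) ℕ.+ (2 ℕ.+ size (guard v) ℕ.+ weight c ℕ.+ size₂ (lit 0) (increment v))

  depth : Program → ℕ
  depth (assign a e f) = 0
  depth (c then c′)    = depth c ℕ.+ depth c′
  depth (when e c)     = depth c
  depth (for v c)      = suc (depth c)

  bits-bound : ∀ {v} β → v ℕ.≤ 2 ℕ.^ β → bits v ℕ.≤ suc β
  bits-bound β v≤ = s≤s (ℕₚ.≤-trans (⌊log₂⌋-mono-≤ v≤) (ℕₚ.≤-reflexive (⌊log₂[2^n]⌋≡n β)))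

  quotient≤ : ∀ m n → quotient m n ℕ.≤ m
  quotient≤ m zero    = z≤n
  quotient≤ m (suc n) = ℕᵈ.m/n≤m m (suc n)

  -- All contents are at most 2 ^ β, and d is the number of loop iterations.
  module Execution (β : ℕ) (0<β : 0 ℕ.< β) (d : ℕ) (d≤2^β : d ℕ.≤ 2 ℕ.^ β) where
    private
      N : ℕ
      N = 2 ℕ.^ β

      B : ℕ
      B = suc β

      2≤N : 2 ℕ.≤ N
      2≤N = ℕₚ.^-monoʳ-≤ 2 0<β

      instance
        N≢0 : NonZero N
        N≢0 = ℕ.>-nonZero (ℕₚ.m^n>0 2 β)

    Bounded : Store → Set
    Bounded s = ∀ a i → s a i ℕ.≤ N

    private
      eval-bound : ∀ e {s} → Bounded s → eval e s ℕ.≤ N ℕ.^ degree e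
      eval-bound (lit n)   bs = ℕₚ.<⇒≤ (n<b^n 2≤N n)
      eval-bound (a [ e ]) bs = ℕₚ.≤-trans (bs _ _) (ℕₚ.≤-reflexive (≡.sym (ℕₚ.*-identityʳ N)))
      eval-bound (e ⊖ f) {s} bs = ℕₚ.≤-trans (ℕₚ.m∸n≤m (eval e s) (eval f s)) (eval-bound e bs)
      eval-bound (e ⊘ f) {s} bs = ℕₚ.≤-trans (quotient≤ (eval e s) (eval f s)) (eval-bound e bs)
      eval-bound (e ⊗ f)   bs = ℕₚ.≤-trans (ℕₚ.*-mono-≤ (eval-bound e bs) (eval-bound f bs))
        (ℕₚ.≤-reflexive (≡.sym (ℕₚ.^-distribˡ-+-* N (degree e) (degree f))))
      eval-bound (e ⊕ f)   bs = ℕₚ.≤-trans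
        (ℕₚ.+-mono-≤ (ℕₚ.≤-trans (eval-bound e bs) (ℕₚ.^-monoʳ-≤ N (ℕₚ.m≤m+n (degree e) (degree f))))
                     (ℕₚ.≤-trans (eval-bound f bs) (ℕₚ.^-monoʳ-≤ N (ℕₚ.m≤n+m (degree f) (degree e)))))
        (ℕₚ.≤-trans (ℕₚ.≤-reflexive (≡.cong (N ℕ.^ (degree e ℕ.+ degree f) ℕ.+_) (≡.sym (ℕₚ.+-identityʳ _))))
          (ℕₚ.*-monoˡ-≤ (N ℕ.^ (degree e ℕ.+ degree f)) 2≤N))

      bits-≤ : ∀ {v g} → v ℕ.≤ N ℕ.^ g → bits v ℕ.≤ suc g ℕ.* B
      bits-≤ {v} {g} v≤ = ℕₚ.≤-trans
        (bits-bound (β ℕ.* g) (ℕₚ.≤-trans v≤ (ℕₚ.≤-reflexive (ℕₚ.^-*-assoc 2 β g))))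
        (s≤s (ℕₚ.≤-trans (ℕₚ.≤-reflexive (ℕₚ.*-comm β g)) (ℕₚ.≤-trans (ℕₚ.*-monoʳ-≤ g (ℕₚ.n≤1+n β)) (ℕₚ.m≤n+m (g ℕ.* B) β))))

      eval-bits : ∀ e {s} → Bounded s → bits (eval e s) ℕ.≤ suc (degree e) ℕ.* B
      eval-bits e bs = bits-≤ {g = degree e} (eval-bound e bs)

      cell-bits : ∀ {s} a i → Bounded s → bits (s a i) ℕ.≤ 2 ℕ.* B
      cell-bits a i bs = bits-≤ {g = 1} (ℕₚ.≤-trans (bs a i) (ℕₚ.≤-reflexive (≡.sym (ℕₚ.*-identityʳ N))))

      1≤B : 1 ℕ.≤ B
      1≤B = s≤s z≤n

      combine₂ : ∀ {x y u v} p q r t → x ℕ.≤ p ℕ.* B → y ℕ.≤ q ℕ.* B → u ℕ.≤ r ℕ.* B → v ℕ.≤ t ℕ.* B →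
                 suc (x ℕ.+ y ℕ.+ u ℕ.+ v) ℕ.≤ (1 ℕ.+ (p ℕ.+ q ℕ.+ r ℕ.+ t)) ℕ.* B
      combine₂ p q r t x≤ y≤ u≤ v≤ = ℕₚ.≤-trans
        (ℕₚ.+-mono-≤ 1≤B (ℕₚ.+-mono-≤ (ℕₚ.+-mono-≤ (ℕₚ.+-mono-≤ x≤ y≤) u≤) v≤))
        (ℕₚ.≤-reflexive (solve 5 (λ p q r t B → B :+ (p :* B :+ q :* B :+ r :* B :+ t :* B) := (con 1 :+ (p :+ q :+ r :+ t)) :* B) ≡.refl p q r t B))
        where open Data.Nat.Solver.+-*-Solver

      cost-bound : ∀ e {s} → Bounded s → cost e s ℕ.≤ size e ℕ.* B
      cost₂-bound : ∀ e f {s} → Bounded s → binaryCost e f s ℕ.≤ size₂ e f ℕ.* B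

      cost-bound (lit n) bs = ℕₚ.≤-trans (ℕₚ.+-mono-≤ 1≤B (eval-bits (lit n) bs)) ℕₚ.≤-refl
      cost-bound (a [ e ]) {s} bs = ℕₚ.≤-trans
        (ℕₚ.+-mono-≤ 1≤B (ℕₚ.+-mono-≤ (ℕₚ.+-mono-≤ (cost-bound e bs) (eval-bits e bs)) (cell-bits a (eval e s) bs)))
        (ℕₚ.≤-reflexive (solve 3 (λ p g B → B :+ (p :* B :+ (con 1 :+ g) :* B :+ con 2 :* B) := (con 4 :+ p :+ g) :* B) ≡.refl (size e) (degree e) B))
        where open Data.Nat.Solver.+-*-Solver
      cost-bound (e ⊕ f) bs = cost₂-bound e f bs
      cost-bound (e ⊖ f) bs = cost₂-bound e f bs
      cost-bound (e ⊗ f) bs = cost₂-bound e f bs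
      cost-bound (e ⊘ f) bs = cost₂-bound e f bs

      cost₂-bound e f bs = combine₂ (size e) (size f) (suc (degree e)) (suc (degree f)) (cost-bound e bs) (cost-bound f bs) (eval-bits e bs) (eval-bits f bs)

      E : ℕ
      E = suc d

    time : Program → ℕ
    time c = weight c ℕ.* B ℕ.* E ℕ.^ depth c

    -- A total-correctness triple with cost. Boundedness is part of it because the cost of an
    -- operation depends on the lengths of its operands, so it must survive every assignment.
    record Exec (c : Program) (s : Store) (Q : Store → Set) : Set where
      constructor exec
      field
        {steps}   : ℕ
        {final}   : Store
        run       : Run (compile c) s steps final
        steps≤    : steps ℕ.≤ time c
        bounded   : Bounded final
        satisfies : Q final

    exec-assign : ∀ {a} e f {s} {Q : Store → Set} → Bounded s → eval f s ℕ.≤ N → Q (update s a (eval e s) (eval f s)) → Exec (assign a e f) s Q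
    exec-assign {a} e f {s} bs f≤N q = exec assign (ℕₚ.≤-trans (cost₂-bound e f bs) (ℕₚ.≤-reflexive (≡.sym (ℕₚ.*-identityʳ _)))) bounded q
      where
      bounded : Bounded (update s a (eval e s) (eval f s))
      bounded b j with (b ≡ᵇ a) ∧ (j ≡ᵇ eval e s)
      ... | true  = f≤N
      ... | false = bs b j

    private
      time-mono : ∀ {w w′ k k′} → w ℕ.≤ w′ → k ℕ.≤ k′ → w ℕ.* B ℕ.* E ℕ.^ k ℕ.≤ w′ ℕ.* B ℕ.* E ℕ.^ k′
      time-mono w≤w′ k≤k′ = ℕₚ.*-mono-≤ (ℕₚ.*-monoˡ-≤ B w≤w′) (ℕₚ.^-monoʳ-≤ E k≤k′)

      unit-time : ∀ w {k} → w ℕ.* B ℕ.≤ w ℕ.* B ℕ.* E ℕ.^ k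
      unit-time w {k} = ℕₚ.m≤m*n (w ℕ.* B) (E ℕ.^ k) {{ℕ.>-nonZero (ℕₚ.m^n>0 E k)}}

      1≤time : ∀ {k} → 1 ℕ.≤ 1 ℕ.* B ℕ.* E ℕ.^ k
      1≤time {k} = ℕₚ.≤-trans (s≤s z≤n) (unit-time 1 {k})

      +-time : ∀ w w′ {k} → w ℕ.* B ℕ.* E ℕ.^ k ℕ.+ w′ ℕ.* B ℕ.* E ℕ.^ k ≡ (w ℕ.+ w′) ℕ.* B ℕ.* E ℕ.^ k
      +-time w w′ {k} = solve 4 (λ w w′ B X → w :* B :* X :+ w′ :* B :* X := (w :+ w′) :* B :* X) ≡.refl w w′ B (E ℕ.^ k)
        where open Data.Nat.Solver.+-*-Solver

    exec-then : ∀ {c c′ s} {P Q : Store → Set} → Exec c s P → (∀ s′ → Bounded s′ → Frame c s s′ → P s′ → Exec c′ s′ Q) → Exec (c then c′) s Q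
    exec-then {c} {c′} (exec r t≤ bs′ p) k with exec r′ t′≤ bs″ q ← k _ bs′ (run-frame r) p =
      exec (seq r r′)
      (ℕₚ.≤-trans (ℕₚ.+-mono-≤ (1≤time {δ}) (ℕₚ.+-mono-≤
          (ℕₚ.≤-trans t≤ (time-mono {weight c} ℕₚ.≤-refl (ℕₚ.m≤m+n (depth c) (depth c′))))
          (ℕₚ.≤-trans t′≤ (time-mono {weight c′} ℕₚ.≤-refl (ℕₚ.m≤n+m (depth c′) (depth c))))))
        (ℕₚ.≤-reflexive (≡.trans (≡.cong (1 ℕ.* B ℕ.* E ℕ.^ δ ℕ.+_) (+-time (weight c) (weight c′) {δ})) (+-time 1 (weight c ℕ.+ weight c′) {δ}))))
      bs″ q
      where
      δ : ℕ
      δ = depth c ℕ.+ depth c′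

    exec-when : ∀ e {c s} {Q : Store → Set} → Bounded s → (eval e s ≢ 0 → Exec c s Q) → (eval e s ≡ 0 → Q s) → Exec (when e c) s Q
    exec-when e {c} {s} bs yes-case no-case with eval e s ℕₚ.≟ 0
    ... | yes e≡0 = exec (if≡0 e≡0 skip)
      (ℕₚ.≤-trans (ℕₚ.≤-trans (ℕₚ.≤-reflexive (≡.cong suc (ℕₚ.+-comm (cost e s) 1)))
        (ℕₚ.+-mono-≤ (ℕₚ.+-mono-≤ 1≤B (ℕₚ.≤-trans 1≤B (ℕₚ.m≤m+n B 0))) (cost-bound e bs)))
      (ℕₚ.≤-trans (ℕₚ.≤-reflexive (solve 2 (λ B p → (B :+ (B :+ con 0)) :+ p :* B := (con 2 :+ p) :* B) ≡.refl B (size e)))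
        (ℕₚ.≤-trans (unit-time (2 ℕ.+ size e) {depth c}) (time-mono {2 ℕ.+ size e} {k = depth c} (ℕₚ.m≤m+n _ (weight c)) ℕₚ.≤-refl))))
      bs (no-case e≡0)
      where open Data.Nat.Solver.+-*-Solver
    ... | no e≢0 with exec r t≤ bs′ q ← yes-case e≢0 = exec (if≢0 e≢0 r)
      (ℕₚ.≤-trans (ℕₚ.+-mono-≤ (1≤time {δ}) (ℕₚ.+-mono-≤ (ℕₚ.≤-trans (cost-bound e bs) (unit-time (size e) {δ})) t≤))
        (ℕₚ.≤-trans (ℕₚ.≤-reflexive (≡.trans (≡.cong (1 ℕ.* B ℕ.* E ℕ.^ δ ℕ.+_) (+-time (size e) (weight c) {δ})) (+-time 1 (size e ℕ.+ weight c) {δ})))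
          (time-mono {1 ℕ.+ (size e ℕ.+ weight c)} {k = δ} (ℕₚ.n≤1+n _) ℕₚ.≤-refl)))
      bs′ q
      where
      δ : ℕ
      δ = depth c

    -- The loop rule. The body must leave alone array 0, which holds the bound `d`, and the counter.
    -- Its postcondition is the invariant after the counter has been increased.
    exec-for : ∀ v c {s} (Inv : ℕ → Store → Set) → (0 ≡ᵇ v) ≡ false → writes (compile c) 0 ≡ false → writes (compile c) v ≡ false →
               Bounded s → s 0 1 ≡ d → Inv 0 (update s v 0 0) →
               (∀ m s′ → m ℕ.< d → Bounded s′ → Frame (for v c) s s′ → s′ v 0 ≡ m → Inv m s′ →
                 Exec c s′ λ s″ → Inv (suc m) (update s″ v 0 (suc m))) →
               Exec (for v c) s (Inv d)
    exec-for v c {s} Inv v≢0 c-keeps-0 c-keeps-v bs s≡d start step = conclude (loop d 0 (update s v 0 0) (ℕₚ.+-identityʳ d) bounded₀ frame₀ (update-hit s v 0 0 0 ≡.refl) start)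
      where
      frame₀ : Frame (for v c) s (update s v 0 0)
      frame₀ b w i = update-other s v 0 0 b i (proj₁ (∨-false w))

      bounded₀ : Bounded (update s v 0 0)
      bounded₀ b j with (b ≡ᵇ v) ∧ (j ≡ᵇ 0)
      ... | true  = z≤n
      ... | false = bs b j

      keeps-0 : writes (compile (for v c)) 0 ≡ false
      keeps-0 rewrite v≢0 | c-keeps-0 = ≡.refl

      G = size (guard v)
      T = time c
      K = size₂ (lit 0) (increment v)
      iteration = (2 ℕ.+ G) ℕ.* B ℕ.+ T ℕ.+ K ℕ.* B

      body : Cmd
      body = compile c ⍮ (v [ lit 0 ]≔ increment v)

      loop : ∀ k m s₁ → k ℕ.+ m ≡ d → Bounded s₁ → Frame (for v c) s s₁ → s₁ v 0 ≡ m → Inv m s₁ →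
             ∃₂ λ t s′ → Run (While guard v Do body) s₁ t s′ × t ℕ.≤ suc G ℕ.* B ℕ.+ k ℕ.* iteration × Bounded s′ × Inv d s′
      loop zero m s₁ ≡.refl bs₁ frame₁ v≡m inv = _ , s₁ , while≡0 guard≡0 ,
        ℕₚ.≤-trans (ℕₚ.+-mono-≤ 1≤B (cost-bound (guard v) bs₁)) (ℕₚ.m≤m+n _ 0) , bs₁ , inv
        where
        guard≡0 : s₁ 0 1 ℕ.∸ s₁ v 0 ≡ 0
        guard≡0 = ≡.trans (≡.cong₂ ℕ._∸_ (≡.trans (frame₁ 0 keeps-0 1) s≡d) v≡m) (ℕₚ.n∸n≡0 m)
      loop (suc k) m s₁ 1+k+m≡d bs₁ frame₁ v≡m inv
        with exec {_} {s₂} r₂ t₂≤ bs₂ inv₂ ← step m s₁ (ℕₚ.≤-trans (s≤s (ℕₚ.m≤n+m m k)) (ℕₚ.≤-reflexive 1+k+m≡d)) bs₁ frame₁ v≡m inv =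
        continue (loop k (suc m) s₃ (≡.trans (ℕₚ.+-suc k m) 1+k+m≡d) bs₃ frame₃ s₃v≡ inv₃)
        where
        new≡ : s₂ v 0 ℕ.+ 1 ≡ suc m
        new≡ = ≡.trans (ℕₚ.+-comm (s₂ v 0) 1) (≡.cong suc (≡.trans (run-frame r₂ v c-keeps-v 0) v≡m))

        s₃ : Store
        s₃ = update s₂ v 0 (s₂ v 0 ℕ.+ 1)

        s₃v≡ : s₃ v 0 ≡ suc m
        s₃v≡ = ≡.trans (update-hit s₂ v 0 _ 0 ≡.refl) new≡

        inv₃ : Inv (suc m) s₃
        inv₃ = ≡.subst (λ x → Inv (suc m) (update s₂ v 0 x)) (≡.sym new≡) inv₂

        bs₃ : Bounded s₃
        bs₃ b j with (b ≡ᵇ v) ∧ (j ≡ᵇ 0)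
        ... | true  = ℕₚ.≤-trans (ℕₚ.≤-reflexive new≡) (ℕₚ.≤-trans (ℕₚ.≤-trans (s≤s (ℕₚ.m≤n+m m k)) (ℕₚ.≤-reflexive 1+k+m≡d)) d≤2^β)
        ... | false = bs₂ b j

        frame₃ : Frame (for v c) s s₃
        frame₃ b w i = ≡.trans (update-other s₂ v 0 _ b i (proj₁ (∨-false w)))
          (≡.trans (run-frame r₂ b (proj₁ (∨-false {writes (compile c) b} (proj₂ (∨-false {b ≡ᵇ v} w)))) i) (frame₁ b w i))

        guard≢0 : s₁ 0 1 ℕ.∸ s₁ v 0 ≢ 0
        guard≢0 g≡0 = contradiction (≡.trans (≡.sym (≡.trans (≡.cong₂ ℕ._∸_ (≡.trans (frame₁ 0 keeps-0 1) (≡.trans s≡d (≡.sym 1+k+m≡d))) v≡m) (ℕₚ.m+n∸n≡m (suc k) m))) g≡0) λ ()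

        continue : (∃₂ λ t s′ → Run (While guard v Do body) s₃ t s′ × t ℕ.≤ suc G ℕ.* B ℕ.+ k ℕ.* iteration × Bounded s′ × Inv d s′) →
                 ∃₂ λ t s′ → Run (While guard v Do body) s₁ t s′ × t ℕ.≤ suc G ℕ.* B ℕ.+ suc k ℕ.* iteration × Bounded s′ × Inv d s′
        continue (t , s′ , r , t≤ , bs′ , q) = _ , s′ , while≢0 guard≢0 (seq r₂ assign) r ,
          ℕₚ.≤-trans (s≤s (ℕₚ.+-mono-≤ (ℕₚ.+-mono-≤ (cost-bound (guard v) bs₁) (s≤s (ℕₚ.+-mono-≤ t₂≤ (cost₂-bound (lit 0) (increment v) bs₂)))) t≤))
          (ℕₚ.≤-trans (ℕₚ.≤-reflexive (solve 5 (λ g T K L I → con 1 :+ (g :+ (con 1 :+ (T :+ K)) :+ (L :+ I)) := L :+ ((con 2 :+ g :+ T :+ K) :+ I)) ≡.refl (G ℕ.* B) T (K ℕ.* B) (suc G ℕ.* B) (k ℕ.* iteration)))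
            (ℕₚ.+-monoʳ-≤ (suc G ℕ.* B) (ℕₚ.+-monoˡ-≤ (k ℕ.* iteration) (ℕₚ.+-monoˡ-≤ (K ℕ.* B) (ℕₚ.+-monoˡ-≤ T
              (ℕₚ.≤-trans (ℕₚ.+-monoˡ-≤ (G ℕ.* B) (ℕₚ.*-monoʳ-≤ 2 1≤B)) (ℕₚ.≤-reflexive (≡.sym (ℕₚ.*-distribʳ-+ B 2 G))))))))) ,
          bs′ , q
          where open Data.Nat.Solver.+-*-Solver

      total-time : ∀ {t} → t ℕ.≤ suc G ℕ.* B ℕ.+ d ℕ.* iteration → suc (binaryCost (lit 0) (lit 0) s ℕ.+ t) ℕ.≤ time (for v c)
      total-time {t} t≤ = begin
        suc (binaryCost (lit 0) (lit 0) s ℕ.+ t)                  ≤⟨ s≤s (ℕₚ.+-mono-≤ (cost₂-bound (lit 0) (lit 0) bs) t≤) ⟩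
        suc (Z ℕ.* B ℕ.+ (suc G ℕ.* B ℕ.+ d ℕ.* iteration))       ≤⟨ ℕₚ.+-monoˡ-≤ _ 1≤B ⟩
        B ℕ.+ (Z ℕ.* B ℕ.+ (suc G ℕ.* B ℕ.+ d ℕ.* iteration))     ≡⟨ solve 4 (λ B Z G I → B :+ (Z :* B :+ ((con 1 :+ G) :* B :+ I)) := (con 2 :+ Z :+ G) :* B :+ I) ≡.refl B Z G (d ℕ.* iteration) ⟩
        (2 ℕ.+ Z ℕ.+ G) ℕ.* B ℕ.+ d ℕ.* iteration                 ≤⟨ ℕₚ.+-mono-≤ (unit-time (2 ℕ.+ Z ℕ.+ G) {suc δ}) (ℕₚ.*-mono-≤ (ℕₚ.n≤1+n d) iteration≤) ⟩
        (2 ℕ.+ Z ℕ.+ G) ℕ.* B ℕ.* E ℕ.^ suc δ ℕ.+ E ℕ.* ((2 ℕ.+ G ℕ.+ weight c ℕ.+ K) ℕ.* B ℕ.* E ℕ.^ δ)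
          ≡⟨ solve 5 (λ W W′ B E X → W :* B :* (E :* X) :+ E :* (W′ :* B :* X) := (W :+ W′) :* B :* (E :* X)) ≡.refl (2 ℕ.+ Z ℕ.+ G) (2 ℕ.+ G ℕ.+ weight c ℕ.+ K) B E (E ℕ.^ δ) ⟩
        time (for v c)                                            ∎
        where
        open ℕₚ.≤-Reasoning
        open Data.Nat.Solver.+-*-Solver using (solve; con; _:=_; _:+_; _:*_)
        Z δ : ℕ
        Z = size₂ (lit 0) (lit 0)
        δ = depth c

        iteration≤ : iteration ℕ.≤ (2 ℕ.+ G ℕ.+ weight c ℕ.+ K) ℕ.* B ℕ.* E ℕ.^ δ
        iteration≤ = begin
          (2 ℕ.+ G) ℕ.* B ℕ.+ T ℕ.+ K ℕ.* B  ≤⟨ ℕₚ.+-mono-≤ (ℕₚ.+-monoˡ-≤ T (unit-time (2 ℕ.+ G) {δ})) (unit-time K {δ}) ⟩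
          (2 ℕ.+ G) ℕ.* B ℕ.* E ℕ.^ δ ℕ.+ weight c ℕ.* B ℕ.* E ℕ.^ δ ℕ.+ K ℕ.* B ℕ.* E ℕ.^ δ
            ≡⟨ ≡.trans (≡.cong (ℕ._+ K ℕ.* B ℕ.* E ℕ.^ δ) (+-time (2 ℕ.+ G) (weight c) {δ})) (+-time (2 ℕ.+ G ℕ.+ weight c) K {δ}) ⟩
          (2 ℕ.+ G ℕ.+ weight c ℕ.+ K) ℕ.* B ℕ.* E ℕ.^ δ ∎

      conclude : (∃₂ λ t s′ → Run (While guard v Do body) (update s v 0 0) t s′ × t ℕ.≤ suc G ℕ.* B ℕ.+ d ℕ.* iteration × Bounded s′ × Inv d s′) →
                 Exec (for v c) s (Inv d)
      conclude (t , s′ , r , t≤ , bs′ , q) = exec (seq assign r) (total-time t≤) bs′ q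

-- Recursion at the upper end matches the loops, which add the term with the largest index last.
Σ< : (ℕ → ℕ) → ℕ → ℕ
Σ< g zero    = 0
Σ< g (suc m) = Σ< g m ℕ.+ g m

Π< : (ℕ → ℕ) → ℕ → ℕ
Π< g zero    = 1
Π< g (suc m) = Π< g m ℕ.* g m

-- The portfolio program and its execution.

module PortfolioProgram where
  open Machine
  open CountedPrograms

  -- Array 5 holds the product of the numerators, 10 the total speed of the selected machines, 11
  -- the jobs left, 12 the number `b ^ e` of selected machines; 7, 9 and 13 are loop counters. With
  -- truncated subtraction, `1 ⊖ (x ⊖ k)` is 1 if `x ≤ k` and 0 otherwise. `share` is a quotient
  -- rounded up, and `base` is `⌊a⌋ - 1`.
  product key-of-i key-of-j isFast share base : Expr
  product  = 5 [ lit 0 ]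
  key-of-i = 6 [ 7 [ lit 0 ] ] ⊗ 0 [ lit 1 ] ⊕ 7 [ lit 0 ]
  key-of-j = 6 [ 9 [ lit 0 ] ] ⊗ 0 [ lit 1 ] ⊕ 9 [ lit 0 ]
  isFast   = lit 1 ⊖ ((8 [ 7 [ lit 0 ] ] ⊕ lit 1) ⊖ 12 [ lit 0 ])
  share    = isFast ⊗ ((0 [ lit 0 ] ⊗ 6 [ 7 [ lit 0 ] ] ⊕ (10 [ lit 0 ] ⊖ lit 1)) ⊘ 10 [ lit 0 ])
  base     = (0 [ lit 2 ] ⊘ 0 [ lit 3 ]) ⊖ lit 1

  -- Array 6 receives integers proportional to the speeds of the machines,
  -- array 8 their ranks, where ties are broken by the index.
  multiply divide compare rankAll addSpeed assignJobs balance iterate prepare program : Program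
  multiply   = assign 5 (lit 0) (product ⊗ 1 [ 7 [ lit 0 ] ])
  divide     = assign 6 (7 [ lit 0 ]) (2 [ 7 [ lit 0 ] ] ⊗ (product ⊘ 1 [ 7 [ lit 0 ] ]))
  -- `1 ⊖ (1 ⊖ x)` is the sign of `x`: the rank grows by one if machine `j` has the larger key.
  compare    = assign 8 (7 [ lit 0 ]) (8 [ 7 [ lit 0 ] ] ⊕ (lit 1 ⊖ (lit 1 ⊖ (key-of-j ⊖ key-of-i))))
  rankAll    = for 7 (for 9 compare)
  addSpeed   = assign 10 (lit 0) (10 [ lit 0 ] ⊕ 6 [ 7 [ lit 0 ] ] ⊗ isFast)
  -- `x ⊖ (x ⊖ y)` is the minimum of `x` and `y`: a machine gets its share or whatever is left.
  assignJobs = assign 4 (3 [ lit 0 ] ⊗ 0 [ lit 1 ] ⊕ 7 [ lit 0 ]) (11 [ lit 0 ] ⊖ (11 [ lit 0 ] ⊖ share)) then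
               assign 11 (lit 0) (11 [ lit 0 ] ⊖ share)
  balance    = assign 10 (lit 0) (lit 0) then
               for 7 addSpeed then
               assign 11 (lit 0) (0 [ lit 0 ]) then
               for 7 assignJobs then
               assign 3 (lit 0) (3 [ lit 0 ] ⊕ lit 1) then
               assign 12 (lit 0) (12 [ lit 0 ] ⊗ base)
  -- The loop has `d` rounds in any case; the test makes them idle once `b ^ e` exceeds `d`.
  iterate    = for 13 (when ((0 [ lit 1 ] ⊕ lit 1) ⊖ 12 [ lit 0 ]) balance)
  prepare    = assign 5 (lit 0) (lit 1) then for 7 multiply then for 7 divide then rankAll
  program    = prepare then assign 12 (lit 0) (lit 1) then iterate

  -- The values that the program computes, in the same truncated arithmetic, so that its execution
  -- is verified by rewriting and their meaning is established separately.
  module Specification (σ₀ : Store) where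
    n d b : ℕ
    n = σ₀ 0 0
    d = σ₀ 0 1
    b = quotient (σ₀ 0 2) (σ₀ 0 3) ℕ.∸ 1

    common : ℕ → ℕ
    common = Π< (σ₀ 1)

    speed key rank : ℕ → ℕ
    speed i = σ₀ 2 i ℕ.* quotient (common d) (σ₀ 1 i)
    key i   = speed i ℕ.* d ℕ.+ i

    faster : ℕ → ℕ → ℕ
    faster i j = 1 ℕ.∸ (1 ℕ.∸ (key j ℕ.∸ key i))

    rank i = Σ< (faster i) d

    fast : ℕ → ℕ → ℕ
    fast k i = 1 ℕ.∸ ((rank i ℕ.+ 1) ℕ.∸ k)

    selected : ℕ → ℕ → ℕ
    selected k i = speed i ℕ.* fast k i

    quota : ℕ → ℕ → ℕ
    quota k i = fast k i ℕ.* quotient (n ℕ.* speed i ℕ.+ (Σ< (selected k) d ℕ.∸ 1)) (Σ< (selected k) d)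

    remaining : ℕ → ℕ → ℕ
    remaining k m = n ℕ.∸ Σ< (quota k) m

    given : ℕ → ℕ → ℕ
    given k i = remaining k i ℕ.∸ (remaining k i ℕ.∸ quota k i)

    faster≤1 : ∀ i j → faster i j ℕ.≤ 1
    faster≤1 i j = ℕₚ.m∸n≤m 1 (1 ℕ.∸ (key j ℕ.∸ key i))

    Σfaster≤ : ∀ i m → Σ< (faster i) m ℕ.≤ m
    Σfaster≤ i zero    = z≤n
    Σfaster≤ i (suc m) = ℕₚ.≤-trans (ℕₚ.+-mono-≤ (Σfaster≤ i m) (faster≤1 i m)) (ℕₚ.≤-reflexive (ℕₚ.+-comm m 1))

    module Correctness (β : ℕ) (0<β : 0 ℕ.< β) (bounded₀ : ∀ a i → σ₀ a i ℕ.≤ 2 ℕ.^ β)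
                       (common≤ : ∀ m → m ℕ.≤ d → common m ℕ.≤ 2 ℕ.^ β)
                       (speed≤ : ∀ i → i ℕ.< d → speed i ℕ.≤ 2 ℕ.^ β)
                       (selected≤ : ∀ k m → m ℕ.≤ d → Σ< (selected k) m ℕ.≤ 2 ℕ.^ β)
                       (b*d≤ : b ℕ.* d ℕ.≤ 2 ℕ.^ β)
                       (2≤b : 2 ℕ.≤ b) (0<d : 0 ℕ.< d)
                       (empty₃ : ∀ i → σ₀ 3 i ≡ 0) (empty₈ : ∀ i → σ₀ 8 i ≡ 0) where

      N : ℕ
      N = 2 ℕ.^ β

      d≤N : d ℕ.≤ N
      d≤N = bounded₀ 0 1

      1≤N : 1 ℕ.≤ N
      1≤N = ℕₚ.m^n>0 2 β

      open Execution β 0<β d d≤N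

      record Inputs (s : Store) : Set where
        field
          in₀ : ∀ i → s 0 i ≡ σ₀ 0 i
          in₁ : ∀ i → s 1 i ≡ σ₀ 1 i
          in₂ : ∀ i → s 2 i ≡ σ₀ 2 i
      open Inputs

      inputs-frame : ∀ c {s s′} → writes (compile c) 0 ≡ false → writes (compile c) 1 ≡ false → writes (compile c) 2 ≡ false →
                     Frame c s s′ → Inputs s → Inputs s′
      inputs-frame c w₀ w₁ w₂ fr I = record
        { in₀ = λ i → ≡.trans (fr 0 w₀ i) (in₀ I i)
        ; in₁ = λ i → ≡.trans (fr 1 w₁ i) (in₁ I i)
        ; in₂ = λ i → ≡.trans (fr 2 w₂ i) (in₂ I i)
        }

      record Ranked (s : Store) : Set where
        field
          inputs : Inputs s
          speeds : ∀ i → i ℕ.< d → s 6 i ≡ speed i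
          ranks  : ∀ i → i ℕ.< d → s 8 i ≡ rank i
      open Ranked

      ranked-frame : ∀ c {s s′} → writes (compile c) 0 ≡ false → writes (compile c) 1 ≡ false → writes (compile c) 2 ≡ false →
                     writes (compile c) 6 ≡ false → writes (compile c) 8 ≡ false → Frame c s s′ → Ranked s → Ranked s′
      ranked-frame c w₀ w₁ w₂ w₆ w₈ fr K = record
        { inputs = inputs-frame c w₀ w₁ w₂ fr (inputs K)
        ; speeds = λ i i<d → ≡.trans (fr 6 w₆ i) (speeds K i i<d)
        ; ranks  = λ i i<d → ≡.trans (fr 8 w₈ i) (ranks K i i<d)
        }

      bound-by : ∀ {x y} → x ≡ y → y ℕ.≤ N → x ℕ.≤ N
      bound-by x≡y y≤N = ℕₚ.≤-trans (ℕₚ.≤-reflexive x≡y) y≤N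

      run-multiply : ∀ {s} → Bounded s → Inputs s → s 5 0 ≡ 1 → Exec (for 7 multiply) s (λ s′ → s′ 5 0 ≡ common d)
      run-multiply {s} bs I s5≡1 = exec-for 7 multiply (λ m s′ → s′ 5 0 ≡ common m) ≡.refl ≡.refl ≡.refl bs (in₀ I 1) s5≡1
        λ m s′ m<d bs′ fr i≡m inv →
          let value : s′ 5 0 ℕ.* s′ 1 (s′ 7 0) ≡ common (suc m)
              value = ≡.cong₂ ℕ._*_ inv (≡.trans (≡.cong (s′ 1) i≡m) (≡.trans (fr 1 ≡.refl m) (in₁ I m)))
          in exec-assign (lit 0) _ bs′ (bound-by value (common≤ (suc m) m<d)) value

      run-divide : ∀ {s} → Bounded s → Inputs s → s 5 0 ≡ common d → Exec (for 7 divide) s (λ s′ → ∀ i → i ℕ.< d → s′ 6 i ≡ speed i)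
      run-divide {s} bs I s5≡ = exec-for 7 divide (λ m s′ → ∀ i → i ℕ.< m → s′ 6 i ≡ speed i) ≡.refl ≡.refl ≡.refl bs (in₀ I 1) (λ i ())
        λ m s′ m<d bs′ fr i≡m inv →
          let value : s′ 2 (s′ 7 0) ℕ.* quotient (s′ 5 0) (s′ 1 (s′ 7 0)) ≡ speed m
              value = ≡.cong₂ ℕ._*_ (≡.trans (≡.cong (s′ 2) i≡m) (≡.trans (fr 2 ≡.refl m) (in₂ I m)))
                        (≡.cong₂ quotient (≡.trans (fr 5 ≡.refl 0) s5≡) (≡.trans (≡.cong (s′ 1) i≡m) (≡.trans (fr 1 ≡.refl m) (in₁ I m))))
          in exec-assign (7 [ lit 0 ]) _ bs′ (bound-by value (speed≤ m m<d))
            λ i i<1+m → case i ℕₚ.≟ m of λ where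
              (yes ≡.refl) → ≡.trans (update-hit s′ 6 _ _ i (≡.sym i≡m)) value
              (no  i≢m)    → ≡.trans (update-miss s′ 6 _ _ i (λ i≡ → i≢m (≡.trans i≡ i≡m))) (inv i (ℕₚ.≤∧≢⇒< (ℕₚ.≤-pred i<1+m) i≢m))

      run-rank : ∀ {s} → Bounded s → Inputs s → (∀ i → i ℕ.< d → s 6 i ≡ speed i) → (∀ i → s 8 i ≡ 0) →
                 Exec rankAll s (λ s′ → ∀ i → i ℕ.< d → s′ 8 i ≡ rank i)
      run-rank {s} bs I sp empty = weaken (exec-for 7 (for 9 compare) Inv ≡.refl ≡.refl ≡.refl bs (in₀ I 1)
          ((λ i ()) , λ i _ → empty i)
          λ m s′ m<d bs′ fr i≡m (below , above) →
            weaken′ m s′ i≡m m<d below above (exec-for 9 compare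
              (λ j s″ → s″ 8 m ≡ Σ< (faster m) j × (∀ i → i ≢ m → s″ 8 i ≡ s′ 8 i)) ≡.refl ≡.refl ≡.refl bs′ (≡.trans (fr 0 ≡.refl 1) (in₀ I 1))
              (above m ℕₚ.≤-refl , λ i _ → ≡.refl)
              λ j s″ j<d bs″ fr″ j≡ (acc , others) →
                let i≡″ : s″ 7 0 ≡ m
                    i≡″ = ≡.trans (fr″ 7 ≡.refl 0) i≡m
                    speed″ : ∀ x {y} → x ≡ y → y ℕ.< d → s″ 6 x ≡ speed y
                    speed″ x x≡y y<d = ≡.trans (≡.cong (s″ 6) x≡y) (≡.trans (fr″ 6 ≡.refl _) (≡.trans (fr 6 ≡.refl _) (sp _ y<d)))
                    d≡″ : s″ 0 1 ≡ d
                    d≡″ = ≡.trans (fr″ 0 ≡.refl 1) (≡.trans (fr 0 ≡.refl 1) (in₀ I 1))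
                    key″ : ∀ x {y} → x ≡ y → y ℕ.< d → s″ 6 x ℕ.* s″ 0 1 ℕ.+ x ≡ key y
                    key″ x x≡y y<d = ≡.cong₂ ℕ._+_ (≡.cong₂ ℕ._*_ (speed″ x x≡y y<d) d≡″) x≡y
                    value : s″ 8 (s″ 7 0) ℕ.+ (1 ℕ.∸ (1 ℕ.∸ ((s″ 6 (s″ 9 0) ℕ.* s″ 0 1 ℕ.+ s″ 9 0) ℕ.∸ (s″ 6 (s″ 7 0) ℕ.* s″ 0 1 ℕ.+ s″ 7 0)))) ≡ Σ< (faster m) (suc j)
                    value = ≡.cong₂ ℕ._+_ (≡.trans (≡.cong (s″ 8) i≡″) acc)
                      (≡.cong (λ x → 1 ℕ.∸ (1 ℕ.∸ x)) (≡.cong₂ ℕ._∸_ (key″ (s″ 9 0) j≡ j<d) (key″ (s″ 7 0) i≡″ m<d)))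
                in exec-assign (7 [ lit 0 ]) _ bs″ (bound-by value (ℕₚ.≤-trans (Σfaster≤ m (suc j)) (ℕₚ.≤-trans j<d d≤N)))
                  (≡.trans (update-hit s″ 8 _ _ m (≡.sym i≡″)) value ,
                   λ i i≢m → ≡.trans (update-miss s″ 8 _ _ i (λ i≡ → i≢m (≡.trans i≡ i≡″))) (others i i≢m))))
        where
        -- `compare` accumulates in place, so the ranks still to be computed must be 0.
        Inv : ℕ → Store → Set
        Inv m s′ = (∀ i → i ℕ.< m → s′ 8 i ≡ rank i) × (∀ i → m ℕ.≤ i → s′ 8 i ≡ 0)

        weaken : Exec rankAll s (Inv d) → Exec rankAll s (λ s′ → ∀ i → i ℕ.< d → s′ 8 i ≡ rank i)
        weaken (exec r t≤ bs′ (inv , _)) = exec r t≤ bs′ inv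

        weaken′ : ∀ m s′ → s′ 7 0 ≡ m → m ℕ.< d → (∀ i → i ℕ.< m → s′ 8 i ≡ rank i) → (∀ i → m ℕ.≤ i → s′ 8 i ≡ 0) →
                  Exec (for 9 compare) s′ (λ s″ → s″ 8 m ≡ rank m × (∀ i → i ≢ m → s″ 8 i ≡ s′ 8 i)) →
                  Exec (for 9 compare) s′ (λ s″ → Inv (suc m) (update s″ 7 0 (suc m)))
        weaken′ m s′ i≡m m<d below above (exec r t≤ bs″ (at-m , others)) = exec r t≤ bs″
          ((λ i i<1+m → case i ℕₚ.≟ m of λ where
            (yes ≡.refl) → at-m
            (no  i≢m)    → ≡.trans (others i i≢m) (below i (ℕₚ.≤∧≢⇒< (ℕₚ.≤-pred i<1+m) i≢m))) ,
          λ i m<i → ≡.trans (others i λ { ≡.refl → ℕₚ.<-irrefl ≡.refl m<i }) (above i (ℕₚ.<⇒≤ m<i)))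

      run-prepare : Exec prepare σ₀ (λ s → Ranked s × s 3 0 ≡ 0)
      run-prepare =
        exec-then (exec-assign (lit 0) (lit 1) {Q = λ s → s 5 0 ≡ 1} bounded₀ 1≤N ≡.refl) λ s₁ bs₁ fr₁ s5≡1 →
        let I₁ = inputs-frame (assign 5 (lit 0) (lit 1)) ≡.refl ≡.refl ≡.refl fr₁ (record { in₀ = λ _ → ≡.refl ; in₁ = λ _ → ≡.refl ; in₂ = λ _ → ≡.refl })
        in exec-then (run-multiply bs₁ I₁ s5≡1) λ s₂ bs₂ fr₂ s5≡ →
        let I₂ = inputs-frame (for 7 multiply) ≡.refl ≡.refl ≡.refl fr₂ I₁
        in exec-then (run-divide bs₂ I₂ s5≡) λ s₃ bs₃ fr₃ sp →
        let I₃ = inputs-frame (for 7 divide) ≡.refl ≡.refl ≡.refl fr₃ I₂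
            exec r t≤ bs₄ rk = run-rank bs₃ I₃ sp (λ i → ≡.trans (fr₃ 8 ≡.refl i) (≡.trans (fr₂ 8 ≡.refl i) (≡.trans (fr₁ 8 ≡.refl i) (empty₈ i))))
        in exec r t≤ bs₄
           (record { inputs = inputs-frame rankAll ≡.refl ≡.refl ≡.refl (run-frame r) I₃
                  ; speeds = λ i i<d → ≡.trans (run-frame r 6 ≡.refl i) (sp i i<d)
                  ; ranks  = rk } ,
           ≡.trans (run-frame r 3 ≡.refl 0) (≡.trans (fr₃ 3 ≡.refl 0) (≡.trans (fr₂ 3 ≡.refl 0) (≡.trans (fr₁ 3 ≡.refl 0) (empty₃ 0)))))

      fast-value : ∀ {s m k} → Ranked s → m ℕ.< d → s 7 0 ≡ m → s 12 0 ≡ k → 1 ℕ.∸ ((s 8 (s 7 0) ℕ.+ 1) ℕ.∸ s 12 0) ≡ fast k m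
      fast-value {s} K m<d i≡m s12≡k = ≡.cong₂ (λ x y → 1 ℕ.∸ ((x ℕ.+ 1) ℕ.∸ y)) (≡.trans (≡.cong (s 8) i≡m) (ranks K _ m<d)) s12≡k

      run-addSpeed : ∀ {s k} → Bounded s → Ranked s → s 12 0 ≡ k → s 10 0 ≡ 0 → Exec (for 7 addSpeed) s (λ s′ → s′ 10 0 ≡ Σ< (selected k) d)
      run-addSpeed {s} {k} bs K s12≡k s10≡0 =
        exec-for 7 addSpeed (λ m s′ → s′ 10 0 ≡ Σ< (selected k) m) ≡.refl ≡.refl ≡.refl bs (in₀ (inputs K) 1) s10≡0
        λ m s′ m<d bs′ fr i≡m inv →
          let K′ = ranked-frame (for 7 addSpeed) ≡.refl ≡.refl ≡.refl ≡.refl ≡.refl fr K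
              value : s′ 10 0 ℕ.+ s′ 6 (s′ 7 0) ℕ.* (1 ℕ.∸ ((s′ 8 (s′ 7 0) ℕ.+ 1) ℕ.∸ s′ 12 0)) ≡ Σ< (selected k) (suc m)
              value = ≡.cong₂ ℕ._+_ inv (≡.cong₂ ℕ._*_ (≡.trans (≡.cong (s′ 6) i≡m) (speeds K′ m m<d)) (fast-value K′ m<d i≡m (≡.trans (fr 12 ≡.refl 0) s12≡k)))
          in exec-assign (lit 0) _ bs′ (bound-by value (selected≤ k (suc m) m<d)) value

      remaining-suc : ∀ k m → remaining k m ℕ.∸ quota k m ≡ remaining k (suc m)
      remaining-suc k m = ℕₚ.∸-+-assoc n (Σ< (quota k) m) (quota k m)

      remaining≤N : ∀ k m → remaining k m ℕ.≤ N
      remaining≤N k m = ℕₚ.≤-trans (ℕₚ.m∸n≤m n (Σ< (quota k) m)) (bounded₀ 0 0)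

      Filled : ℕ → ℕ → Store → ℕ → Store → Set
      Filled k e s m s′ = s′ 11 0 ≡ remaining k m × (∀ i → i ℕ.< m → s′ 4 (e ℕ.* d ℕ.+ i) ≡ given k i) × (∀ j → j ℕ.< e ℕ.* d → s′ 4 j ≡ s 4 j)

      run-assignJobs : ∀ {s k e} → Bounded s → Ranked s → s 12 0 ≡ k → s 10 0 ≡ Σ< (selected k) d → s 3 0 ≡ e → s 11 0 ≡ n →
                       Exec (for 7 assignJobs) s (Filled k e s d)
      run-assignJobs {s} {k} {e} bs K s12≡k s10≡ s3≡e s11≡n =
        exec-for 7 assignJobs (Filled k e s) ≡.refl ≡.refl ≡.refl bs (in₀ (inputs K) 1) (s11≡n , (λ i ()) , λ j _ → ≡.refl)
        λ m s′ m<d bs′ fr i≡m (rem , filled , others) →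
          let K′ = ranked-frame (for 7 assignJobs) ≡.refl ≡.refl ≡.refl ≡.refl ≡.refl fr K
              share≡ : ∀ {s″} → Ranked s″ → s″ 7 0 ≡ m → s″ 12 0 ≡ k → s″ 10 0 ≡ Σ< (selected k) d → eval share s″ ≡ quota k m
              share≡ {s″} K″ i≡″ s12≡″ s10≡″ = ≡.cong₂ ℕ._*_ (fast-value K″ m<d i≡″ s12≡″)
                (≡.cong₂ quotient (≡.cong₂ ℕ._+_ (≡.cong₂ ℕ._*_ (in₀ (inputs K″) 0) (≡.trans (≡.cong (s″ 6) i≡″) (speeds K″ m m<d))) (≡.cong (ℕ._∸ 1) s10≡″)) s10≡″)
              s12≡′ = ≡.trans (fr 12 ≡.refl 0) s12≡k
              s10≡′ = ≡.trans (fr 10 ≡.refl 0) s10≡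
              share≡′ = share≡ K′ i≡m s12≡′ s10≡′
              value : s′ 11 0 ℕ.∸ (s′ 11 0 ℕ.∸ eval share s′) ≡ given k m
              value = ≡.cong₂ (λ x y → x ℕ.∸ (x ℕ.∸ y)) rem share≡′
              index≡ : s′ 3 0 ℕ.* s′ 0 1 ℕ.+ s′ 7 0 ≡ e ℕ.* d ℕ.+ m
              index≡ = ≡.cong₂ ℕ._+_ (≡.cong₂ ℕ._*_ (≡.trans (fr 3 ≡.refl 0) s3≡e) (in₀ (inputs K′) 1)) i≡m
              first = assign 4 (3 [ lit 0 ] ⊗ 0 [ lit 1 ] ⊕ 7 [ lit 0 ]) (11 [ lit 0 ] ⊖ (11 [ lit 0 ] ⊖ share))
          in exec-then {c = first} {P = λ s″ → (∀ i → i ℕ.< suc m → s″ 4 (e ℕ.* d ℕ.+ i) ≡ given k i) × (∀ j → j ℕ.< e ℕ.* d → s″ 4 j ≡ s 4 j)}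
            (exec-assign _ _ bs′ (bound-by value (ℕₚ.≤-trans (ℕₚ.m∸n≤m (remaining k m) (remaining k m ℕ.∸ quota k m)) (remaining≤N k m)))
              ((λ i i<1+m → case i ℕₚ.≟ m of λ where
                  (yes ≡.refl) → ≡.trans (update-hit s′ 4 _ _ _ (≡.sym index≡)) value
                  (no  i≢m)    → ≡.trans (update-miss s′ 4 _ _ _ (λ eq → i≢m (ℕₚ.+-cancelˡ-≡ (e ℕ.* d) i m (≡.trans eq index≡)))) (filled i (ℕₚ.≤∧≢⇒< (ℕₚ.≤-pred i<1+m) i≢m))) ,
               λ j j<ed → ≡.trans (update-miss s′ 4 _ _ j (λ eq → ℕₚ.<⇒≱ j<ed (ℕₚ.≤-trans (ℕₚ.m≤m+n (e ℕ.* d) m) (ℕₚ.≤-reflexive (≡.sym (≡.trans eq index≡)))))) (others j j<ed)))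
            λ s″ bs″ fr″ (filled″ , others″) →
              let K″ = ranked-frame first ≡.refl ≡.refl ≡.refl ≡.refl ≡.refl fr″ K′
                  value″ : s″ 11 0 ℕ.∸ eval share s″ ≡ remaining k (suc m)
                  value″ = ≡.trans (≡.cong₂ ℕ._∸_ (≡.trans (fr″ 11 ≡.refl 0) rem)
                             (share≡ K″ (≡.trans (fr″ 7 ≡.refl 0) i≡m) (≡.trans (fr″ 12 ≡.refl 0) s12≡′) (≡.trans (fr″ 10 ≡.refl 0) s10≡′))) (remaining-suc k m)
              in exec-assign (lit 0) _ bs″ (bound-by value″ (remaining≤N k (suc m))) (value″ , filled″ , others″)

      Balanced : Store → ℕ → ℕ → Store → Set
      Balanced s k e s′ = s′ 12 0 ≡ b ℕ.* k × s′ 3 0 ≡ suc e × (∀ i → i ℕ.< d → s′ 4 (e ℕ.* d ℕ.+ i) ≡ given k i) × (∀ j → j ℕ.< e ℕ.* d → s′ 4 j ≡ s 4 j)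

      run-balance : ∀ {s k e} → Bounded s → Ranked s → s 12 0 ≡ k → s 3 0 ≡ e → e ℕ.< d → k ℕ.≤ d →
                    Exec balance s (Balanced s k e)
      run-balance {s} {k} {e} bs K s12≡k s3≡e e<d k≤d =
        exec-then (exec-assign (lit 0) (lit 0) {Q = λ s′ → s′ 10 0 ≡ 0} bs z≤n ≡.refl) λ s₁ bs₁ fr₁ s10≡0 →
        let K₁ = ranked-frame (assign 10 (lit 0) (lit 0)) ≡.refl ≡.refl ≡.refl ≡.refl ≡.refl fr₁ K
            k₁ = ≡.trans (fr₁ 12 ≡.refl 0) s12≡k
        in exec-then (run-addSpeed bs₁ K₁ k₁ s10≡0) λ s₂ bs₂ fr₂ s10≡ →
        let K₂ = ranked-frame (for 7 addSpeed) ≡.refl ≡.refl ≡.refl ≡.refl ≡.refl fr₂ K₁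
            k₂ = ≡.trans (fr₂ 12 ≡.refl 0) k₁
        in exec-then (exec-assign (lit 0) (0 [ lit 0 ]) {Q = λ s′ → s′ 11 0 ≡ n} bs₂ (bs₂ 0 0) (in₀ (inputs K₂) 0)) λ s₃ bs₃ fr₃ s11≡n →
        let K₃ = ranked-frame (assign 11 (lit 0) (0 [ lit 0 ])) ≡.refl ≡.refl ≡.refl ≡.refl ≡.refl fr₃ K₂
            k₃ = ≡.trans (fr₃ 12 ≡.refl 0) k₂
            e₃ = ≡.trans (fr₃ 3 ≡.refl 0) (≡.trans (fr₂ 3 ≡.refl 0) (≡.trans (fr₁ 3 ≡.refl 0) s3≡e))
        in exec-then (run-assignJobs bs₃ K₃ k₃ (≡.trans (fr₃ 10 ≡.refl 0) s10≡) e₃ s11≡n) λ s₄ bs₄ fr₄ (_ , filled , others) →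
        let K₄ = ranked-frame (for 7 assignJobs) ≡.refl ≡.refl ≡.refl ≡.refl ≡.refl fr₄ K₃
            k₄ = ≡.trans (fr₄ 12 ≡.refl 0) k₃
            e₄ : s₄ 3 0 ℕ.+ 1 ≡ suc e
            e₄ = ≡.trans (≡.cong (ℕ._+ 1) (≡.trans (fr₄ 3 ≡.refl 0) e₃)) (ℕₚ.+-comm e 1)
            count = assign 3 (lit 0) (3 [ lit 0 ] ⊕ lit 1)
        in exec-then {c = count} (exec-assign (lit 0) _ {Q = λ s′ → s′ 3 0 ≡ suc e} bs₄ (bound-by e₄ (ℕₚ.≤-trans e<d d≤N)) e₄) λ s₅ bs₅ fr₅ e₅ →
        let K₅ = ranked-frame count ≡.refl ≡.refl ≡.refl ≡.refl ≡.refl fr₅ K₄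
            value : s₅ 12 0 ℕ.* (quotient (s₅ 0 2) (s₅ 0 3) ℕ.∸ 1) ≡ b ℕ.* k
            value = ≡.trans (≡.cong₂ ℕ._*_ (≡.trans (fr₅ 12 ≡.refl 0) k₄) (≡.cong (ℕ._∸ 1) (≡.cong₂ quotient (in₀ (inputs K₅) 2) (in₀ (inputs K₅) 3)))) (ℕₚ.*-comm k b)
        -- The power is multiplied only while it is at most `d`, so it never exceeds `b * d`.
        in exec-assign (lit 0) _ bs₅ (bound-by value (ℕₚ.≤-trans (ℕₚ.*-monoʳ-≤ b k≤d) b*d≤))
          (value , e₅ , (λ i i<d → ≡.trans (fr₅ 4 ≡.refl _) (filled i i<d)) ,
           λ j j<ed → ≡.trans (fr₅ 4 ≡.refl j) (≡.trans (others j j<ed) (≡.trans (fr₃ 4 ≡.refl j) (≡.trans (fr₂ 4 ≡.refl j) (fr₁ 4 ≡.refl j)))))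

      -- After `o` rounds, `e` schedules are written. `advanced` records that either no round was
      -- idle or the powers have passed `d`.
      record Progress (o : ℕ) (s : Store) : Set where
        field
          e        : ℕ
          count    : s 3 0 ≡ e
          power    : s 12 0 ≡ b ℕ.^ e
          powers≤d : ∀ e′ → e′ ℕ.< e → b ℕ.^ e′ ℕ.≤ d
          advanced : e ≡ o ⊎ d ℕ.< b ℕ.^ e
          e≤o      : e ℕ.≤ o
          written  : ∀ e′ → e′ ℕ.< e → ∀ i → i ℕ.< d → s 4 (e′ ℕ.* d ℕ.+ i) ≡ given (b ℕ.^ e′) i
      open Progress

      run-iterate : ∀ {s} → Bounded s → Ranked s → s 3 0 ≡ 0 → s 12 0 ≡ 1 → Exec iterate s (Progress d)
      run-iterate {s} bs K s3≡0 s12≡1 = exec-for 13 (when test balance) Progress ≡.refl ≡.refl ≡.refl bs (in₀ (inputs K) 1)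
          (record { e = 0 ; count = s3≡0 ; power = s12≡1 ; powers≤d = λ _ () ; advanced = inj₁ ≡.refl ; e≤o = z≤n ; written = λ _ () })
          λ o s′ o<d bs′ fr o≡ pr →
            let K′ = ranked-frame iterate ≡.refl ≡.refl ≡.refl ≡.refl ≡.refl fr K
                value : s′ 0 1 ℕ.+ 1 ℕ.∸ s′ 12 0 ≡ suc d ℕ.∸ b ℕ.^ e pr
                value = ≡.cong₂ ℕ._∸_ (≡.trans (≡.cong (ℕ._+ 1) (in₀ (inputs K′) 1)) (ℕₚ.+-comm d 1)) (power pr)
            in exec-when test bs′
              (λ test≢0 → advance o s′ o<d bs′ K′ pr (ℕₚ.≤-pred (ℕₚ.m∸n≢0⇒n<m λ eq → test≢0 (≡.trans value eq))))
              (λ test≡0 → let d<bᵉ = ℕₚ.m∸n≡0⇒m≤n (≡.trans (≡.sym value) test≡0) in record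
                { e = e pr ; count = count pr ; power = power pr ; powers≤d = powers≤d pr ; advanced = inj₂ d<bᵉ ; e≤o = ℕₚ.m≤n⇒m≤1+n (e≤o pr) ; written = written pr })
        where
        test : Expr
        test = (0 [ lit 1 ] ⊕ lit 1) ⊖ 12 [ lit 0 ]

        advance : ∀ o s′ → o ℕ.< d → Bounded s′ → Ranked s′ → (pr : Progress o s′) → b ℕ.^ e pr ℕ.≤ d →
                  Exec balance s′ (λ s″ → Progress (suc o) (update s″ 13 0 (suc o)))
        advance o s′ o<d bs′ K′ pr bᵉ≤d = continue (run-balance bs′ K′ (power pr) (count pr) (ℕₚ.≤-<-trans (e≤o pr) o<d) bᵉ≤d)
          where
          continue : Exec balance s′ (Balanced s′ (b ℕ.^ e pr) (e pr)) → Exec balance s′ (λ s″ → Progress (suc o) (update s″ 13 0 (suc o)))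
          continue (exec r t≤ bs″ (power″ , count″ , written″ , others)) = exec r t≤ bs″ record
            { e = suc (e pr) ; count = count″ ; power = power″
            ; powers≤d = λ e′ e′<1+e → case e′ ℕₚ.≟ e pr of λ where
                (yes ≡.refl) → bᵉ≤d
                (no  e′≢e)   → powers≤d pr e′ (ℕₚ.≤∧≢⇒< (ℕₚ.≤-pred e′<1+e) e′≢e)
            ; advanced = [ inj₁ ∘ ≡.cong suc , (λ d<bᵉ → contradiction bᵉ≤d (ℕₚ.<⇒≱ d<bᵉ)) ]′ (advanced pr)
            ; e≤o = s≤s (e≤o pr)
            ; written = λ e′ e′<1+e i i<d → case e′ ℕₚ.≟ e pr of λ where
                (yes ≡.refl) → written″ i i<d
                (no  e′≢e)   → let e′<e = ℕₚ.≤∧≢⇒< (ℕₚ.≤-pred e′<1+e) e′≢e in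
                  ≡.trans (others _ (ℕₚ.<-≤-trans (ℕₚ.+-monoʳ-< (e′ ℕ.* d) i<d) (ℕₚ.≤-trans (ℕₚ.≤-reflexive (ℕₚ.+-comm (e′ ℕ.* d) d)) (ℕₚ.*-monoˡ-≤ d e′<e))))
                    (written pr e′ e′<e i i<d)
            }

      record Result (s : Store) : Set where
        field
          E       : ℕ
          count   : s 3 0 ≡ suc E
          bᴱ≤d    : b ℕ.^ E ℕ.≤ d
          d<bᴱ⁺¹  : d ℕ.< b ℕ.^ suc E
          written : ∀ e → e ℕ.≤ E → ∀ i → i ℕ.< d → s 4 (e ℕ.* d ℕ.+ i) ≡ given (b ℕ.^ e) i

      run-program : Exec program σ₀ Result
      run-program =
        finish (exec-then run-prepare λ s₁ bs₁ fr₁ (K₁ , s3≡0) →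
        exec-then (exec-assign (lit 0) (lit 1) {Q = λ s → s 12 0 ≡ 1} bs₁ 1≤N ≡.refl) λ s₂ bs₂ fr₂ s12≡1 →
        run-iterate bs₂ (ranked-frame (assign 12 (lit 0) (lit 1)) ≡.refl ≡.refl ≡.refl ≡.refl ≡.refl fr₂ K₁) (≡.trans (fr₂ 3 ≡.refl 0) s3≡0) s12≡1)
        where
        result : ∀ {s} → Progress d s → Result s
        result {s} record { e = zero ; advanced = inj₁ 0≡d } = contradiction 0≡d (ℕₚ.<⇒≢ 0<d)
        result {s} record { e = zero ; advanced = inj₂ d<1 } = contradiction 0<d (ℕₚ.<⇒≱ d<1)
        result {s} record { e = suc E ; count = count ; powers≤d = powers≤d ; advanced = advanced ; written = written } = record
          { E = E ; count = count ; bᴱ≤d = powers≤d E ℕₚ.≤-refl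
          -- If no round was idle, then `d = E + 1`, which is below `b ^ (E + 1)` anyway: `d` rounds
          -- are enough.
          ; d<bᴱ⁺¹ = [ (λ 1+E≡d → ≡.subst (ℕ._< b ℕ.^ suc E) 1+E≡d (n<b^n 2≤b (suc E))) , id ]′ advanced
          ; written = λ e e≤E → written e (s≤s e≤E)
          }

        finish : Exec program σ₀ (Progress d) → Exec program σ₀ Result
        finish (exec r t≤ bs pr) = exec r t≤ bs (result pr)

-- Finite sums and products of natural numbers.

jobs-cong : ∀ {d} {m m′ : Vector ℕ d} → (∀ i → m i ≡ m′ i) → jobs m ≡ jobs m′
jobs-cong m≗m′ = ≡.cong sumᴸ (tabulate-cong m≗m′)

-- Links the sums that loops compute with those of vectors, which can be permuted.
jobs-toℕ : ∀ d g → jobs {d} (g ∘ toℕ) ≡ Σ< g d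
jobs-toℕ zero    g = ≡.refl
jobs-toℕ (suc d) g = ≡.trans (≡.cong (g 0 ℕ.+_) (jobs-toℕ d (g ∘ suc))) (head d g)
  where
  head : ∀ m g → g 0 ℕ.+ Σ< (g ∘ suc) m ≡ Σ< g (suc m)
  head zero    g = ℕₚ.+-comm (g 0) 0
  head (suc m) g = ≡.trans (≡.sym (ℕₚ.+-assoc (g 0) _ _)) (≡.cong (ℕ._+ g (suc m)) (head m g))

Σ<-mono : ∀ {f g} m → (∀ i → i ℕ.< m → f i ℕ.≤ g i) → Σ< f m ℕ.≤ Σ< g m
Σ<-mono zero    f≤g = z≤n
Σ<-mono (suc m) f≤g = ℕₚ.+-mono-≤ (Σ<-mono m (λ i i<m → f≤g i (ℕₚ.m<n⇒m<1+n i<m))) (f≤g m ℕₚ.≤-refl)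

Σ<-*ˡ : ∀ c g m → c ℕ.* Σ< g m ≡ Σ< (λ i → c ℕ.* g i) m
Σ<-*ˡ c g zero    = ℕₚ.*-zeroʳ c
Σ<-*ˡ c g (suc m) = ≡.trans (ℕₚ.*-distribˡ-+ c (Σ< g m) (g m)) (≡.cong (ℕ._+ c ℕ.* g m) (Σ<-*ˡ c g m))

Σ<-*ʳ : ∀ c g m → Σ< g m ℕ.* c ≡ Σ< (λ i → g i ℕ.* c) m
Σ<-*ʳ c g zero    = ≡.refl
Σ<-*ʳ c g (suc m) = ≡.trans (ℕₚ.*-distribʳ-+ c (Σ< g m) (g m)) (≡.cong (ℕ._+ g m ℕ.* c) (Σ<-*ʳ c g m))

Σ<-monoʳ : ∀ g {m m′} → m ℕ.≤ m′ → Σ< g m ℕ.≤ Σ< g m′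
Σ<-monoʳ g {m} {zero}   z≤n = z≤n
Σ<-monoʳ g {m} {suc m′} m≤ = case ℕₚ.m≤n⇒m<n∨m≡n m≤ of λ where
  (inj₁ m<)     → ℕₚ.≤-trans (Σ<-monoʳ g (ℕₚ.≤-pred m<)) (ℕₚ.m≤m+n _ (g m′))
  (inj₂ ≡.refl) → ℕₚ.≤-refl

Σ<-≤* : ∀ {g c} m → (∀ i → i ℕ.< m → g i ℕ.≤ c) → Σ< g m ℕ.≤ m ℕ.* c
Σ<-≤* zero    g≤c = z≤n
Σ<-≤* {c = c} (suc m) g≤c = ℕₚ.≤-trans (ℕₚ.+-mono-≤ (Σ<-≤* m (λ i i<m → g≤c i (ℕₚ.m<n⇒m<1+n i<m))) (g≤c m ℕₚ.≤-refl)) (ℕₚ.≤-reflexive (ℕₚ.+-comm (m ℕ.* c) c))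

term≤Σ< : ∀ g {i m} → i ℕ.< m → g i ℕ.≤ Σ< g m
term≤Σ< g {i} i<m = ℕₚ.≤-trans (ℕₚ.m≤n+m (g i) (Σ< g i)) (Σ<-monoʳ g i<m)

-- Keeps the product of all numerators within the total bit length of the input.
Π<-≤2^ : ∀ {f g} m → (∀ i → f i ℕ.≤ 2 ℕ.^ g i) → Π< f m ℕ.≤ 2 ℕ.^ Σ< g m
Π<-≤2^ zero    f≤ = ℕₚ.≤-refl
Π<-≤2^ {f} {g} (suc m) f≤ = ℕₚ.≤-trans (ℕₚ.*-mono-≤ (Π<-≤2^ m f≤) (f≤ m)) (ℕₚ.≤-reflexive (≡.sym (ℕₚ.^-distribˡ-+-* 2 (Σ< g m) (g m))))

Π<-multiple : ∀ f {i m} → i ℕ.< m → ∃ λ c → Π< f m ≡ c ℕ.* f i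
Π<-multiple f {i} {suc m} i<1+m with i ℕₚ.≟ m
... | yes ≡.refl = Π< f m , ≡.refl
... | no  i≢m with c , eq ← Π<-multiple f {i} {m} (ℕₚ.≤∧≢⇒< (ℕₚ.≤-pred i<1+m) i≢m) =
  c ℕ.* f m , ≡.trans (≡.cong (ℕ._* f m) eq)
    (≡.trans (ℕₚ.*-assoc c (f i) (f m)) (≡.trans (≡.cong (c ℕ.*_) (ℕₚ.*-comm (f i) (f m))) (≡.sym (ℕₚ.*-assoc c (f m) (f i)))))

Π<-pos : ∀ {f} m → (∀ i → i ℕ.< m → 0 ℕ.< f i) → 0 ℕ.< Π< f m
Π<-pos zero    0<f = z<s
Π<-pos (suc m) 0<f = ℕₚ.*-mono-≤ (Π<-pos m (λ i i<m → 0<f i (ℕₚ.m<n⇒m<1+n i<m))) (0<f m ℕₚ.≤-refl)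

-- Bit lengths and running time.

module ProgramCorrectness where
  open Machine
  open CountedPrograms
  open PortfolioProgram

  v≤2^bits : ∀ v → v ℕ.≤ 2 ℕ.^ bits v
  v≤2^bits v = ℕₚ.≮⇒≥ λ 2^<v → ℕₚ.<-irrefl ≡.refl
    (ℕₚ.≤-trans (ℕₚ.≤-reflexive (≡.sym (⌊log₂[2^n]⌋≡n (bits v)))) (⌊log₂⌋-mono-≤ (ℕₚ.<⇒≤ 2^<v)))

  contents-tabulate : ∀ {d} (f : Vector ℕ d) i → contents (List.tabulate f) (toℕ i) ≡ f i
  contents-tabulate f zero    = ≡.refl
  contents-tabulate f (suc i) = contents-tabulate (f ∘ suc) i

  contents-≤ : ∀ {M xs} → All (ℕ._≤ M) xs → ∀ i → contents xs i ℕ.≤ M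
  contents-≤ []       i       = z≤n
  contents-≤ (p ∷ ps) zero    = p
  contents-≤ (p ∷ ps) (suc i) = contents-≤ ps i

  quotient*≤ : ∀ m {n} → 0 ℕ.< n → quotient m n ℕ.* n ℕ.≤ m
  quotient*≤ m {suc n} _ = ℕᵈ.m/n*n≤m m (suc n)

  <[1+quotient]* : ∀ m {n} → 0 ℕ.< n → m ℕ.< suc (quotient m n) ℕ.* n
  <[1+quotient]* m {suc n} _ = ℕₚ.≤-<-trans (ℕₚ.≤-reflexive (ℕᵈ.m≡m%n+[m/n]*n m (suc n))) (ℕₚ.+-monoˡ-< _ (ℕᵈ.m%n<n m (suc n)))

  ≤quotient : ∀ {c} m {n} → 0 ℕ.< n → c ℕ.* n ℕ.≤ m → c ℕ.≤ quotient m n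
  ≤quotient {c} m {n} 0<n cn≤m = ℕₚ.≤-pred (ℕₚ.*-cancelʳ-< n c (suc (quotient m n)) (ℕₚ.≤-<-trans cn≤m (<[1+quotient]* m 0<n)))

  quotient-exact : ∀ c {n} → 0 ℕ.< n → quotient (c ℕ.* n) n ≡ c
  quotient-exact c {suc n} _ = ℕᵈ.m*n/n≡m c (suc n)

  ceiling-lower : ∀ m {n} → 0 ℕ.< n → m ℕ.≤ quotient (m ℕ.+ (n ℕ.∸ 1)) n ℕ.* n
  ceiling-lower m {suc n} 0<n = ℕₚ.+-cancelʳ-≤ (suc n) m _ (ℕₚ.≤-trans (ℕₚ.≤-reflexive (ℕₚ.+-suc m n))
    (ℕₚ.≤-trans (<[1+quotient]* (m ℕ.+ n) 0<n) (ℕₚ.≤-reflexive (ℕₚ.+-comm (suc n) _))))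

  ceiling-upper : ∀ m {n} → 0 ℕ.< n → quotient (m ℕ.+ (n ℕ.∸ 1)) n ℕ.* n ℕ.≤ m ℕ.+ n
  ceiling-upper m {n} 0<n = ℕₚ.≤-trans (quotient*≤ (m ℕ.+ (n ℕ.∸ 1)) 0<n) (ℕₚ.+-monoʳ-≤ m (ℕₚ.m∸n≤m n 1))

  -- The theorem uses one number both as factor and as exponent; the sum of the two required values
  -- serves for both.
  polynomial-bound : ∀ w δ {B E z} → B ℕ.≤ 4 ℕ.* z → E ℕ.≤ z → 1 ℕ.≤ z →
                     w ℕ.* B ℕ.* E ℕ.^ δ ℕ.≤ (4 ℕ.* w ℕ.+ suc δ) ℕ.* z ℕ.^ (4 ℕ.* w ℕ.+ suc δ)
  polynomial-bound w δ {B} {E} {z} B≤4z E≤z 1≤z = begin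
    w ℕ.* B ℕ.* E ℕ.^ δ               ≤⟨ ℕₚ.*-mono-≤ (ℕₚ.*-monoʳ-≤ w B≤4z) (ℕₚ.^-monoˡ-≤ δ E≤z) ⟩
    w ℕ.* (4 ℕ.* z) ℕ.* z ℕ.^ δ       ≡⟨ solve 3 (λ w z x → w :* (con 4 :* z) :* x := (con 4 :* w) :* (z :* x)) ≡.refl w z (z ℕ.^ δ) ⟩
    4 ℕ.* w ℕ.* z ℕ.^ suc δ           ≤⟨ ℕₚ.*-mono-≤ (ℕₚ.m≤m+n (4 ℕ.* w) (suc δ)) (ℕₚ.^-monoʳ-≤ z {{ℕ.>-nonZero 1≤z}} (ℕₚ.m≤n+m (suc δ) (4 ℕ.* w))) ⟩
    (4 ℕ.* w ℕ.+ suc δ) ℕ.* z ℕ.^ (4 ℕ.* w ℕ.+ suc δ) ∎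
    where
    open ℕₚ.≤-Reasoning
    open Data.Nat.Solver.+-*-Solver using (solve; con; _:=_; _:*_)

  -- Abstract, because the powers with this numeral as exponent would be unrolled.
  abstract
    exponent : ℕ
    exponent = 4 ℕ.* weight program ℕ.+ suc (depth program)

    time-bound : ∀ {B E z} → B ℕ.≤ 4 ℕ.* z → E ℕ.≤ z → 1 ℕ.≤ z →
                 weight program ℕ.* B ℕ.* E ℕ.^ depth program ℕ.≤ exponent ℕ.* z ℕ.^ exponent
    time-bound = polynomial-bound (weight program) (depth program)

  module Bounds {d′ : ℕ} (n : ℕ) (q : Vector ℚ (suc d′)) (a : ℚ)
                (0<num : ∀ i → 0 ℕ.< num (q i)) (2≤b : 2 ℕ.≤ quotient (num a) (↧ₙ a) ℕ.∸ 1) where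

    σ₀ : Store
    σ₀ = input n q a

    d : ℕ
    d = suc d′

    open Specification σ₀ using (b; common; speed; rank; selected; fast)

    z ratios β : ℕ
    z      = inputSize n q a
    ratios = jobs (λ i → ratBits (q i))
    -- The largest intermediate values are sums of up to `d` speeds. Each speed is a denominator
    -- times a quotient of the product of the numerators; `d` and these two factors are at most
    -- `2 ^ z` each.
    β      = 3 ℕ.* z

    cellBits : ℕ → ℕ
    cellBits i = bits (σ₀ 1 i) ℕ.+ bits (σ₀ 2 i)

    Σcell≡ : Σ< cellBits d ≡ ratios
    Σcell≡ = ≡.trans (≡.sym (jobs-toℕ d cellBits)) (jobs-cong λ i →
      ≡.cong₂ (λ x y → bits x ℕ.+ bits y) (contents-tabulate (num ∘ q) i) (contents-tabulate (λ i → ↧ₙ (q i)) i))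

    ratios≤z : ratios ℕ.≤ z
    ratios≤z = ℕₚ.m≤n+m ratios (bits n ℕ.+ bits d ℕ.+ ratBits a)

    2^-mono : ∀ {x y} → x ℕ.≤ y → 2 ℕ.^ x ℕ.≤ 2 ℕ.^ y
    2^-mono = ℕₚ.^-monoʳ-≤ 2

    2^* : ∀ x y {u v} → u ℕ.≤ 2 ℕ.^ x → v ℕ.≤ 2 ℕ.^ y → u ℕ.* v ℕ.≤ 2 ℕ.^ (x ℕ.+ y)
    2^* x y u≤ v≤ = ℕₚ.≤-trans (ℕₚ.*-mono-≤ u≤ v≤) (ℕₚ.≤-reflexive (≡.sym (ℕₚ.^-distribˡ-+-* 2 x y)))

    z≤β : z ℕ.≤ β
    z≤β = ℕₚ.m≤m+n z _

    small : ∀ v → bits v ℕ.≤ z → v ℕ.≤ 2 ℕ.^ z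
    small v b≤z = ℕₚ.≤-trans (v≤2^bits v) (2^-mono b≤z)

    bits-n≤z : bits n ℕ.≤ z
    bits-n≤z = ℕₚ.≤-trans (ℕₚ.m≤m+n (bits n) (bits d)) (ℕₚ.≤-trans (ℕₚ.m≤m+n _ (ratBits a)) (ℕₚ.m≤m+n _ ratios))

    bits-d≤z : bits d ℕ.≤ z
    bits-d≤z = ℕₚ.≤-trans (ℕₚ.m≤n+m (bits d) (bits n)) (ℕₚ.≤-trans (ℕₚ.m≤m+n _ (ratBits a)) (ℕₚ.m≤m+n _ ratios))

    ratBits-a≤z : ratBits a ℕ.≤ z
    ratBits-a≤z = ℕₚ.≤-trans (ℕₚ.m≤n+m (ratBits a) (bits n ℕ.+ bits d)) (ℕₚ.m≤m+n _ ratios)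

    ratBits-q≤z : ∀ i → ratBits (q i) ℕ.≤ z
    ratBits-q≤z i = ℕₚ.≤-trans (ℕₚ.≤-trans (ℕₚ.≤-reflexive (≡.sym (≡.cong₂ (λ x y → bits x ℕ.+ bits y) (contents-tabulate (num ∘ q) i) (contents-tabulate (λ i → ↧ₙ (q i)) i))))
      (ℕₚ.≤-trans (term≤Σ< cellBits (Finₚ.toℕ<n i)) (ℕₚ.≤-reflexive Σcell≡))) ratios≤z

    num-bound : ∀ {q} → ratBits q ℕ.≤ z → num q ℕ.≤ 2 ℕ.^ z
    num-bound {q} r≤z = small (num q) (ℕₚ.≤-trans (ℕₚ.m≤m+n (bits (num q)) (bits (↧ₙ q))) r≤z)

    den-bound : ∀ {q} → ratBits q ℕ.≤ z → ↧ₙ q ℕ.≤ 2 ℕ.^ z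
    den-bound {q} r≤z = small (↧ₙ q) (ℕₚ.≤-trans (ℕₚ.m≤n+m (bits (↧ₙ q)) (bits (num q))) r≤z)

    input-bound : ∀ A i → σ₀ A i ℕ.≤ 2 ℕ.^ z
    input-bound 0 = contents-≤ (small n bits-n≤z ∷ small d bits-d≤z ∷ num-bound {a} ratBits-a≤z ∷ den-bound {a} ratBits-a≤z ∷ [])
    input-bound 1 = contents-≤ (Allₚ.tabulate⁺ λ i → num-bound {q i} (ratBits-q≤z i))
    input-bound 2 = contents-≤ (Allₚ.tabulate⁺ λ i → den-bound {q i} (ratBits-q≤z i))
    input-bound (suc (suc (suc A))) = contents-≤ []

    bounded₀ : ∀ A i → σ₀ A i ℕ.≤ 2 ℕ.^ β
    bounded₀ A i = ℕₚ.≤-trans (input-bound A i) (2^-mono z≤β)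

    0<z : 0 ℕ.< z
    0<z = ℕₚ.≤-trans (s≤s z≤n) bits-n≤z

    0<β : 0 ℕ.< β
    0<β = ℕₚ.≤-trans 0<z z≤β

    common≤2^z : ∀ m → m ℕ.≤ d → common m ℕ.≤ 2 ℕ.^ z
    common≤2^z m m≤d = ℕₚ.≤-trans
      (Π<-≤2^ {g = cellBits} m (λ i → ℕₚ.≤-trans (v≤2^bits (σ₀ 1 i)) (2^-mono (ℕₚ.m≤m+n (bits (σ₀ 1 i)) (bits (σ₀ 2 i))))))
      (2^-mono (ℕₚ.≤-trans (Σ<-monoʳ cellBits m≤d) (ℕₚ.≤-trans (ℕₚ.≤-reflexive Σcell≡) ratios≤z)))

    common≤ : ∀ m → m ℕ.≤ d → common m ℕ.≤ 2 ℕ.^ β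
    common≤ m m≤d = ℕₚ.≤-trans (common≤2^z m m≤d) (2^-mono z≤β)

    speed≤2^2z : ∀ i → speed i ℕ.≤ 2 ℕ.^ (z ℕ.+ z)
    speed≤2^2z i = 2^* z z (input-bound 2 i) (ℕₚ.≤-trans (quotient≤ (common d) (σ₀ 1 i)) (common≤2^z d ℕₚ.≤-refl))

    2z≤β : z ℕ.+ z ℕ.≤ β
    2z≤β = ℕₚ.+-monoʳ-≤ z (ℕₚ.m≤m+n z _)

    speed≤ : ∀ i → i ℕ.< d → speed i ℕ.≤ 2 ℕ.^ β
    speed≤ i _ = ℕₚ.≤-trans (speed≤2^2z i) (2^-mono 2z≤β)

    fast≤1 : ∀ k i → fast k i ℕ.≤ 1
    fast≤1 k i = ℕₚ.m∸n≤m 1 ((rank i ℕ.+ 1) ℕ.∸ k)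

    selected≤ : ∀ k m → m ℕ.≤ d → Σ< (selected k) m ℕ.≤ 2 ℕ.^ β
    selected≤ k m m≤d = ℕₚ.≤-trans
      (Σ<-≤* m (λ i _ → ℕₚ.≤-trans (ℕₚ.*-mono-≤ (speed≤2^2z i) (fast≤1 k i)) (ℕₚ.≤-reflexive (ℕₚ.*-identityʳ _))))
      (ℕₚ.≤-trans (2^* z (z ℕ.+ z) (ℕₚ.≤-trans m≤d (small d bits-d≤z)) ℕₚ.≤-refl)
        (ℕₚ.≤-reflexive (≡.cong (λ x → 2 ℕ.^ (z ℕ.+ (z ℕ.+ x))) (≡.sym (ℕₚ.+-identityʳ z)))))

    b*d≤ : b ℕ.* d ℕ.≤ 2 ℕ.^ β
    b*d≤ = ℕₚ.≤-trans
      (2^* z z (ℕₚ.≤-trans (ℕₚ.m∸n≤m _ 1) (ℕₚ.≤-trans (quotient≤ (num a) (↧ₙ a)) (num-bound {a} ratBits-a≤z))) (small d bits-d≤z))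
      (2^-mono 2z≤β)

    open Specification.Correctness σ₀ β 0<β bounded₀ common≤ speed≤ selected≤ b*d≤ 2≤b z<s (λ i → ≡.refl) (λ i → ≡.refl) public
      using (Result; run-program)

    -- Every processing time takes at least one bit of the input, and so does `n`.
    E≤z : suc d ℕ.≤ z
    E≤z = ℕₚ.≤-trans (s≤s (ℕₚ.≤-trans d≤Σ (ℕₚ.≤-reflexive Σcell≡))) (ℕₚ.+-monoˡ-≤ ratios (s≤s z≤n))
      where
      m≤Σ : ∀ m → m ℕ.≤ Σ< cellBits m
      m≤Σ zero    = z≤n
      m≤Σ (suc m) = ℕₚ.≤-trans (ℕₚ.≤-reflexive (ℕₚ.+-comm 1 m)) (ℕₚ.+-mono-≤ (m≤Σ m) (s≤s z≤n))
      d≤Σ : d ℕ.≤ Σ< cellBits d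
      d≤Σ = m≤Σ d

    B≤4z : suc β ℕ.≤ 4 ℕ.* z
    B≤4z = ℕₚ.+-monoˡ-≤ β 0<z

    execution : ∃₂ λ t s → Run (compile program) σ₀ t s × t ℕ.≤ exponent ℕ.* z ℕ.^ exponent × Result s
    execution = conclude run-program
      where
      open Execution β 0<β d (bounded₀ 0 1)

      conclude : Exec program σ₀ Result → ∃₂ λ t s → Run (compile program) σ₀ t s × t ℕ.≤ exponent ℕ.* z ℕ.^ exponent × Result s
      conclude (exec r t≤ _ res) = _ , _ , r , ℕₚ.≤-trans t≤ (time-bound B≤4z E≤z 0<z) , res

-- The schedules that the program specifies.

module SpecifiedSchedules {d′ : ℕ} (n : ℕ) (q : Vector ℚ (suc d′)) (a : ℚ) (0<num : ∀ i → 0 ℕ.< Machine.num (q i)) where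
  open Machine
  open PortfolioProgram
  open ProgramCorrectness

  open Specification (input n q a) hiding (n)

  num≡ : ∀ (i : Fin d) → input n q a 1 (toℕ i) ≡ num (q i)
  num≡ = contents-tabulate (num ∘ q)

  den≡ : ∀ (i : Fin d) → input n q a 2 (toℕ i) ≡ ↧ₙ (q i)
  den≡ = contents-tabulate (λ i → ↧ₙ (q i))

  0<input₁ : ∀ i → i ℕ.< d → 0 ℕ.< input n q a 1 i
  0<input₁ i i<d = ≡.subst (λ j → 0 ℕ.< input n q a 1 j) (Finₚ.toℕ-fromℕ< i<d)
    (≡.subst (0 ℕ.<_) (≡.sym (num≡ (fromℕ< i<d))) (0<num (fromℕ< i<d)))

  0<common : 0 ℕ.< common d
  0<common = Π<-pos d 0<input₁

  cofactor : Fin d → ℕ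
  cofactor i = quotient (common d) (num (q i))

  cofactor*num : ∀ i → cofactor i ℕ.* num (q i) ≡ common d
  cofactor*num i = exact (Π<-multiple (input n q a 1) (Finₚ.toℕ<n i))
    where
    exact : (∃ λ c → common d ≡ c ℕ.* input n q a 1 (toℕ i)) → cofactor i ℕ.* num (q i) ≡ common d
    exact (c , eq) = ≡.trans (≡.cong (ℕ._* num (q i)) (≡.trans (≡.cong (λ x → quotient x (num (q i))) eq′) (quotient-exact c (0<num i)))) (≡.sym eq′)
      where
      eq′ : common d ≡ c ℕ.* num (q i)
      eq′ = ≡.trans eq (≡.cong (c ℕ.*_) (num≡ i))

  speed≡ : ∀ i → speed (toℕ i) ≡ ↧ₙ (q i) ℕ.* cofactor i
  speed≡ i = ≡.cong₂ (λ x y → x ℕ.* quotient (common d) y) (den≡ i) (num≡ i)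

  0<speed : ∀ (i : Fin d) → 0 ℕ.< speed (toℕ i)
  0<speed i = ≡.subst (0 ℕ.<_) (≡.sym (speed≡ i)) (ℕₚ.*-mono-≤ {1} {↧ₙ (q i)} {1} (s≤s z≤n) (ℕₚ.n≢0⇒n>0 λ c≡0 →
    ℕₚ.<⇒≢ 0<common (≡.trans (≡.cong (ℕ._* num (q i)) (≡.sym c≡0)) (cofactor*num i))))

  -- Keys are ordered lexicographically by speed and index, because an index below `d` cannot
  -- outweigh a difference in speed.
  key≤⇒speed≤ : ∀ {i j} → i ℕ.< d → key j ℕ.≤ key i → speed j ℕ.≤ speed i
  key≤⇒speed≤ {i} {j} i<d keyⱼ≤keyᵢ = ℕₚ.≮⇒≥ λ sᵢ<sⱼ → ℕₚ.<⇒≱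
    (ℕₚ.<-≤-trans (ℕₚ.+-monoʳ-< (speed i ℕ.* d) i<d)
      (ℕₚ.≤-trans (ℕₚ.≤-reflexive (ℕₚ.+-comm (speed i ℕ.* d) d)) (ℕₚ.≤-trans (ℕₚ.*-monoˡ-≤ d sᵢ<sⱼ) (ℕₚ.m≤m+n (speed j ℕ.* d) j)))) keyⱼ≤keyᵢ

  key-injective : ∀ {i j} → i ℕ.< d → j ℕ.< d → key i ≡ key j → i ≡ j
  key-injective {i} {j} i<d j<d eq = ℕₚ.+-cancelˡ-≡ (speed i ℕ.* d) i j
    (≡.trans eq (≡.cong (λ s → s ℕ.* d ℕ.+ j) (ℕₚ.≤-antisym (key≤⇒speed≤ {i} {j} i<d (ℕₚ.≤-reflexive (≡.sym eq))) (key≤⇒speed≤ {j} {i} j<d (ℕₚ.≤-reflexive eq)))))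

  private module S = SortingPermutation (Flip.decTotalOrder ℕₚ.≤-decTotalOrder)

  σ : Permutation′ d
  σ = S.σ (key ∘ toℕ)

  machine : Fin d → ℕ
  machine r = toℕ (σ ⟨$⟩ʳ r)

  machine<d : ∀ r → machine r ℕ.< d
  machine<d r = Finₚ.toℕ<n (σ ⟨$⟩ʳ r)

  key-≤ : ∀ r r′ → r Fin.≤ r′ → key (machine r′) ℕ.≤ key (machine r)
  key-≤ = S.σ-sorted (key ∘ toℕ)

  key-< : ∀ r r′ → r Fin.< r′ → key (machine r′) ℕ.< key (machine r)
  key-< r r′ r<r′ = ℕₚ.≤∧≢⇒< (key-≤ r r′ (ℕₚ.<⇒≤ r<r′)) λ eq →
    ℕₚ.<⇒≢ r<r′ (≡.cong toℕ (≡.sym (permutation-injective σ (Finₚ.toℕ-injective (key-injective {machine r′} {machine r} (machine<d r′) (machine<d r) eq)))))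

  spread-< : ∀ {k} (r : Fin d) → toℕ r ℕ.< k → spread k 1 r ≡ 1
  spread-< {k} r r<k with toℕ r <ᵇ k | ℕₚ.<⇒<ᵇ r<k
  ... | true | _ = ≡.refl

  spread-≥ : ∀ {k} (r : Fin d) → k ℕ.≤ toℕ r → spread k 1 r ≡ 0
  spread-≥ {k} r k≤r with toℕ r <ᵇ k | ℕₚ.<ᵇ⇒< (toℕ r) k
  ... | false | _ = ≡.refl
  ... | true  | p = contradiction (p tt) (ℕₚ.≤⇒≯ k≤r)

  1∸[1∸pos] : ∀ {x} → 0 ℕ.< x → 1 ℕ.∸ (1 ℕ.∸ x) ≡ 1
  1∸[1∸pos] {suc x} _ = ≡.cong (1 ℕ.∸_) (ℕₚ.0∸n≡0 x)

  faster-σ : ∀ r r′ → faster (machine r) (machine r′) ≡ spread (toℕ r) 1 r′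
  faster-σ r r′ = case toℕ r′ ℕₚ.<? toℕ r of λ where
    (yes r′<r) → ≡.trans (1∸[1∸pos] (ℕₚ.m<n⇒0<n∸m (key-< r′ r r′<r))) (≡.sym (spread-< r′ r′<r))
    (no  r′≮r) → ≡.trans (≡.cong (λ x → 1 ℕ.∸ (1 ℕ.∸ x)) (ℕₚ.m≤n⇒m∸n≡0 (key-≤ r r′ (ℕₚ.≮⇒≥ r′≮r)))) (≡.sym (spread-≥ r′ (ℕₚ.≮⇒≥ r′≮r)))

  -- Keys strictly decrease along `σ`, so exactly the `r` machines before position `r` are counted
  -- as faster. Ranking by counting thus agrees with the sorting permutation.
  rank-σ : ∀ r → rank (machine r) ≡ toℕ r
  rank-σ r = begin
    Σ< (faster (machine r)) d                               ≡⟨ jobs-toℕ d (faster (machine r)) ⟨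
    jobs {d} (faster (machine r) ∘ toℕ)                     ≡⟨ jobs-permute (faster (machine r) ∘ toℕ) σ ⟨
    jobs (λ r′ → faster (machine r) (machine r′))           ≡⟨ jobs-cong (faster-σ r) ⟩
    jobs {d} (spread (toℕ r) 1)                             ≡⟨ jobs-spread 1 (ℕₚ.<⇒≤ (Finₚ.toℕ<n r)) ⟩
    toℕ r ℕ.* 1                                             ≡⟨ ℕₚ.*-identityʳ _ ⟩
    toℕ r                                                   ∎
    where open ≡.≡-Reasoning

  fast-< : ∀ {k} r → toℕ r ℕ.< k → fast k (machine r) ≡ 1
  fast-< {k} r r<k = ≡.cong (1 ℕ.∸_) (ℕₚ.m≤n⇒m∸n≡0 (ℕₚ.≤-trans (ℕₚ.≤-reflexive (≡.trans (ℕₚ.+-comm _ 1) (≡.cong suc (rank-σ r)))) r<k))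

  fast-≥ : ∀ {k} r → k ℕ.≤ toℕ r → fast k (machine r) ≡ 0
  fast-≥ {k} r k≤r = ℕₚ.m≤n⇒m∸n≡0 (ℕₚ.m<n⇒0<n∸m (ℕₚ.≤-trans (s≤s k≤r) (ℕₚ.≤-reflexive (≡.sym (≡.trans (ℕₚ.+-comm _ 1) (≡.cong suc (rank-σ r)))))))

  total-speed : ℕ → ℕ
  total-speed k = Σ< (selected k) d

  0<total-speed : ∀ {k} → 0 ℕ.< k → 0 ℕ.< total-speed k
  0<total-speed {k} 0<k = ℕₚ.<-≤-trans
    (≡.subst (0 ℕ.<_) (≡.sym (≡.trans (≡.cong (speed (machine zero) ℕ.*_) (fast-< zero 0<k)) (ℕₚ.*-identityʳ _))) (0<speed (σ ⟨$⟩ʳ zero)))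
    (term≤Σ< (selected k) (machine<d zero))

  -- Multiplied by the total speed, each quota covers `n` times the speed of its machine if that
  -- machine is selected.
  n≤Σquota : ∀ {k} → 0 ℕ.< k → n ℕ.≤ Σ< (quota k) d
  n≤Σquota {k} 0<k = ℕₚ.*-cancelʳ-≤ n _ (total-speed k) {{ℕ.>-nonZero (0<total-speed 0<k)}} (begin
    n ℕ.* total-speed k                         ≡⟨ Σ<-*ˡ n (selected k) d ⟩
    Σ< (λ i → n ℕ.* selected k i) d             ≤⟨ Σ<-mono d (λ i _ → pointwise i) ⟩
    Σ< (λ i → quota k i ℕ.* total-speed k) d    ≡⟨ Σ<-*ʳ (total-speed k) (quota k) d ⟨
    Σ< (quota k) d ℕ.* total-speed k            ∎)
    where
    open ℕₚ.≤-Reasoning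

    w : ℕ → ℕ
    w i = quotient (n ℕ.* speed i ℕ.+ (total-speed k ℕ.∸ 1)) (total-speed k)

    pointwise : ∀ i → n ℕ.* selected k i ℕ.≤ quota k i ℕ.* total-speed k
    pointwise i = begin
      n ℕ.* (speed i ℕ.* fast k i)              ≡⟨ ≡.trans (≡.sym (ℕₚ.*-assoc n (speed i) (fast k i))) (ℕₚ.*-comm (n ℕ.* speed i) (fast k i)) ⟩
      fast k i ℕ.* (n ℕ.* speed i)              ≤⟨ ℕₚ.*-monoʳ-≤ (fast k i) (ceiling-lower (n ℕ.* speed i) (0<total-speed 0<k)) ⟩
      fast k i ℕ.* (w i ℕ.* total-speed k)      ≡⟨ ℕₚ.*-assoc (fast k i) (w i) (total-speed k) ⟨
      quota k i ℕ.* total-speed k               ∎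

  -- Jobs given out and jobs remaining always add up to `n`, and by `n≤Σquota` none remain at the
  -- end.
  Σgiven : ∀ {k} → 0 ℕ.< k → Σ< (given k) d ≡ n
  Σgiven {k} 0<k = ≡.trans (≡.sym (ℕₚ.+-identityʳ _))
    (≡.trans (≡.cong (Σ< (given k) d ℕ.+_) (≡.sym (ℕₚ.m≤n⇒m∸n≡0 (n≤Σquota 0<k)))) (telescope d))
    where
    telescope : ∀ m → Σ< (given k) m ℕ.+ remaining k m ≡ n
    telescope zero    = ≡.refl
    telescope (suc m) = begin
      Σ< (given k) m ℕ.+ given k m ℕ.+ remaining k (suc m)  ≡⟨ ℕₚ.+-assoc (Σ< (given k) m) (given k m) (remaining k (suc m)) ⟩
      Σ< (given k) m ℕ.+ (given k m ℕ.+ remaining k (suc m)) ≡⟨ ≡.cong (λ x → Σ< (given k) m ℕ.+ (given k m ℕ.+ x)) (ℕₚ.∸-+-assoc n (Σ< (quota k) m) (quota k m)) ⟨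
      Σ< (given k) m ℕ.+ (given k m ℕ.+ (remaining k m ℕ.∸ quota k m)) ≡⟨ ≡.cong (Σ< (given k) m ℕ.+_) (ℕₚ.m∸n+n≡m (ℕₚ.m∸n≤m (remaining k m) (quota k m))) ⟩
      Σ< (given k) m ℕ.+ remaining k m                      ≡⟨ telescope m ⟩
      n                                                     ∎
      where open ≡.≡-Reasoning

  given≤quota : ∀ k i → given k i ℕ.≤ quota k i
  given≤quota k i = ℕₚ.m≤n+o⇒m∸n≤o (remaining k i) (remaining k i ℕ.∸ quota k i)
    (ℕₚ.≤-trans (ℕₚ.m≤n+m∸n (remaining k i) (quota k i)) (ℕₚ.≤-reflexive (ℕₚ.+-comm (quota k i) _)))

  quota-≥ : ∀ {k} r → k ℕ.≤ toℕ r → quota k (machine r) ≡ 0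
  quota-≥ {k} r k≤r = ≡.cong (ℕ._* quotient (n ℕ.* speed (machine r) ℕ.+ (total-speed k ℕ.∸ 1)) (total-speed k)) (fast-≥ r k≤r)

  quota*total-speed≤ : ∀ {k} r → toℕ r ℕ.< k → quota k (machine r) ℕ.* total-speed k ℕ.≤ n ℕ.* speed (machine r) ℕ.+ total-speed k
  quota*total-speed≤ {k} r r<k = ℕₚ.≤-trans
    (ℕₚ.≤-reflexive (≡.cong (ℕ._* total-speed k) (≡.trans (≡.cong (ℕ._* w) (fast-< r r<k)) (ℕₚ.*-identityˡ w))))
    (ceiling-upper (n ℕ.* speed (machine r)) (0<total-speed (ℕₚ.≤-<-trans z≤n r<k)))
    where
    w : ℕ
    w = quotient (n ℕ.* speed (machine r) ℕ.+ (total-speed k ℕ.∸ 1)) (total-speed k)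

-- The output of the program as a portfolio.

module ProgramPortfolio (R : RealField) (L : NaturalLog R) where
  open RealField R hiding (zero)
  open OrderedField R
  open Rearrangement R
  open PrefixSums R
  open Portfolios R L
  open SortedMachines R L
  open Construction R L
  open Existence R L using (≤b+2⇒≤4b)
  open Machine
  open CountedPrograms
  open PortfolioProgram
  open ProgramCorrectness
  open Solver using (solve; con; _:=_; _:+_; _:*_; _:-_)
  open ≤-Reasoning

  positive-fraction : ∀ q → 0# < fromℚ q → 0 ℕ.< num q × fromℕ (↧ₙ q) * fromℚ q ≈ fromℕ (num q)
  positive-fraction q 0<q = go (↥ q) (numerator-pos 0<q) (x*y/x (fromℤ (↥ q)) 0<den)
    where
    0<den : 0# < fromℕ (↧ₙ q)
    0<den = fromℕ-pos {↧ₙ q} (s≤s z≤n)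

    numerator-pos : 0# < fromℚ q → 0# < fromℤ (↥ q)
    numerator-pos 0<q = <-respʳ-≈ (x*y/x (fromℤ (↥ q)) 0<den) (*-pos 0<den 0<q)

    go : ∀ z → 0# < fromℤ z → fromℕ (↧ₙ q) * fromℚ q ≈ fromℤ z → 0 ℕ.< ℤ.∣ z ∣ × fromℕ (↧ₙ q) * fromℚ q ≈ fromℕ ℤ.∣ z ∣
    go (+ zero)  0<z eq = contradiction 0<z <-irrefl
    go (+ suc m) 0<z eq = z<s , eq
    go -[1+ m ]  0<z eq = contradiction 0<z (≤⇒≯ (≤-respʳ-≈ -0#≈0# (neg-mono-≤ (fromℕ-nonNegative (suc m)))))

  module _ {d′} (I : MLIJ (suc d′)) {α} (4<α : fromℕ 4 < α) (q : Vector ℚ (suc d′)) (a : ℚ)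
           (p≈q : ∀ i → MLIJ.p I i ≈ fromℚ (q i)) (α≈a : α ≈ fromℚ a) where
    open MLIJ I

    private
      0<num : ∀ i → 0 ℕ.< num (q i)
      0<num i = proj₁ (positive-fraction (q i) (<-respʳ-≈ (p≈q i) (p>0 i)))

      den*p≈num : ∀ i → fromℕ (↧ₙ (q i)) * p i ≈ fromℕ (num (q i))
      den*p≈num i = trans (*-congˡ (p≈q i)) (proj₂ (positive-fraction (q i) (<-respʳ-≈ (p≈q i) (p>0 i))))

      0<α = <-≤-trans (fromℕ-pos {4} z<s) (<⇒≤ 4<α)

      den-a num-a floor b : ℕ
      den-a = ↧ₙ a
      num-a = num a
      floor = quotient num-a den-a
      b     = floor ℕ.∸ 1

      0<den-a : 0 ℕ.< den-a
      0<den-a = s≤s z≤n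

      den*α≈num : fromℕ den-a * α ≈ fromℕ num-a
      den*α≈num = trans (*-congˡ α≈a) (proj₂ (positive-fraction a (<-respʳ-≈ α≈a 0<α)))

      4≤floor : 4 ℕ.≤ floor
      4≤floor = ≤quotient num-a 0<den-a (fromℕ-cancel-≤ (begin
        fromℕ (4 ℕ.* den-a)       ≈⟨ fromℕ-* 4 den-a ⟩
        fromℕ 4 * fromℕ den-a     ≤⟨ *-monoʳ-≤ _ (fromℕ-nonNegative den-a) (<⇒≤ 4<α) ⟩
        α * fromℕ den-a           ≈⟨ *-comm _ _ ⟩
        fromℕ den-a * α           ≈⟨ den*α≈num ⟩
        fromℕ num-a               ∎))

      1+b≡floor : suc b ≡ floor
      1+b≡floor = ℕₚ.m+[n∸m]≡n (ℕₚ.≤-trans (s≤s z≤n) 4≤floor)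

      3≤b : 3 ℕ.≤ b
      3≤b = ℕₚ.∸-monoˡ-≤ 1 4≤floor

      2≤b : 2 ℕ.≤ b
      2≤b = ℕₚ.≤-trans (ℕₚ.n≤1+n 2) 3≤b

      b+1≤α : fromℕ (suc b) ≤ α
      b+1≤α = *-cancelˡ-≤ (fromℕ-pos 0<den-a) (begin
        fromℕ den-a * fromℕ (suc b)   ≡⟨ ≡.cong (λ x → fromℕ den-a * fromℕ x) 1+b≡floor ⟩
        fromℕ den-a * fromℕ floor     ≈⟨ trans (*-comm _ _) (sym (fromℕ-* floor den-a)) ⟩
        fromℕ (floor ℕ.* den-a)       ≤⟨ fromℕ-mono-≤ (quotient*≤ num-a 0<den-a) ⟩
        fromℕ num-a                   ≈⟨ den*α≈num ⟨
        fromℕ den-a * α               ∎)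

      α≤b+2 : α ≤ fromℕ (suc (suc b))
      α≤b+2 = *-cancelˡ-≤ (fromℕ-pos 0<den-a) (begin
        fromℕ den-a * α                     ≈⟨ den*α≈num ⟩
        fromℕ num-a                         ≤⟨ fromℕ-mono-≤ (ℕₚ.<⇒≤ (<[1+quotient]* num-a 0<den-a)) ⟩
        fromℕ (suc floor ℕ.* den-a)         ≈⟨ trans (fromℕ-* (suc floor) den-a) (*-comm _ _) ⟩
        fromℕ den-a * fromℕ (suc floor)     ≡⟨ ≡.cong (λ x → fromℕ den-a * fromℕ (suc x)) 1+b≡floor ⟨
        fromℕ den-a * fromℕ (suc (suc b))   ∎)

      module Spec = Specification (input n q a)
      open SpecifiedSchedules n q a 0<num

      A : Carrier
      A = fromℕ (Spec.common (suc d′))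

      0<A : 0# < A
      0<A = fromℕ-pos 0<common

      -- The integral speeds are the speeds `1 / p i` scaled by one common factor, so shares and
      -- order are those of the instance.
      speed*p≈A : ∀ i → fromℕ (Spec.speed (toℕ i)) * p i ≈ A
      speed*p≈A i = begin-equality
        fromℕ (Spec.speed (toℕ i)) * p i                       ≡⟨ ≡.cong (λ x → fromℕ x * p i) (speed≡ i) ⟩
        fromℕ (↧ₙ (q i) ℕ.* cofactor i) * p i                  ≈⟨ *-congʳ (fromℕ-* (↧ₙ (q i)) (cofactor i)) ⟩
        (fromℕ (↧ₙ (q i)) * fromℕ (cofactor i)) * p i          ≈⟨ solve 3 (λ d c p → (d :* c) :* p := c :* (d :* p)) refl (fromℕ (↧ₙ (q i))) (fromℕ (cofactor i)) (p i) ⟩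
        fromℕ (cofactor i) * (fromℕ (↧ₙ (q i)) * p i)          ≈⟨ *-congˡ (den*p≈num i) ⟩
        fromℕ (cofactor i) * fromℕ (num (q i))                 ≈⟨ fromℕ-* (cofactor i) (num (q i)) ⟨
        fromℕ (cofactor i ℕ.* num (q i))                       ≡⟨ ≡.cong fromℕ (cofactor*num i) ⟩
        A                                                      ∎

      p↗ : ∀ i j → i Fin.≤ j → p (σ ⟨$⟩ʳ i) ≤ p (σ ⟨$⟩ʳ j)
      p↗ i j i≤j = *-cancelˡ-≤ (fromℕ-pos (0<speed (σ ⟨$⟩ʳ j))) (begin
        fromℕ (Spec.speed (machine j)) * p (σ ⟨$⟩ʳ i)   ≤⟨ *-monoʳ-≤ _ (<⇒≤ (p>0 _)) (fromℕ-mono-≤ (key≤⇒speed≤ {machine i} {machine j} (machine<d i) (key-≤ i j i≤j))) ⟩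
        fromℕ (Spec.speed (machine i)) * p (σ ⟨$⟩ʳ i)   ≈⟨ trans (speed*p≈A (σ ⟨$⟩ʳ i)) (sym (speed*p≈A (σ ⟨$⟩ʳ j))) ⟩
        fromℕ (Spec.speed (machine j)) * p (σ ⟨$⟩ʳ j)   ∎)

      -- The integral total speed is `A * S κ`. Multiplied by it, the estimate of the rounded-up
      -- quota becomes the bound by `level κ` plus one job.
      balanced : ∀ κ (m : Vector ℕ (suc d′)) → (∀ i → m i ≡ Spec.given (suc (toℕ κ)) (toℕ i)) → BalancedSchedule I σ p↗ κ m
      balanced κ m m≡ 0<n r = ≤-trans (*-monoʳ-≤ (P I σ p↗ r) (<⇒≤ (p>0 _)) (fromℕ-mono-≤
          (ℕₚ.≤-trans (ℕₚ.≤-reflexive (m≡ (σ ⟨$⟩ʳ r))) (given≤quota k (machine r)))))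
          (case toℕ r ℕₚ.<? k of λ where
            (no r≮k) → ≤-reflexive (trans
              (trans (*-congʳ (reflexive (≡.cong fromℕ (quota-≥ r (ℕₚ.≮⇒≥ r≮k))))) (zeroˡ _))
              (sym (trans (*-congʳ (reflexive (indicator-≥ {i = r} (ℕₚ.≮⇒≥ r≮k)))) (zeroˡ _))))
            (yes r<k) → ≤-respʳ-≈ (sym (trans (*-congʳ (reflexive (indicator-< {i = r} r<k))) (*-identityˡ _)))
              (*-cancelˡ-≤ (*-pos 0<A (0<S κ)) (begin
                (A * S κ) * (fromℕ (Spec.quota k (machine r)) * pᵣ)   ≈⟨ *-congʳ total-speed≈ ⟨
                C * (fromℕ (Spec.quota k (machine r)) * pᵣ)           ≈⟨ solve 3 (λ C w p → C :* (w :* p) := (w :* C) :* p) refl C (fromℕ (Spec.quota k (machine r))) pᵣ ⟩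
                (fromℕ (Spec.quota k (machine r)) * C) * pᵣ           ≈⟨ *-congʳ (fromℕ-* (Spec.quota k (machine r)) (total-speed k)) ⟨
                fromℕ (Spec.quota k (machine r) ℕ.* total-speed k) * pᵣ ≤⟨ *-monoʳ-≤ pᵣ (<⇒≤ (p>0 _)) (fromℕ-mono-≤ (quota*total-speed≤ r r<k)) ⟩
                fromℕ (n ℕ.* Spec.speed (machine r) ℕ.+ total-speed k) * pᵣ ≈⟨ *-congʳ (trans (fromℕ-+ (n ℕ.* Spec.speed (machine r)) (total-speed k)) (+-congʳ (fromℕ-* n (Spec.speed (machine r))))) ⟩
                (fromℕ n * fromℕ (Spec.speed (machine r)) + C) * pᵣ   ≈⟨ solve 4 (λ n s C p → (n :* s :+ C) :* p := n :* (s :* p) :+ C :* p) refl (fromℕ n) (fromℕ (Spec.speed (machine r))) C pᵣ ⟩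
                fromℕ n * (fromℕ (Spec.speed (machine r)) * pᵣ) + C * pᵣ ≈⟨ +-cong (*-cong (sym (x*y/x (fromℕ n) (0<S κ))) (speed*p≈A (σ ⟨$⟩ʳ r))) (*-congʳ total-speed≈) ⟩
                (S κ * level κ) * A + (A * S κ) * pᵣ                  ≈⟨ solve 4 (λ S l A p → (S :* l) :* A :+ (A :* S) :* p := (A :* S) :* (l :+ p)) refl (S κ) (level κ) A pᵣ ⟩
                (A * S κ) * (level κ + pᵣ)                            ∎)))
        where
        open Machines (P I σ p↗) (0<P I σ p↗) p↗ 0<n

        k : ℕ
        k = suc (toℕ κ)

        C pᵣ : Carrier
        C  = fromℕ (total-speed k)
        pᵣ = p (σ ⟨$⟩ʳ r)

        speed≈A*Q : ∀ r → fromℕ (Spec.speed (machine r)) ≈ A * Q r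
        speed≈A*Q r = begin-equality
          fromℕ (Spec.speed (machine r))                         ≈⟨ *-identityʳ _ ⟨
          fromℕ (Spec.speed (machine r)) * 1#                    ≈⟨ *-congˡ (⁻¹-inverseʳ _ (pos≉0 (p>0 _))) ⟨
          fromℕ (Spec.speed (machine r)) * (p (σ ⟨$⟩ʳ r) * Q r)  ≈⟨ *-assoc _ _ _ ⟨
          (fromℕ (Spec.speed (machine r)) * p (σ ⟨$⟩ʳ r)) * Q r  ≈⟨ *-congʳ (speed*p≈A (σ ⟨$⟩ʳ r)) ⟩
          A * Q r                                                ∎

        fast≈indicator : ∀ r → fromℕ (Spec.fast k (machine r)) ≈ initial κ r
        fast≈indicator r = case toℕ r ℕₚ.<? k of λ where
          (yes r<k) → trans (reflexive (≡.cong fromℕ (fast-< r r<k))) (trans (+-identityʳ 1#) (reflexive (≡.sym (indicator-< {i = r} r<k))))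
          (no  r≮k) → trans (reflexive (≡.cong fromℕ (fast-≥ r (ℕₚ.≮⇒≥ r≮k)))) (reflexive (≡.sym (indicator-≥ {i = r} (ℕₚ.≮⇒≥ r≮k))))

        total-speed≈ : C ≈ A * S κ
        total-speed≈ = begin-equality
          fromℕ (Σ< (Spec.selected k) (suc d′))                         ≡⟨ ≡.cong fromℕ (jobs-toℕ (suc d′) (Spec.selected k)) ⟨
          fromℕ (jobs {suc d′} (Spec.selected k ∘ toℕ))                 ≡⟨ ≡.cong fromℕ (jobs-permute (Spec.selected k ∘ toℕ) σ) ⟨
          fromℕ (jobs (Spec.selected k ∘ machine))                      ≈⟨ fromℕ-sum (Spec.selected k ∘ machine) ⟩
          sum (λ r → fromℕ (Spec.selected k (machine r)))               ≈⟨ sum-cong-≋ (λ r → trans (fromℕ-* (Spec.speed (machine r)) (Spec.fast k (machine r)))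
                                                                            (trans (*-cong (speed≈A*Q r) (fast≈indicator r)) (trans (*-assoc A (Q r) (initial κ r)) (*-congˡ (*-comm (Q r) (initial κ r)))))) ⟩
          sum (λ r → A * (initial κ r * Q r))                           ≈⟨ *-distribˡ-sum A (λ r → initial κ r * Q r) ⟨
          A * S κ                                                       ∎

    open Bounds n q a 0<num 2≤b using (Result; execution)

    goodOutput : ∀ {s} → Result s → IsGoodPortfolio 1# I α (map loads (output (suc d′) s))
    goodOutput {s} res = isGoodPortfolio I σ p↗ 4<α 2≤b b+1≤α (inj₂ (≤b+2⇒≤4b 3≤b α≤b+2)) bᴱ≤d d<bᴱ⁺¹
        (output (suc d′) s) (≡.trans (length-applyUpTo schedule (s 3 0)) count)
        (Allₚ.applyUpTo⁺₁ schedule (s 3 0) λ {e} e<count → isSchedule e (e≤E e<count))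
        λ e κ e≤E κ≡bᵉ → schedule e , ∈ₚ.∈-applyUpTo⁺ schedule (≡.subst (e ℕ.<_) (≡.sym count) (s≤s e≤E)) ,
          balanced κ (schedule e) (λ i → ≡.trans (written e e≤E (toℕ i) (Finₚ.toℕ<n i)) (≡.cong (λ k → Spec.given k (toℕ i)) (≡.sym κ≡bᵉ)))
      where
      open Result res

      schedule : ℕ → Vector ℕ (suc d′)
      schedule e i = s 4 (e ℕ.* suc d′ ℕ.+ toℕ i)

      e≤E : ∀ {e} → e ℕ.< s 3 0 → e ℕ.≤ E
      e≤E e<count = ℕₚ.≤-pred (≡.subst (_ ℕ.<_) count e<count)

      isSchedule : ∀ e → e ℕ.≤ E → IsSchedule (schedule e)
      isSchedule e e≤E = ≡.trans (jobs-cong λ i → written e e≤E (toℕ i) (Finₚ.toℕ<n i))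
        (≡.trans (jobs-toℕ (suc d′) (Spec.given (b ℕ.^ e))) (Σgiven (ℕₚ.m^n>0 b {{ℕ.>-nonZero (ℕₚ.<-≤-trans z<s 2≤b)}} e)))

    programPortfolio : ∃₂ λ t s → Run (compile program) (input n q a) t s × t ℕ.≤ exponent ℕ.* inputSize n q a ℕ.^ exponent ×
                       IsGoodPortfolio 1# I α (map loads (output (suc d′) s))
    programPortfolio = conclude execution
      where
      conclude : (∃₂ λ t s → Run (compile program) (input n q a) t s × t ℕ.≤ exponent ℕ.* inputSize n q a ℕ.^ exponent × Result s) →
                 ∃₂ λ t s → Run (compile program) (input n q a) t s × t ℕ.≤ exponent ℕ.* inputSize n q a ℕ.^ exponent × IsGoodPortfolio 1# I α (map loads (output (suc d′) s))
      conclude (t , s , r , t≤ , res) = t , s , r , t≤ , goodOutput res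

theorem1 :
  (R : RealField) (L : NaturalLog R) →
  let open RealField R
      open NaturalLog L
      open Portfolios R L
      open MLIJ
      open Machine
  in
  (∃ λ (K : Carrier) →
    (∀ d → .{{_ : NonZero d}} → (I : MLIJ d) (α : Carrier) → fromℕ 4 < α →
       ∃ λ (X : List (Point d)) → IsGoodPortfolio K I α X)
    ×
    (∃₂ λ (program : Cmd) (k : ℕ) →
       ∀ d → .{{_ : NonZero d}} → (I : MLIJ d) (α : Carrier) → fromℕ 4 < α →
       (q : Vector ℚ d) (a : ℚ) → (∀ i → p I i ≈ fromℚ (q i)) → α ≈ fromℚ a →
       ∃₂ λ (t : ℕ) (s : Store) →
         Run program (input (n I) q a) t s
         × t ℕ.≤ k ℕ.* inputSize (n I) q a ℕ.^ k
         × IsGoodPortfolio K I α (map (loads I) (output d s))))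
  ×
  (∃₂ λ (c : Carrier) (I : (d : ℕ) → MLIJ d) →
    0# < c
    × (∀ d → 3 ℕ.≤ d → (α : Carrier) → 1# ≤ α → (X : List (Point d)) →
         IsPortfolio (I d) IsOrderedNorm α X →
         c * (ln (fromℕ d) / (ln α + ln (ln (fromℕ d)))) ≤ fromℕ (length X)))
theorem1 R L =
  -- One constant, `1#`, serves for the size and for the factor, both in the existence statement and
  -- for the program.
  (RealField.1# R , Existence.existence R L ,
   CountedPrograms.compile PortfolioProgram.program , ProgramCorrectness.exponent ,
   λ { (suc d) I α 4<α q a p≈q α≈a → ProgramPortfolio.programPortfolio R L I 4<α q a p≈q α≈a }) ,
  (LowerBound.constant R L , LowerBound.family R L , LowerBound.0<constant R L , LowerBound.lowerBound R L)
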